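{- Let $m,b,k\in\mathbb{Z}$ with $|m|\ge 2$, $b\ge 2$, $k\ge 1$, and set $n=2$. Assume that $\gcd(b,m)=1$, that $b$ is squarefree, and that $m\equiv 0 \pmod{\mathrm{rad}(k)}$. Let $$\mathcal{D}:=\frac{n^n(1-bm^{2n})^{n+1}+bm^{2n}(n+1)^{n+1}}{(1+bm^{2n}n)^2}\in\mathbb{Z}\qquad (\text{with } n=2),$$ and assume that $$d:=\frac{|\mathcal{D}|}{\prod_{p\text{ prime},\ p\mid bm}p^{\nu_p(\mathcal{D})}}$$ is squarefree. Then the trinomial $$\mathcal{F}_{2,b,m,k}(x)=x^{2k}+bm^2x^k+b$$ is monogenic if and only if both of the following hold: (1) no odd prime divisor of $k$ is a base-$b$ Wieferich prime; and (2) if $m\equiv 0\pmod 2$, then $b\equiv 1\pmod 4$ (equivalently, $2$ is a base-$b$ Wieferich prime).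
   Context: For an integer $b\ge 2$, a prime $p\ge 2$ is called a base-$b$ Wieferich prime if $b^{p-1}\equiv 1\pmod{p^2}$. A monic polynomial $f(x)\in\mathbb{Z}[x]$ is called monogenic if $f(x)$ is irreducible over $\mathbb{Q}$ and $\{1,\theta,\theta^2,\ldots,\theta^{\deg(f)-1}\}$ is a basis (over $\mathbb{Z}$) for the ring of integers of $\mathbb{Q}(\theta)$, where $f(\theta)=0$. Here $\mathrm{rad}(1)=1$ and, for $k\ge 2$, $\mathrm{rad}(k)$ is the product of the distinct prime divisors of $k$; $\nu_p(z)$ denotes the $p$-adic valuation of the integer $z$. The quantity $\mathcal{D}$ is always an integer. -}

module Defs where

open import Algebra.Bundles using (RawRing)
import Algebra.Definitions.RawSemiring as RawSemiringDefs
open import Data.Fin using (Fin; toℕ)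
open import Data.Integer as ℤ using (ℤ; +_; ∣_∣)
open import Data.Integer.Solver using (module +-*-Solver)
open import Data.List using (List; []; _∷_; map; filter; foldr; upTo)
open import Data.Nat as ℕ using (ℕ; zero; suc; _<_; _⊔_)
open import Data.Nat.Divisibility using (_∣_; _∣?_)
open import Data.Nat.ListAction using (product)
open import Data.Nat.Primality using (Prime; prime?)
open import Data.Product using (Σ-syntax; ∃; _×_)
open import Data.Rational as ℚ using (ℚ)
open import Data.Vec.Functional using (Vector)
open import Level using (0ℓ)
open import Relation.Binary.PropositionalEquality using (_≡_; refl)
open import Relation.Nullary.Decidable using (_×-dec_)

Squarefree : ℕ → Set
Squarefree n = ∀ d → d ℕ.* d ∣ n → d ≡ 1

-- The list of distinct primes dividing n, for n ≢ 0.
primeDivisors : ℕ → List ℕ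
primeDivisors n = filter (λ p → prime? p ×-dec (p ∣? n)) (upTo (suc n))

rad : ℕ → ℕ
rad n = product (primeDivisors n)

-- The largest e with p ^ e ∣ z.  For p ≥ 2 and z ≢ 0 the search bound
-- loses nothing, as p ^ e ∣ z forces e < p ^ e ≤ ∣ z ∣.
ν : ℕ → ℤ → ℕ
ν p z = foldr _⊔_ 0 (filter (λ e → (p ℕ.^ e) ∣? ∣ z ∣) (upTo (suc ∣ z ∣)))

Wieferich : ℕ → ℕ → Set
Wieferich b p = Prime p × p ℕ.^ 2 ∣ ∣ (+ b) ℤ.^ (p ℕ.∸ 1) ℤ.- + 1 ∣

module _ (n b : ℕ) (m : ℤ) where

  private
    t : ℤ
    t = + b ℤ.* m ℤ.^ (2 ℕ.* n)

  𝒟-numerator : ℤ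
  𝒟-numerator = (+ n) ℤ.^ n ℤ.* (+ 1 ℤ.- t) ℤ.^ (n ℕ.+ 1)
                ℤ.+ t ℤ.* (+ (n ℕ.+ 1)) ℤ.^ (n ℕ.+ 1)

  𝒟-denominator : ℤ
  𝒟-denominator = (+ 1 ℤ.+ t ℤ.* + n) ℤ.^ 2

  -- D = 𝒟-numerator / 𝒟-denominator.  As m ^ 2n ≥ 0 the denominator is
  -- positive, so D is unique.
  Is𝒟 : ℤ → Set
  Is𝒟 D = D ℤ.* 𝒟-denominator ≡ 𝒟-numerator

𝒟-integral : ∀ b m → Is𝒟 2 b m (+ 4 ℤ.- + b ℤ.* m ℤ.^ 4)
𝒟-integral b m = solve 1
  (λ t → (con (+ 4) :- t) :* (con (+ 1) :+ t :* con (+ 2)) :^ 2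
         := con (+ 4) :* (con (+ 1) :- t) :^ 3 :+ t :* con (+ 27))
  refl (+ b ℤ.* m ℤ.^ 4)
  where open +-*-Solver

bmPart : ℕ → ℤ → ℤ → ℕ
bmPart b m D = product (map (λ p → p ℕ.^ ν p D) (primeDivisors (b ℕ.* ∣ m ∣)))

-- d = ∣ D ∣ / bmPart b m D.  The divisor is positive, so d is unique.
IsReduced𝒟 : ℕ → ℤ → ℤ → ℕ → Set
IsReduced𝒟 b m D d = d ℕ.* bmPart b m D ≡ ∣ D ∣

-- A polynomial is the list of its coefficients, constant term first.
-- Trailing zeros are allowed, hence equality is coefficientwise.
module Polynomial {c ℓ} (R : RawRing c ℓ) where
  open RawRing R

  coeff : List Carrier → ℕ → Carrier
  coeff []      _       = 0#
  coeff (a ∷ p) zero    = a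
  coeff (a ∷ p) (suc i) = coeff p i

  add : List Carrier → List Carrier → List Carrier
  add []      q       = q
  add (a ∷ p) []      = a ∷ p
  add (a ∷ p) (b ∷ q) = a + b ∷ add p q

  mul : List Carrier → List Carrier → List Carrier
  mul []      q = []
  mul (a ∷ p) q = add (map (a *_) q) (0# ∷ mul p q)

  polynomialRing : RawRing c ℓ
  polynomialRing = record
    { Carrier = List Carrier
    ; _≈_     = λ p q → ∀ i → coeff p i ≈ coeff q i
    ; _+_     = add
    ; _*_     = mul
    ; -_      = map -_
    ; 0#      = []
    ; 1#      = 1# ∷ []
    }

  X : List Carrier
  X = 0# ∷ 1# ∷ []

  const : Carrier → List Carrier
  const a = a ∷ []

  MonicOfDegree : ℕ → List Carrier → Set ℓ
  MonicOfDegree n p = coeff p n ≈ 1# × (∀ i → n < i → coeff p i ≈ 0#)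

module ℤ[x] where
  open Polynomial ℤ.+-*-rawRing public
  open RawRing polynomialRing public
  open RawSemiringDefs rawSemiring public using (_^_)

module ℚ[x] where
  open Polynomial ℚ.+-*-rawRing public
  open RawRing polynomialRing public
  open RawSemiringDefs rawSemiring public using (_^_; Irreducible)
    renaming (_∣_ to _divides_)

ℤ⇒ℚ : ℤ → ℚ
ℤ⇒ℚ a = a ℚ./ 1

ℤ[x]⇒ℚ[x] : ℤ[x].Carrier → ℚ[x].Carrier
ℤ[x]⇒ℚ[x] = map ℤ⇒ℚ

IrreducibleOverℚ : ℤ[x].Carrier → Set
IrreducibleOverℚ f = ℚ[x].Irreducible (ℤ[x]⇒ℚ[x] f)

-- The ring ℚ(θ) = ℚ[x] / (f), where θ is the class of x; a field when f
-- is irreducible over ℚ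

module Adjoin (f : ℤ[x].Carrier) where

  ℚ⟨θ⟩ : RawRing 0ℓ 0ℓ
  ℚ⟨θ⟩ = record
    { Carrier = ℚ[x].Carrier
    ; _≈_     = λ g h → ℤ[x]⇒ℚ[x] f ℚ[x].divides (g ℚ[x].+ (ℚ[x].- h))
    ; _+_     = ℚ[x]._+_
    ; _*_     = ℚ[x]._*_
    ; -_      = ℚ[x].-_
    ; 0#      = ℚ[x].0#
    ; 1#      = ℚ[x].1#
    }

  open RawRing ℚ⟨θ⟩
  open RawSemiringDefs rawSemiring using (sum; _^_)

  θ : Carrier
  θ = ℚ[x].X

  fromℤ : ℤ → Carrier
  fromℤ a = ℚ[x].const (ℤ⇒ℚ a)

  eval : ℤ[x].Carrier → Carrier → Carrier
  eval []      α = 0#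
  eval (a ∷ g) α = fromℤ a + α * eval g α

  -- The ring of integers is the set of integral elements of ℚ⟨θ⟩.
  Integral : Carrier → Set
  Integral α = Σ[ g ∈ ℤ[x].Carrier ]
    (∃ λ n → ℤ[x].MonicOfDegree n g) × eval g α ≈ 0#

  combination : ∀ {n} → Vector ℤ n → Vector Carrier n → Carrier
  combination a v = sum (λ i → fromℤ (a i) * v i)

  record IsIntegralBasis {n} (v : Vector Carrier n) : Set where
    field
      integral    : ∀ i → Integral (v i)
      spanning    : ∀ α → Integral α → ∃ λ a → α ≈ combination a v
      independent : ∀ a → combination a v ≈ 0# → ∀ i → a i ≡ + 0

  powers : ∀ n → Vector Carrier n
  powers n i = θ ^ toℕ i

record Monogenic (f : ℤ[x].Carrier) : Set where
  open Adjoin f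
  field
    degree      : ℕ
    monic       : ℤ[x].MonicOfDegree degree f
    irreducible : IrreducibleOverℚ f
    basis       : IsIntegralBasis (powers degree)

ℱ₂ : ℕ → ℤ → ℕ → ℤ[x].Carrier
ℱ₂ b m k = X ^ (2 ℕ.* k) + const (ℤ.+ b ℤ.* m ℤ.^ 2) * X ^ k + const (ℤ.+ b)
  where open ℤ[x]

{-# OPTIONS --safe #-}
module Submission where

-- Write f = x^(2k) + b m² x^k + b.  It is Eisenstein at every prime of b, so
-- only the integral closure of ℤ[θ] matters, one prime p at a time.
-- In each case f = r^e + p F with a monic r that is squarefree modulo p,
-- and F is congruent to a constant c modulo (p, r), the value of f / p at a
-- root of r.  If p ∤ c then (p, r) is locally principal, and ℤ[θ] is
-- p-maximal.  If p ∣ c and e ≥ 2 then r^(e-1) / p is an integral element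
-- outside ℤ[θ].  The choices are
--   p ∣ b                 r = x,            e = 2k
--   p ∣ k odd             r = x^(2k/q) + b, e = q = p^ν(k), c = - (b^q - b) / p
--   p = 2 ∣ m             r = x^(k/q) + 1,  e = 2 q, q = 2^ν(k), c = (1 + b) / 2
--   p ∤ b k, p ∤ D        r = f - p,        e = 1
--   p ∤ 2 b m k, p ∣ D    r = x^k + c₀,     e = 2, c₀ ≡ b m² / 2 (mod p²)
-- Squarefreeness of r enters as x^(p^N) ≡ x modulo (p, r): Frobenius then
-- fixes ℤ[x] / (p, r), which is therefore reduced.

open import Defs
open import Algebra.Bundles using (CommutativeRing; RawRing)
open import Algebra.Definitions.RawMagma using (_,_; module _∣ʳ_)
open import Algebra.Morphism.Structures using (IsRingHomomorphism)
open import Algebra.Solver.Ring.AlmostCommutativeRing using (AlmostCommutativeRing; fromCommutativeRing; _-Raw-AlmostCommutative⟶_)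
open import Data.Fin as Fin using (Fin; zero; suc; toℕ; fromℕ; fromℕ<; inject₁; splitAt)
import Data.Fin.Properties as Finₚ
open import Data.Integer as ℤ using (ℤ; +_; -[1+_]; ∣_∣)
open import Data.Integer.Divisibility using () renaming (_∣_ to _∣ℤ_)
open import Data.Integer.Divisibility.Signed as Signed using (divides; ∣ᵤ⇒∣; ∣⇒∣ᵤ) renaming (_∣_ to _∣ˢ_; _∣?_ to _∣ˢ?_)
open import Data.Integer.GCD using (gcd)
import Data.Integer.Properties as ℤₚ
open import Data.Integer.Solver using (module +-*-Solver)
open import Data.List as List using (List; []; _∷_; map)
open import Data.List.Membership.Propositional.Properties using (∈-filter⁺; ∈-upTo⁺)
open import Data.List.Relation.Unary.All using (All; []; _∷_)
open import Data.List.Relation.Unary.All.Properties using (all-filter)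
open import Data.Maybe using (Maybe; just; nothing)
open import Data.Nat as ℕ using (ℕ; zero; suc; _≤_; _<_; z≤n; s≤s; _!)
open import Data.Nat.Combinatorics using (_C_; nCk≡n!/k![n-k]!; k![n∸k]!∣n!; nCn≡1)
open import Data.Nat.Coprimality as Coprimality using (Coprime; coprime-divisor)
open import Data.Nat.Divisibility as ℕ∣ using (_∣_; _∤_; _∣?_)
open import Data.Nat.DivMod using (_/_; _%_; m%n<n; m/n*n≡m; m≡m%n+[m/n]*n)
import Data.Nat.GCD as ℕGCD
open import Data.Nat.Induction using (<-wellFounded; Acc; acc)
open import Data.Nat.ListAction using (product)
open import Data.Nat.ListAction.Properties using (∈⇒∣product)
open import Data.Nat.Primality using (Prime; euclidsLemma; prime?; prime[2]; prime⇒irreducible; prime⇒nonTrivial; prime⇒nonZero)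
open import Data.Nat.Primality.Factorisation using (factorise; PrimeFactorisation)
import Data.Nat.Properties as ℕₚ
open import Data.Nat.Solver using () renaming (module +-*-Solver to ℕ-Solver)
open import Data.Product using (∃; ∃₂; _×_; _,_; proj₁; proj₂)
open import Data.Rational as ℚ using (ℚ; mkℚ; toℚᵘ)
import Data.Rational.Properties as ℚₚ
open import Data.Rational.Unnormalised as ℚᵘ using (mkℚᵘ; *≡*) renaming (_≃_ to _≃ᵘ_)
import Data.Rational.Unnormalised.Properties as ℚᵘₚ
open import Data.Sum as Sum using (_⊎_; inj₁; inj₂; [_,_]′)
open import Data.Vec.Functional using (Vector; _++_)
open import Function using (_∘_; id)
open import Function.Bundles using (_⇔_; mk⇔)
open import Level using (0ℓ)
open import Relation.Binary.Definitions using (tri<; tri≈; tri>)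
open import Relation.Binary.PropositionalEquality as ≡ using (_≡_; _≢_; subst)
open import Relation.Nullary using (Dec; yes; no; ¬_; contradiction)
open import Relation.Nullary.Decidable using (_×-dec_; toWitnessFalse)

-- Why these c. If an odd p divides k, then p divides m and p² divides b m², so the middle term
-- drops out of f / p modulo p, and x^(2k) = (- b)^q at a root of r leaves - (b^q - b) / p. Since
-- b^(p^j) ≡ b modulo p gives b^(p^(j+1)) ≡ b^p modulo p², the vanishing of c modulo p does not
-- depend on ν and is the Wieferich condition. At 2 the value of x^(2k) is 1, and 1 + b modulo 4
-- decides. At an odd prime p of D prime to b m k the value of f at the double root is b D / 4
-- modulo p⁴, and squarefreeness of d keeps c prime to p. Local principality is used through
-- elements only. An integral element is written h / (p M), a root of a monic g, and h is pushed
-- through the ideals (p, r^i) until (p, r^e) = (p), as r^e is a multiple of p in ℤ[θ]. Inverting F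
-- at (p, r) is replaced by the fact that z = p y z forces z = 0 in ℤ[θ].

-- Algebras over ℤ and their quotients

record ℤ-Algebra : Set₁ where
  field
    commutativeRing : CommutativeRing 0ℓ 0ℓ

  open CommutativeRing commutativeRing public hiding (zero)

  field
    int            : ℤ → Carrier
    isHomomorphism : IsRingHomomorphism ℤ.+-*-rawRing rawRing int

  open IsRingHomomorphism isHomomorphism public
    using (+-homo; *-homo; -‿homo; 0#-homo; 1#-homo)

  open import Algebra.Definitions.RawSemiring (RawRing.rawSemiring rawRing) public using () renaming (_∣_ to _∣ᴿ_)
  open import Algebra.Properties.Semiring.Exp semiring public
    using (_^_; ^-congˡ; ^-homo-*; ^-assocʳ)

  ^-congᵉ : ∀ x {m n} → m ≡ n → x ^ m ≈ x ^ n
  ^-congᵉ x ≡.refl = refl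

  int-cong : ∀ {a b} → a ≡ b → int a ≈ int b
  int-cong ≡.refl = refl

  int-^ : ∀ a n → int (a ℤ.^ n) ≈ int a ^ n
  int-^ a zero    = 1#-homo
  int-^ a (suc n) = trans (*-homo a (a ℤ.^ n)) (*-congˡ (int-^ a n))

module Solver (A : ℤ-Algebra) where
  open ℤ-Algebra A

  private
    R : AlmostCommutativeRing 0ℓ 0ℓ
    R = fromCommutativeRing commutativeRing

    morphism : ℤ.+-*-rawRing -Raw-AlmostCommutative⟶ R
    morphism = record
      { ⟦_⟧    = int
      ; +-homo = +-homo
      ; *-homo = *-homo
      ; -‿homo = -‿homo
      ; 0-homo = 0#-homo
      ; 1-homo = 1#-homo
      }

    _≟_ : ∀ a b → Maybe (int a ≈ int b)
    a ≟ b with a ℤₚ.≟ b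
    ... | yes a≡b = just (int-cong a≡b)
    ... | no _    = nothing

  open import Algebra.Solver.Ring ℤ.+-*-rawRing R morphism _≟_ public
    using (solve; _:=_; _:+_; _:*_; _:-_; :-_; _:^_; con)

-- A quotient keeps the carrier and coarsens only the equality. A polynomial is thus at the same
-- time an element of ℤ[x], of ℤ[θ] and of ℤ[x] / (p, r), and no projection maps occur.
module Quotient (A : ℤ-Algebra) where
  open ℤ-Algebra A
  open Solver A

  record IsIdeal (I : Carrier → Set) : Set where
    field
      resp   : ∀ {x y} → x ≈ y → I x → I y
      zeroᴵ  : I 0#
      plus   : ∀ {x y} → I x → I y → I (x + y)
      absorb : ∀ z {x} → I x → I (z * x)

  module _ {I : Carrier → Set} (isIdeal : IsIdeal I) where
    open IsIdeal isIdeal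

    infix 4 _∼_
    _∼_ : Carrier → Carrier → Set
    x ∼ y = I (x + - y)

    ≈⇒≈/ : ∀ {x y} → x ≈ y → x ∼ y
    ≈⇒≈/ {x} {y} x≈y = resp (sym (trans (+-congʳ x≈y) (-‿inverseʳ y))) zeroᴵ

    private
      neg : ∀ {x} → I x → I (- x)
      neg {x} i = resp (solve 1 (λ x → con (ℤ.- (+ 1)) :* x := :- x) refl x) (absorb (int (ℤ.- (+ 1))) i)

    quotientRing : CommutativeRing 0ℓ 0ℓ
    quotientRing = record
      { Carrier = Carrier ; _≈_ = _∼_ ; _+_ = _+_ ; _*_ = _*_ ; -_ = -_ ; 0# = 0# ; 1# = 1#
      ; isCommutativeRing = record
        { isRing = record
          { +-isAbelianGroup = record
            { isGroup = record
              { isMonoid = record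
                { isSemigroup = record
                  { isMagma = record
                    { isEquivalence = record
                      { refl  = ≈⇒≈/ refl
                      ; sym   = λ {x} {y} i → resp (solve 2 (λ x y → :- (x :- y) := y :- x) refl x y) (neg i)
                      ; trans = λ {x} {y} {z} i j →
                          resp (solve 3 (λ x y z → (x :- y) :+ (y :- z) := x :- z) refl x y z) (plus i j) }
                    ; ∙-cong = λ {x} {y} {u} {v} i j →
                        resp (solve 4 (λ x y u v → (x :- y) :+ (u :- v) := (x :+ u) :- (y :+ v))
                            refl x y u v) (plus i j) }
                  ; assoc = λ x y z → ≈⇒≈/ (+-assoc x y z) }
                ; identity = (λ x → ≈⇒≈/ (+-identityˡ x)) , (λ x → ≈⇒≈/ (+-identityʳ x)) }
              ; inverse = (λ x → ≈⇒≈/ (-‿inverseˡ x)) , (λ x → ≈⇒≈/ (-‿inverseʳ x))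
              ; ⁻¹-cong = λ {x} {y} i → resp (solve 2 (λ x y → :- (x :- y) := :- x :- :- y) refl x y) (neg i) }
            ; comm = λ x y → ≈⇒≈/ (+-comm x y) }
          ; *-cong = λ {x} {y} {u} {v} i j →
              resp (solve 4 (λ x y u v → u :* (x :- y) :+ y :* (u :- v) := (x :* u) :- (y :* v)) refl x y u v)
                   (plus (absorb u i) (absorb y j))
          ; *-assoc = λ x y z → ≈⇒≈/ (*-assoc x y z)
          ; *-identity = (λ x → ≈⇒≈/ (*-identityˡ x)) , (λ x → ≈⇒≈/ (*-identityʳ x))
          ; distrib = (λ x y z → ≈⇒≈/ (distribˡ x y z)) , (λ x y z → ≈⇒≈/ (distribʳ x y z)) }
        ; *-comm = λ x y → ≈⇒≈/ (*-comm x y) } }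

    quotient : ℤ-Algebra
    quotient = record
      { commutativeRing = quotientRing
      ; int             = int
      ; isHomomorphism  = record
        { isSemiringHomomorphism = record
          { isNearSemiringHomomorphism = record
            { +-isMonoidHomomorphism = record
              { isMagmaHomomorphism = record
                { isRelHomomorphism = record { cong = λ {a} {b} eq → ≈⇒≈/ (int-cong eq) }
                ; homo = λ a b → ≈⇒≈/ (+-homo a b) }
              ; ε-homo = ≈⇒≈/ 0#-homo }
            ; *-homo = λ a b → ≈⇒≈/ (*-homo a b) }
          ; 1#-homo = ≈⇒≈/ 1#-homo }
        ; -‿homo = λ a → ≈⇒≈/ (-‿homo a) } }

    -- Powers recurse over the whole ring structure, and the two structures differ in their
    -- equality. For a variable exponent the powers therefore agree only by induction, and this
    -- equation has to be transported along wherever a power changes rings.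
    ^-quotient : ∀ x n → ℤ-Algebra._^_ quotient x n ≡ x ^ n
    ^-quotient x zero    = ≡.refl
    ^-quotient x (suc n) = ≡.cong (x *_) (^-quotient x n)

    private
      x-0≈x : ∀ x → x + - 0# ≈ x
      x-0≈x x = trans (+-congˡ ε⁻¹≈ε) (+-identityʳ x)
        where open import Algebra.Properties.Group +-group using (ε⁻¹≈ε)

    ∈⇒≈0 : ∀ {x} → I x → x ∼ 0#
    ∈⇒≈0 {x} = resp (sym (x-0≈x x))

    ≈0⇒∈ : ∀ {x} → x ∼ 0# → I x
    ≈0⇒∈ {x} = resp (x-0≈x x)

  Span₂ : Carrier → Carrier → Carrier → Set
  Span₂ p r x = ∃₂ λ a b → x ≈ p * a + r * b

  principal-isIdeal : ∀ f → IsIdeal (f ∣ᴿ_)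
  principal-isIdeal f = record
    { resp   = λ { x≈y (q , e) → q , trans e x≈y }
    ; zeroᴵ  = 0# , zeroˡ f
    ; plus   = λ { (q , e) (q′ , e′) → q + q′ , trans (distribʳ f q q′) (+-cong e e′) }
    ; absorb = λ { z (q , e) → z * q , trans (*-assoc z q f) (*-congˡ e) } }

  Span₂-isIdeal : ∀ p r → IsIdeal (Span₂ p r)
  Span₂-isIdeal p r = record
    { resp   = λ { x≈y (a , b , e) → a , b , trans (sym x≈y) e }
    ; zeroᴵ  = 0# , 0# , sym (trans (+-cong (zeroʳ p) (zeroʳ r)) (+-identityˡ 0#))
    ; plus   = λ { (a , b , e) (a′ , b′ , e′) → a + a′ , b + b′ , trans (+-cong e e′)
        (solve 6 (λ p r a b a′ b′ → (p :* a :+ r :* b) :+ (p :* a′ :+ r :* b′) := p :* (a :+ a′) :+ r :* (b :+ b′))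
          refl p r a b a′ b′) }
    ; absorb = λ { z (a , b , e) → z * a , z * b , trans (*-congˡ e)
        (solve 5 (λ p r a b z → z :* (p :* a :+ r :* b) := p :* (z :* a) :+ r :* (z :* b)) refl p r a b z) } }

  A/⟨_⟩ : Carrier → ℤ-Algebra
  A/⟨_⟩ f = quotient (principal-isIdeal f)

-- Frobenius

prime≥2 : ∀ {p} → Prime p → 2 ≤ p
prime≥2 {p} pr = ℕ.nonTrivial⇒n>1 p {{prime⇒nonTrivial pr}}

prime>0 : ∀ {p} → Prime p → 0 < p
prime>0 pr = ℕₚ.≤-trans (s≤s z≤n) (prime≥2 pr)

prime∤1 : ∀ {p} → Prime p → ¬ (p ∣ 1)
prime∤1 pr p∣1 = ℕₚ.<⇒≱ (prime≥2 pr) (ℕ∣.∣⇒≤ p∣1)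

prime∣n!⇒≤ : ∀ {p} → Prime p → ∀ n → p ∣ n ! → p ≤ n
prime∣n!⇒≤ pr zero    p∣ = contradiction p∣ (prime∤1 pr)
prime∣n!⇒≤ pr (suc n) p∣ with euclidsLemma (suc n) (n !) pr p∣
... | inj₁ p∣n = ℕ∣.∣⇒≤ p∣n
... | inj₂ p∣n! = ℕₚ.m≤n⇒m≤1+n (prime∣n!⇒≤ pr n p∣n!)

-- p divides p! = C(p, k) k! (p - k)! but neither of the two factorials, whose factors are all below
-- p.
prime∣binomial : ∀ {p k} → Prime p → 0 < k → k < p → p ∣ p C k
prime∣binomial {p} {k} pr 0<k k<p with euclidsLemma (p C k) (k ! ℕ.* (p ℕ.∸ k) !) pr (subst (p ∣_) (≡.sym eq) p∣p!)
  where
  k≤p = ℕₚ.<⇒≤ k<p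
  instance _ = ℕₚ.m*n≢0 (k !) ((p ℕ.∸ k) !) {{ℕₚ._!≢0 k}} {{ℕₚ._!≢0 (p ℕ.∸ k)}}
  eq : (p C k) ℕ.* (k ! ℕ.* (p ℕ.∸ k) !) ≡ p !
  eq = ≡.trans (≡.cong (ℕ._* (k ! ℕ.* (p ℕ.∸ k) !)) (nCk≡n!/k![n-k]! k≤p)) (m/n*n≡m (k![n∸k]!∣n! k≤p))
  p∣p! : p ∣ p !
  p∣p! = go p (ℕₚ.<-trans 0<k k<p)
    where
    go : ∀ n → 0 < n → n ∣ n !
    go (suc n) _ = ℕ∣.∣m⇒∣m*n (n !) ℕ∣.∣-refl
... | inj₁ p∣C = p∣C
... | inj₂ p∣k!l! with euclidsLemma (k !) ((p ℕ.∸ k) !) pr p∣k!l!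
...   | inj₁ p∣k! = contradiction (prime∣n!⇒≤ pr k p∣k!) (ℕₚ.<⇒≱ k<p)
...   | inj₂ p∣l! = contradiction (prime∣n!⇒≤ pr (p ℕ.∸ k) p∣l!) (ℕₚ.<⇒≱ (ℕₚ.∸-monoʳ-< 0<k (ℕₚ.<⇒≤ k<p)))

n<b^n : ∀ {b} n → 2 ≤ b → n < b ℕ.^ n
n<b^n zero    2≤b = s≤s z≤n
n<b^n {b} (suc n) 2≤b = begin-strict
  suc n              ≤⟨ n<b^n n 2≤b ⟩
  b ℕ.^ n            <⟨ ℕₚ.m<m+n (b ℕ.^ n) (ℕₚ.≤-trans (s≤s z≤n) (n<b^n n 2≤b)) ⟩
  b ℕ.^ n ℕ.+ b ℕ.^ n  ≡⟨ ≡.cong (b ℕ.^ n ℕ.+_) (≡.sym (ℕₚ.+-identityʳ (b ℕ.^ n))) ⟩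
  2 ℕ.* b ℕ.^ n      ≤⟨ ℕₚ.*-monoˡ-≤ (b ℕ.^ n) 2≤b ⟩
  b ℕ.* b ℕ.^ n ∎
  where open ℕₚ.≤-Reasoning

-- Horner induction for an algebra generated by x over ℤ. In the form of an induction principle it
-- passes to every quotient at once.
GeneratedBy : (A : ℤ-Algebra) → ℤ-Algebra.Carrier A → Set₁
GeneratedBy A x = (Q : Carrier → Set) → (∀ {s t} → s ≈ t → Q s → Q t) → Q 0# →
  (∀ a t → Q t → Q (int a + x * t)) → ∀ t → Q t
  where open ℤ-Algebra A

module Powers (A : ℤ-Algebra) where
  open ℤ-Algebra A
  open import Relation.Binary.Reasoning.Setoid setoid
  open import Algebra.Properties.CommutativeSemiring.Exp commutativeSemiring public using (^-distrib-*)

  1^n≈1 : ∀ n → 1# ^ n ≈ 1#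
  1^n≈1 zero    = refl
  1^n≈1 (suc n) = trans (*-identityˡ _) (1^n≈1 n)

  0^n≈0 : ∀ {n} → 0 < n → 0# ^ n ≈ 0#
  0^n≈0 {suc n} _ = zeroˡ _

  ^-≤-zero : ∀ {x m n} → m ≤ n → x ^ m ≈ 0# → x ^ n ≈ 0#
  ^-≤-zero {x} {m} {n} m≤n e = begin
    x ^ n                      ≈⟨ ^-congᵉ x (≡.sym (ℕₚ.m+[n∸m]≡n m≤n)) ⟩
    x ^ (m ℕ.+ (n ℕ.∸ m))      ≈⟨ ^-homo-* x m (n ℕ.∸ m) ⟩
    x ^ m * x ^ (n ℕ.∸ m)      ≈⟨ *-congʳ e ⟩
    0# * x ^ (n ℕ.∸ m)         ≈⟨ zeroˡ _ ⟩
    0# ∎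

  multiple-nilpotent : ∀ n {t} u X → t ≈ u * X → X ^ n ≈ 0# → t ^ n ≈ 0#
  multiple-nilpotent n {t} u X t≈uX X^n≈0 = begin
    t ^ n           ≈⟨ ^-congˡ n t≈uX ⟩
    (u * X) ^ n     ≈⟨ ^-distrib-* u X n ⟩
    u ^ n * X ^ n   ≈⟨ *-congˡ X^n≈0 ⟩
    u ^ n * 0#      ≈⟨ zeroʳ _ ⟩
    0# ∎

  1≈x^kn : ∀ {x k} n → x ^ k ≈ 1# → x ^ (k ℕ.* n) ≈ 1#
  1≈x^kn {x} {k} n e = trans (sym (^-assocʳ x k n)) (trans (^-congˡ n e) (1^n≈1 n))

module Characteristic (A : ℤ-Algebra) {p : ℕ} (pr : Prime p)
  (p≈0 : ℤ-Algebra._≈_ A (ℤ-Algebra.int A (+ p)) (ℤ-Algebra.0# A)) where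
  open ℤ-Algebra A
  open Solver A
  open Powers A
  open import Algebra.Properties.Semiring.Sum semiring using (sum; sum-cong-≋; sum-init-last; sum-replicate-zero)
  open import Algebra.Properties.Semiring.Mult semiring using () renaming (_×_ to _·_)
  import Algebra.Properties.CommutativeSemiring.Binomial commutativeSemiring as Binomial
  open import Relation.Binary.Reasoning.Setoid setoid

  ·≈int* : ∀ n x → n · x ≈ int (+ n) * x
  ·≈int* zero    x = sym (trans (*-congʳ 0#-homo) (zeroˡ x))
  ·≈int* (suc n) x = begin
    x + n · x                        ≈⟨ +-cong (sym (*-identityˡ x)) (·≈int* n x) ⟩
    1# * x + int (+ n) * x           ≈⟨ distribʳ x 1# (int (+ n)) ⟨
    (1# + int (+ n)) * x             ≈⟨ *-congʳ (+-congʳ 1#-homo) ⟨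
    (int (+ 1) + int (+ n)) * x      ≈⟨ *-congʳ (+-homo (+ 1) (+ n)) ⟨
    int (+ suc n) * x ∎

  p∣⇒int≈0 : ∀ {n} → p ∣ n → int (+ n) ≈ 0#
  p∣⇒int≈0 {n} (ℕ∣.divides q ≡.refl) = begin
    int (+ (q ℕ.* p))       ≈⟨ int-cong (ℤₚ.pos-* q p) ⟩
    int (+ q ℤ.* + p)       ≈⟨ *-homo (+ q) (+ p) ⟩
    int (+ q) * int (+ p)   ≈⟨ *-congˡ p≈0 ⟩
    int (+ q) * 0#          ≈⟨ zeroʳ _ ⟩
    0# ∎

  0<p : 0 < p
  0<p = prime>0 pr

  frobenius : ∀ x y → (x + y) ^ p ≈ x ^ p + y ^ p
  frobenius x y = go p ≡.refl
    where
    -- The exponent is generalised to q so that it can be matched as a successor, which splits off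
    -- both end terms of the binomial sum.
    go : ∀ q → p ≡ q → (x + y) ^ q ≈ x ^ q + y ^ q
    go zero    eq = contradiction (subst (0 <_) eq 0<p) λ ()
    go (suc q) eq = begin
      (x + y) ^ suc q                                    ≈⟨ Binomial.theorem (suc q) x y ⟩
      sum t                                              ≡⟨⟩
      t Fin.zero + sum (t ∘ Fin.suc)                     ≈⟨ +-congˡ (sum-init-last (t ∘ Fin.suc)) ⟩
      t Fin.zero + (sum middle + t (Fin.suc (fromℕ q)))
        ≈⟨ +-cong first (+-cong (trans (sum-cong-≋ middle≈0) (sum-replicate-zero q)) final) ⟩
      y ^ suc q + (0# + x ^ suc q)                       ≈⟨ +-congˡ (+-identityˡ _) ⟩
      y ^ suc q + x ^ suc q                              ≈⟨ +-comm _ _ ⟩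
      x ^ suc q + y ^ suc q ∎
      where
      t : Fin (suc (suc q)) → Carrier
      t = Binomial.binomialTerm x y (suc q)
      middle : Fin q → Carrier
      middle i = t (Fin.suc (inject₁ i))
      middle≈0 : ∀ i → middle i ≈ 0#
      middle≈0 i = trans (·≈int* (suc q C k) z) (trans (*-congʳ (p∣⇒int≈0 p∣C)) (zeroˡ z))
        where
        k = suc (toℕ (inject₁ i))
        z = x ^ k * y ^ (suc q ℕ.∸ k)
        p∣C : p ∣ suc q C k
        p∣C = subst (λ n → p ∣ n C k) eq (prime∣binomial pr (s≤s z≤n)
          (subst (k <_) (≡.sym eq) (s≤s (subst (_< q) (≡.sym (Finₚ.toℕ-inject₁ i)) (Finₚ.toℕ<n i)))))
      first : t Fin.zero ≈ y ^ suc q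
      first = begin
        1 · (1# * y ^ suc q)  ≈⟨ +-identityʳ _ ⟩
        1# * y ^ suc q        ≈⟨ *-identityˡ _ ⟩
        y ^ suc q ∎
      final : t (Fin.suc (fromℕ q)) ≈ x ^ suc q
      final rewrite Finₚ.toℕ-fromℕ q | nCn≡1 (suc q) | ℕₚ.n∸n≡0 q = begin
        1 · (x ^ suc q * 1#)  ≈⟨ +-identityʳ _ ⟩
        x ^ suc q * 1#        ≈⟨ *-identityʳ _ ⟩
        x ^ suc q ∎

  frobeniusᴺ : ∀ N x y → (x + y) ^ (p ℕ.^ N) ≈ x ^ (p ℕ.^ N) + y ^ (p ℕ.^ N)
  frobeniusᴺ zero    x y = trans (*-identityʳ _) (+-cong (sym (*-identityʳ x)) (sym (*-identityʳ y)))
  frobeniusᴺ (suc N) x y = begin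
    (x + y) ^ (p ℕ.* p ℕ.^ N)          ≈⟨ ^-assocʳ (x + y) p (p ℕ.^ N) ⟨
    ((x + y) ^ p) ^ (p ℕ.^ N)          ≈⟨ ^-congˡ (p ℕ.^ N) (frobenius x y) ⟩
    (x ^ p + y ^ p) ^ (p ℕ.^ N)        ≈⟨ frobeniusᴺ N (x ^ p) (y ^ p) ⟩
    (x ^ p) ^ (p ℕ.^ N) + (y ^ p) ^ (p ℕ.^ N)    ≈⟨ +-cong (^-assocʳ x p (p ℕ.^ N)) (^-assocʳ y p (p ℕ.^ N)) ⟩
    x ^ (p ℕ.* p ℕ.^ N) + y ^ (p ℕ.* p ℕ.^ N) ∎

  fermat⁺ : ∀ n → int (+ n) ^ p ≈ int (+ n)
  fermat⁺ zero       = trans (^-congˡ p 0#-homo) (trans (0^n≈0 0<p) (sym 0#-homo))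
  fermat⁺ (suc n)    = begin
    int (+ 1 ℤ.+ + n) ^ p         ≈⟨ ^-congˡ p (+-homo (+ 1) (+ n)) ⟩
    (int (+ 1) + int (+ n)) ^ p   ≈⟨ frobenius _ _ ⟩
    int (+ 1) ^ p + int (+ n) ^ p
      ≈⟨ +-cong (trans (^-congˡ p 1#-homo) (trans (1^n≈1 p) (sym 1#-homo))) (fermat⁺ n) ⟩
    int (+ 1) + int (+ n)         ≈⟨ +-homo (+ 1) (+ n) ⟨
    int (+ suc n) ∎
  fermat : ∀ a → int a ^ p ≈ int a
  fermat (+ n)    = fermat⁺ n
  -- (- n)^p + n^p = (- n + n)^p = 0 settles the negative case without the sign (- 1)^p, so p = 2 is
  -- no exception.
  fermat -[1+ n ] = begin
    int -[1+ n ] ^ p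
      ≈⟨ solve 2 (λ u v → u := (u :+ v) :- v) refl _ (int (+ suc n)) ⟩
    (int -[1+ n ] ^ p + int (+ suc n)) + - int (+ suc n) ≈⟨ +-congʳ zero-sum ⟩
    0# + - int (+ suc n)                                 ≈⟨ +-identityˡ _ ⟩
    - int (+ suc n)                                      ≈⟨ -‿homo (+ suc n) ⟨
    int -[1+ n ] ∎
    where
    zero-sum : int -[1+ n ] ^ p + int (+ suc n) ≈ 0#
    zero-sum = begin
      int -[1+ n ] ^ p + int (+ suc n)       ≈⟨ +-congˡ (fermat⁺ (suc n)) ⟨
      int -[1+ n ] ^ p + int (+ suc n) ^ p   ≈⟨ frobenius _ _ ⟨
      (int -[1+ n ] + int (+ suc n)) ^ p     ≈⟨ ^-congˡ p (+-homo -[1+ n ] (+ suc n)) ⟨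
      int (-[1+ n ] ℤ.+ + suc n) ^ p         ≈⟨ ^-congˡ p (int-cong (ℤₚ.+-inverseˡ (+ suc n))) ⟩
      int (+ 0) ^ p                          ≈⟨ ^-congˡ p 0#-homo ⟩
      0# ^ p                                 ≈⟨ 0^n≈0 0<p ⟩
      0# ∎

  fermatᴺ : ∀ N a → int a ^ (p ℕ.^ N) ≈ int a
  fermatᴺ zero    a = *-identityʳ _
  fermatᴺ (suc N) a = trans (sym (^-assocʳ (int a) p (p ℕ.^ N))) (trans (^-congˡ (p ℕ.^ N) (fermat a)) (fermatᴺ N a))

  module _ {x : Carrier} (gen : GeneratedBy A x) (N : ℕ) (0<N : 0 < N) (fixed : x ^ (p ℕ.^ N) ≈ x) where

    private
      q : ℕ
      q = p ℕ.^ N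

    -- The map t ↦ t^q is a ring endomorphism that fixes the integers and x, and these generate the
    -- algebra.
    frobenius-fixes : ∀ t → t ^ q ≈ t
    frobenius-fixes = gen (λ t → t ^ q ≈ t)
      (λ {s} {t} s≈t e → trans (^-congˡ q (sym s≈t)) (trans e s≈t))
      (0^n≈0 (ℕₚ.m^n>0 p {{prime⇒nonZero pr}} N))
      λ a t e → begin
        (int a + x * t) ^ q     ≈⟨ frobeniusᴺ N _ _ ⟩
        int a ^ q + (x * t) ^ q ≈⟨ +-cong (fermatᴺ N a) (^-distrib-* x t q) ⟩
        int a + x ^ q * t ^ q   ≈⟨ +-congˡ (*-cong fixed e) ⟩
        int a + x * t ∎

    -- t equals t^(q^n), and q^n exceeds n, so that power of a t with t^n = 0 vanishes.
    reduced : ∀ n t → t ^ n ≈ 0# → t ≈ 0#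
    reduced n t e = trans (sym (iterate n)) (^-≤-zero (ℕₚ.<⇒≤ (n<b^n n 2≤q)) e)
      where
      2≤q : 2 ≤ q
      2≤q = ℕₚ.≤-trans (prime≥2 pr) (ℕₚ.≤-trans (ℕₚ.≤-reflexive (≡.sym (ℕₚ.^-identityʳ p)))
        (ℕₚ.^-monoʳ-≤ p {{prime⇒nonZero pr}} 0<N))
      iterate : ∀ j → t ^ (q ℕ.^ j) ≈ t
      iterate zero    = *-identityʳ t
      iterate (suc j) = trans (sym (^-assocʳ t q (q ℕ.^ j))) (trans (^-congˡ (q ℕ.^ j) (frobenius-fixes t)) (iterate j))

-- Polynomial rings

module PolynomialAlgebra (R : ℤ-Algebra) where
  open ℤ-Algebra R hiding (_-_)
  open Solver R
  open Polynomial rawRing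
  open import Relation.Binary.Reasoning.Setoid setoid

  infix 4 _≋_
  _≋_ : List Carrier → List Carrier → Set
  p ≋ q = ∀ i → coeff p i ≈ coeff q i

  coeff-add : ∀ p q i → coeff (add p q) i ≈ coeff p i + coeff q i
  coeff-add []      q       i       = sym (+-identityˡ _)
  coeff-add (a ∷ p) []      i       = sym (+-identityʳ _)
  coeff-add (a ∷ p) (b ∷ q) zero    = refl
  coeff-add (a ∷ p) (b ∷ q) (suc i) = coeff-add p q i

  coeff-scale : ∀ a q i → coeff (map (a *_) q) i ≈ a * coeff q i
  coeff-scale a []      i       = sym (zeroʳ a)
  coeff-scale a (b ∷ q) zero    = refl
  coeff-scale a (b ∷ q) (suc i) = coeff-scale a q i

  coeff-neg : ∀ p i → coeff (map -_ p) i ≈ - coeff p i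
  coeff-neg []      i       = sym ε⁻¹≈ε
    where open import Algebra.Properties.Group +-group using (ε⁻¹≈ε)
  coeff-neg (a ∷ p) zero    = refl
  coeff-neg (a ∷ p) (suc i) = coeff-neg p i

  mul-zero : ∀ a p q → coeff (mul (a ∷ p) q) 0 ≈ a * coeff q 0
  mul-zero a p q = trans (coeff-add (map (a *_) q) _ 0) (trans (+-congʳ (coeff-scale a q 0)) (+-identityʳ _))

  mul-suc : ∀ a p q i → coeff (mul (a ∷ p) q) (suc i) ≈ a * coeff q (suc i) + coeff (mul p q) i
  mul-suc a p q i = trans (coeff-add (map (a *_) q) _ (suc i)) (+-congʳ (coeff-scale a q (suc i)))

  mul-zeroˡ : ∀ p q → p ≋ [] → mul p q ≋ []
  mul-zeroˡ []      q p≋0 i       = refl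
  mul-zeroˡ (a ∷ p) q p≋0 zero    = trans (mul-zero a p q) (trans (*-congʳ (p≋0 0)) (zeroˡ _))
  mul-zeroˡ (a ∷ p) q p≋0 (suc i) = trans (mul-suc a p q i) (trans (+-cong (trans (*-congʳ (p≋0 0)) (zeroˡ _))
    (mul-zeroˡ p q (λ i → p≋0 (suc i)) i)) (+-identityˡ _))

  mul-congʳ : ∀ p {q q′} → q ≋ q′ → mul p q ≋ mul p q′
  mul-congʳ []      e i       = refl
  mul-congʳ (a ∷ p) {q} {q′} e zero    = trans (mul-zero a p q) (trans (*-congˡ (e 0)) (sym (mul-zero a p q′)))
  mul-congʳ (a ∷ p) {q} {q′} e (suc i) = trans (mul-suc a p q i) (trans (+-cong (*-congˡ (e (suc i))) (mul-congʳ p e i)) (sym (mul-suc a p q′ i)))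

  mul-congˡ : ∀ p p′ q → p ≋ p′ → mul p q ≋ mul p′ q
  mul-congˡ []      p′       q e i       = sym (mul-zeroˡ p′ q (λ i → sym (e i)) i)
  mul-congˡ (a ∷ p) []       q e i       = mul-zeroˡ (a ∷ p) q e i
  mul-congˡ (a ∷ p) (b ∷ p′) q e zero    = trans (mul-zero a p q) (trans (*-congʳ (e 0)) (sym (mul-zero b p′ q)))
  mul-congˡ (a ∷ p) (b ∷ p′) q e (suc i) = trans (mul-suc a p q i)
    (trans (+-cong (*-congʳ (e 0)) (mul-congˡ p p′ q (λ i → e (suc i)) i)) (sym (mul-suc b p′ q i)))

  mul-zeroʳ : ∀ p → mul p [] ≋ []
  mul-zeroʳ []      i       = refl
  mul-zeroʳ (a ∷ p) zero    = refl
  mul-zeroʳ (a ∷ p) (suc i) = mul-zeroʳ p i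

  mul-∷ʳ-zero : ∀ p b q → coeff (mul p (b ∷ q)) 0 ≈ coeff p 0 * b
  mul-∷ʳ-zero []      b q = sym (zeroˡ b)
  mul-∷ʳ-zero (a ∷ p) b q = mul-zero a p (b ∷ q)

  -- The recursion of `mul` mirrored in the second factor; commutativity follows by comparing the
  -- two recursions.
  mul-∷ʳ-suc : ∀ p b q i → coeff (mul p (b ∷ q)) (suc i) ≈ coeff p (suc i) * b + coeff (mul p q) i
  mul-∷ʳ-suc []      b q i       = sym (trans (+-identityʳ _) (zeroˡ b))
  mul-∷ʳ-suc (a ∷ p) b q zero    = begin
    coeff (mul (a ∷ p) (b ∷ q)) 1                ≈⟨ mul-suc a p (b ∷ q) 0 ⟩
    a * coeff q 0 + coeff (mul p (b ∷ q)) 0      ≈⟨ +-congˡ (mul-∷ʳ-zero p b q) ⟩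
    a * coeff q 0 + coeff p 0 * b                ≈⟨ +-comm _ _ ⟩
    coeff p 0 * b + a * coeff q 0                ≈⟨ +-congˡ (mul-zero a p q) ⟨
    coeff p 0 * b + coeff (mul (a ∷ p) q) 0 ∎
  mul-∷ʳ-suc (a ∷ p) b q (suc i) = begin
    coeff (mul (a ∷ p) (b ∷ q)) (suc (suc i))                                   ≈⟨ mul-suc a p (b ∷ q) (suc i) ⟩
    a * coeff q (suc i) + coeff (mul p (b ∷ q)) (suc i)
      ≈⟨ +-congˡ (mul-∷ʳ-suc p b q i) ⟩
    a * coeff q (suc i) + (coeff p (suc i) * b + coeff (mul p q) i)
      ≈⟨ solve 3 (λ u v w → u :+ (v :+ w) := v :+ (u :+ w)) refl _ _ _ ⟩
    coeff p (suc i) * b + (a * coeff q (suc i) + coeff (mul p q) i)             ≈⟨ +-congˡ (mul-suc a p q i) ⟨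
    coeff p (suc i) * b + coeff (mul (a ∷ p) q) (suc i) ∎

  mul-comm : ∀ p q → mul p q ≋ mul q p
  mul-comm []      q i       = sym (mul-zeroʳ q i)
  mul-comm (a ∷ p) q zero    = trans (mul-zero a p q) (trans (*-comm a _) (sym (mul-∷ʳ-zero q a p)))
  mul-comm (a ∷ p) q (suc i) = trans (mul-suc a p q i) (trans (+-cong (*-comm a _) (mul-comm p q i)) (sym (mul-∷ʳ-suc q a p i)))

  mul-distribʳ : ∀ r p q → mul (add p q) r ≋ add (mul p r) (mul q r)
  mul-distribʳ r p q i = trans (go p q i) (sym (coeff-add (mul p r) (mul q r) i))
    where
    go : ∀ p q i → coeff (mul (add p q) r) i ≈ coeff (mul p r) i + coeff (mul q r) i
    go []      q       i       = sym (+-identityˡ _)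
    go (a ∷ p) []      i       = sym (+-identityʳ _)
    go (a ∷ p) (b ∷ q) zero    = begin
      coeff (mul (a + b ∷ add p q) r) 0                       ≈⟨ mul-zero (a + b) (add p q) r ⟩
      (a + b) * coeff r 0                                     ≈⟨ distribʳ _ a b ⟩
      a * coeff r 0 + b * coeff r 0                           ≈⟨ +-cong (mul-zero a p r) (mul-zero b q r) ⟨
      coeff (mul (a ∷ p) r) 0 + coeff (mul (b ∷ q) r) 0 ∎
    go (a ∷ p) (b ∷ q) (suc i) = begin
      coeff (mul (a + b ∷ add p q) r) (suc i)                       ≈⟨ mul-suc (a + b) (add p q) r i ⟩
      (a + b) * coeff r (suc i) + coeff (mul (add p q) r) i         ≈⟨ +-congˡ (go p q i) ⟩
      (a + b) * coeff r (suc i) + (coeff (mul p r) i + coeff (mul q r) i)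
        ≈⟨ solve 5 (λ a b r u v → (a :+ b) :* r :+ (u :+ v) := (a :* r :+ u) :+ (b :* r :+ v))
            refl a b (coeff r (suc i)) _ _ ⟩
      (a * coeff r (suc i) + coeff (mul p r) i) + (b * coeff r (suc i) + coeff (mul q r) i)
        ≈⟨ +-cong (mul-suc a p r i) (mul-suc b q r i) ⟨
      coeff (mul (a ∷ p) r) (suc i) + coeff (mul (b ∷ q) r) (suc i) ∎

  coeff-mul-scale : ∀ a p q i → coeff (mul (map (a *_) p) q) i ≈ a * coeff (mul p q) i
  coeff-mul-scale a []      q i       = sym (zeroʳ a)
  coeff-mul-scale a (b ∷ p) q zero    = trans (mul-zero (a * b) (map (a *_) p) q) (trans (*-assoc a b _) (*-congˡ (sym (mul-zero b p q))))
  coeff-mul-scale a (b ∷ p) q (suc i) = begin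
    coeff (mul (a * b ∷ map (a *_) p) q) (suc i)              ≈⟨ mul-suc (a * b) (map (a *_) p) q i ⟩
    a * b * coeff q (suc i) + coeff (mul (map (a *_) p) q) i
      ≈⟨ +-cong (*-assoc a b _) (coeff-mul-scale a p q i) ⟩
    a * (b * coeff q (suc i)) + a * coeff (mul p q) i         ≈⟨ distribˡ a _ _ ⟨
    a * (b * coeff q (suc i) + coeff (mul p q) i)             ≈⟨ *-congˡ (mul-suc b p q i) ⟨
    a * coeff (mul (b ∷ p) q) (suc i) ∎

  mul-shift : ∀ p q → mul (0# ∷ p) q ≋ 0# ∷ mul p q
  mul-shift p q zero    = trans (mul-zero 0# p q) (zeroˡ _)
  mul-shift p q (suc i) = trans (mul-suc 0# p q i) (trans (+-congʳ (zeroˡ _)) (+-identityˡ _))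

  mul-assoc : ∀ p q r → mul (mul p q) r ≋ mul p (mul q r)
  mul-assoc []      q r i = refl
  mul-assoc (a ∷ p) q r i = begin
    coeff (mul (add (map (a *_) q) (0# ∷ mul p q)) r) i
      ≈⟨ mul-distribʳ r (map (a *_) q) (0# ∷ mul p q) i ⟩
    coeff (add (mul (map (a *_) q) r) (mul (0# ∷ mul p q) r)) i
      ≈⟨ coeff-add (mul (map (a *_) q) r) _ i ⟩
    coeff (mul (map (a *_) q) r) i + coeff (mul (0# ∷ mul p q) r) i
      ≈⟨ +-cong (coeff-mul-scale a q r i) (mul-shift (mul p q) r i) ⟩
    a * coeff (mul q r) i + coeff (0# ∷ mul (mul p q) r) i
      ≈⟨ +-cong (sym (coeff-scale a (mul q r) i)) (tail i) ⟩
    coeff (map (a *_) (mul q r)) i + coeff (0# ∷ mul p (mul q r)) i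
      ≈⟨ coeff-add (map (a *_) (mul q r)) _ i ⟨
    coeff (mul (a ∷ p) (mul q r)) i ∎
    where
    tail : 0# ∷ mul (mul p q) r ≋ 0# ∷ mul p (mul q r)
    tail zero    = refl
    tail (suc i) = mul-assoc p q r i

  mul-const : ∀ a q i → coeff (mul (const a) q) i ≈ a * coeff q i
  mul-const a q zero    = mul-zero a [] q
  mul-const a q (suc i) = trans (mul-suc a [] q i) (+-identityʳ _)

  mul-identityˡ : ∀ q → mul (const 1#) q ≋ q
  mul-identityˡ q i = trans (mul-const 1# q i) (*-identityˡ _)

  add-cong : ∀ {p p′ q q′} → p ≋ p′ → q ≋ q′ → add p q ≋ add p′ q′
  add-cong {p} {p′} {q} {q′} e e′ i = trans (coeff-add p q i) (trans (+-cong (e i) (e′ i)) (sym (coeff-add p′ q′ i)))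

  add-comm : ∀ p q → add p q ≋ add q p
  add-comm p q i = trans (coeff-add p q i) (trans (+-comm _ _) (sym (coeff-add q p i)))

  add-assoc : ∀ p q r → add (add p q) r ≋ add p (add q r)
  add-assoc p q r i = begin
    coeff (add (add p q) r) i              ≈⟨ coeff-add (add p q) r i ⟩
    coeff (add p q) i + coeff r i          ≈⟨ +-congʳ (coeff-add p q i) ⟩
    coeff p i + coeff q i + coeff r i      ≈⟨ +-assoc _ _ _ ⟩
    coeff p i + (coeff q i + coeff r i)    ≈⟨ +-congˡ (coeff-add q r i) ⟨
    coeff p i + coeff (add q r) i          ≈⟨ coeff-add p (add q r) i ⟨
    coeff (add p (add q r)) i ∎

  add-inverseˡ : ∀ p → add (map -_ p) p ≋ []
  add-inverseˡ p i = trans (coeff-add (map -_ p) p i) (trans (+-congʳ (coeff-neg p i)) (-‿inverseˡ _))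

  mul-cong : ∀ {p p′ q q′} → p ≋ p′ → q ≋ q′ → mul p q ≋ mul p′ q′
  mul-cong {p} {p′} {q} e e′ i = trans (mul-congˡ p p′ q e i) (mul-congʳ p′ e′ i)

  add-zero : ∀ p → add p [] ≋ p
  add-zero p i = trans (coeff-add p [] i) (+-identityʳ _)

  polynomialCommutativeRing : CommutativeRing 0ℓ 0ℓ
  polynomialCommutativeRing = record
    { Carrier = List Carrier ; _≈_ = _≋_ ; _+_ = add ; _*_ = mul ; -_ = map -_ ; 0# = [] ; 1# = const 1#
    ; isCommutativeRing = record
      { isRing = record
        { +-isAbelianGroup = record
          { isGroup = record
            { isMonoid = record
              { isSemigroup = record
                { isMagma = record
                  { isEquivalence = record
                    { refl = λ i → refl ; sym = λ e i → sym (e i) ; trans = λ e e′ i → trans (e i) (e′ i) }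
                  ; ∙-cong = λ {p} {p′} {q} {q′} → add-cong {p} {p′} {q} {q′} }
                ; assoc = add-assoc }
              ; identity = (λ p i → refl) , add-zero }
            ; inverse = add-inverseˡ , λ p i → trans (add-comm p (map -_ p) i) (add-inverseˡ p i)
            ; ⁻¹-cong = λ {p} {q} e i → trans (coeff-neg p i) (trans (-‿cong (e i)) (sym (coeff-neg q i))) }
          ; comm = add-comm }
        ; *-cong = λ {p} {p′} {q} {q′} → mul-cong {p} {p′} {q} {q′}
        ; *-assoc = mul-assoc
        ; *-identity = mul-identityˡ , λ p i → trans (mul-comm p (const 1#) i) (mul-identityˡ p i)
        ; distrib = (λ r p q i → trans (mul-comm r (add p q) i) (trans (mul-distribʳ r p q i)
                      (add-cong {mul p r} {mul r p} (mul-comm p r) (mul-comm q r) i)))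
                  , mul-distribʳ }
      ; *-comm = mul-comm } }

  private
    const-cong : ∀ {a b} → a ≈ b → const a ≋ const b
    const-cong e zero    = e
    const-cong e (suc i) = refl

  polynomials : ℤ-Algebra
  polynomials = record
    { commutativeRing = polynomialCommutativeRing
    ; int             = λ a → const (int a)
    ; isHomomorphism  = record
      { isSemiringHomomorphism = record
        { isNearSemiringHomomorphism = record
          { +-isMonoidHomomorphism = record
            { isMagmaHomomorphism = record
              { isRelHomomorphism = record { cong = λ e → const-cong (int-cong e) }
              ; homo = λ a b → const-cong (+-homo a b) }
            ; ε-homo = λ { zero → 0#-homo ; (suc i) → refl } }
          ; *-homo = λ a b → λ { zero → trans (*-homo a b) (sym (mul-const (int a) (const (int b)) 0))
                              ; (suc i) → sym (trans (mul-const (int a) (const (int b)) (suc i)) (zeroʳ _)) } }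
        ; 1#-homo = const-cong 1#-homo }
      ; -‿homo = λ a → const-cong (-‿homo a) } }

  ∷≋const+X* : ∀ a p → a ∷ p ≋ add (const a) (mul X p)
  ∷≋const+X* a p zero    = sym (trans (coeff-add (const a) (mul X p) 0) (trans (+-congˡ (mul-shift (const 1#) p 0)) (+-identityʳ a)))
  ∷≋const+X* a p (suc i) = sym (trans (coeff-add (const a) (mul X p) (suc i)) (trans (+-identityˡ _)
    (trans (mul-shift (const 1#) p (suc i)) (mul-identityˡ p i))))

  -- A bound on the degree instead of the degree itself, which would require deciding whether
  -- coefficients vanish.
  Below : ℕ → List Carrier → Set
  Below n p = ∀ i → n ≤ i → coeff p i ≈ 0#

  below-mul-top : ∀ {m n} p q → Below (suc m) p → Below (suc n) q →
                  coeff (mul p q) (m ℕ.+ n) ≈ coeff p m * coeff q n × Below (suc (m ℕ.+ n)) (mul p q)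
  below-mul-top {m} {n} []      q _  _  = sym (zeroˡ _) , λ i _ → refl
  below-mul-top {zero}  {n} (a ∷ p) q bp bq = top n , rest
    where
    p≋0 : p ≋ []
    p≋0 i = bp (suc i) (s≤s z≤n)
    top : ∀ n → coeff (mul (a ∷ p) q) n ≈ a * coeff q n
    top zero    = mul-zero a p q
    top (suc n) = trans (mul-suc a p q n) (trans (+-congˡ (mul-zeroˡ p q p≋0 n)) (+-identityʳ _))
    rest : Below (suc n) (mul (a ∷ p) q)
    rest i n<i = trans (top i) (trans (*-congˡ (bq i n<i)) (zeroʳ a))
  below-mul-top {suc m} {n} (a ∷ p) q bp bq = top , rest
    where
    rec = below-mul-top {m} {n} p q (λ i le → bp (suc i) (s≤s le)) bq
    top : coeff (mul (a ∷ p) q) (suc (m ℕ.+ n)) ≈ coeff p m * coeff q n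
    top = trans (mul-suc a p q (m ℕ.+ n)) (trans (+-cong (trans (*-congˡ (bq _ (s≤s (ℕₚ.m≤n+m n m)))) (zeroʳ a)) (proj₁ rec)) (+-identityˡ _))
    rest : Below (suc (suc (m ℕ.+ n))) (mul (a ∷ p) q)
    rest (suc i) (s≤s le) = trans (mul-suc a p q i)
      (trans (+-cong (trans (*-congˡ (bq (suc i) (s≤s (ℕₚ.≤-trans (ℕₚ.m≤n+m n m) (ℕₚ.<⇒≤ le))))) (zeroʳ a)) (proj₂ rec i le)) (+-identityˡ _))

  module _ {f : List Carrier} {N : ℕ} (monic : MonicOfDegree N f) where

    -- Uniqueness of the remainder. At indices above N the head a contributes nothing, so the tail q
    -- satisfies the same bound and vanishes by induction; then a is the coefficient at N.
    below-multiple : ∀ q → Below N (mul q f) → q ≋ []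
    below-multiple []      b i       = refl
    below-multiple (a ∷ q) b = λ { zero → a≈0 ; (suc i) → q≋0 i }
      where
      q≋0 : q ≋ []
      q≋0 = below-multiple q λ i N≤i → begin
        coeff (mul q f) i                         ≈⟨ +-identityˡ _ ⟨
        0# + coeff (mul q f) i
          ≈⟨ +-congʳ (trans (*-congˡ (proj₂ monic (suc i) (s≤s N≤i))) (zeroʳ a)) ⟨
        a * coeff f (suc i) + coeff (mul q f) i   ≈⟨ mul-suc a q f i ⟨
        coeff (mul (a ∷ q) f) (suc i)             ≈⟨ b (suc i) (ℕₚ.m≤n⇒m≤1+n N≤i) ⟩
        0# ∎
      top : ∀ N → coeff (mul (a ∷ q) f) N ≈ a * coeff f N
      top zero    = mul-zero a q f
      top (suc N) = trans (mul-suc a q f N) (trans (+-congˡ (mul-zeroˡ q f q≋0 N)) (+-identityʳ _))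
      a≈0 : a ≈ 0#
      a≈0 = begin
        a                       ≈⟨ *-identityʳ a ⟨
        a * 1#                  ≈⟨ *-congˡ (proj₁ monic) ⟨
        a * coeff f N           ≈⟨ top N ⟨
        coeff (mul (a ∷ q) f) N ≈⟨ b N ℕₚ.≤-refl ⟩
        0# ∎

    reduce : ∀ z → ∃₂ λ q z₀ → z ≋ add (mul q f) z₀ × Below N z₀
    reduce []      = [] , [] , (λ i → refl) , λ i _ → refl
    reduce (a ∷ z) with reduce z
    ... | q , z₀ , e , b = c ∷ q , z₁ , eq , bound
      where
      -- a + x z₀ has degree at most N. Its coefficient at N is the next digit of the quotient, and
      -- subtracting c f removes it.
      c : Carrier
      c = coeff (a ∷ z₀) N
      z₁ : List Carrier
      z₁ = add (a ∷ z₀) (map (- c *_) f)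
      coeff-z₁ : ∀ i → coeff z₁ i ≈ coeff (a ∷ z₀) i + - c * coeff f i
      coeff-z₁ i = trans (coeff-add (a ∷ z₀) (map (- c *_) f) i) (+-congˡ (coeff-scale (- c) f i))
      eq : a ∷ z ≋ add (mul (c ∷ q) f) z₁
      eq zero = begin
        a
          ≈⟨ solve 3 (λ a c f → a := c :* f :+ (a :+ :- c :* f)) refl a c (coeff f 0) ⟩
        c * coeff f 0 + (a + - c * coeff f 0)                   ≈⟨ +-cong (mul-zero c q f) (coeff-z₁ 0) ⟨
        coeff (mul (c ∷ q) f) 0 + coeff z₁ 0           ≈⟨ coeff-add (mul (c ∷ q) f) _ 0 ⟨
        coeff (add (mul (c ∷ q) f) z₁) 0 ∎
      eq (suc i) = begin
        coeff z i                                               ≈⟨ e i ⟩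
        coeff (add (mul q f) z₀) i                              ≈⟨ coeff-add (mul q f) z₀ i ⟩
        coeff (mul q f) i + coeff z₀ i
          ≈⟨ solve 4 (λ m z c f → m :+ z := (c :* f :+ m) :+ (z :+ :- c :* f))
              refl _ (coeff z₀ i) c (coeff f (suc i)) ⟩
        (c * coeff f (suc i) + coeff (mul q f) i) + (coeff z₀ i + - c * coeff f (suc i))
          ≈⟨ +-cong (mul-suc c q f i) (coeff-z₁ (suc i)) ⟨
        coeff (mul (c ∷ q) f) (suc i) + coeff z₁ (suc i) ≈⟨ coeff-add (mul (c ∷ q) f) _ (suc i) ⟨
        coeff (add (mul (c ∷ q) f) z₁) (suc i) ∎
      shifted : ∀ i → N < i → coeff (a ∷ z₀) i ≈ 0#
      shifted (suc i) (s≤s N≤i) = b i N≤i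
      bound : Below N z₁
      bound i N≤i with ℕₚ.m≤n⇒m<n∨m≡n N≤i
      ... | inj₁ N<i = trans (coeff-z₁ i) (trans (+-cong (shifted i N<i) (trans (*-congˡ (proj₂ monic i N<i)) (zeroʳ _))) (+-identityˡ _))
      ... | inj₂ ≡.refl = trans (coeff-z₁ N) (trans (+-congˡ (trans (*-congˡ (proj₁ monic)) (*-identityʳ _))) (-‿inverseʳ c))

-- The maximality criterion

open ℤ[x] using (coeff; add; mul; const; MonicOfDegree)

module BinaryForm (A : ℤ-Algebra) where
  open ℤ-Algebra A
  open Solver A
  open import Relation.Binary.Reasoning.Setoid setoid

  -- The homogenisation of g in degree n, which ignores coefficients beyond n. It turns g(h / N) = 0
  -- into an equation without fractions.
  form : ℕ → List ℤ → Carrier → Carrier → Carrier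
  form n       []      X Y = 0#
  form zero    (a ∷ g) X Y = int a
  form (suc n) (a ∷ g) X Y = int a * Y ^ suc n + X * form n g X Y

  form-cong : ∀ n g {X X′ Y Y′} → X ≈ X′ → Y ≈ Y′ → form n g X Y ≈ form n g X′ Y′
  form-cong n       []      eX eY = refl
  form-cong zero    (a ∷ g) eX eY = refl
  form-cong (suc n) (a ∷ g) eX eY = +-cong (*-congˡ (^-congˡ (suc n) eY)) (*-cong eX (form-cong n g eX eY))

  form-homogeneous : ∀ n g c X Y → form n g (c * X) (c * Y) ≈ c ^ n * form n g X Y
  form-homogeneous n       []      c X Y = sym (zeroʳ (c ^ n))
  form-homogeneous zero    (a ∷ g) c X Y = sym (*-identityˡ _)
  form-homogeneous (suc n) (a ∷ g) c X Y = begin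
    int a * (c * Y) ^ suc n + c * X * form n g (c * X) (c * Y)
      ≈⟨ +-cong (*-congˡ (^-distrib-* c Y (suc n))) (*-congˡ (form-homogeneous n g c X Y)) ⟩
    int a * (c ^ suc n * Y ^ suc n) + c * X * (c ^ n * form n g X Y)
      ≈⟨ solve 6 (λ a c cn y x q → a :* (c :* cn :* y) :+ c :* x :* (cn :* q) := c :* cn :* (a :* y :+ x :* q))
           refl (int a) c (c ^ n) (Y ^ suc n) X (form n g X Y) ⟩
    c ^ suc n * (int a * Y ^ suc n + X * form n g X Y) ∎
    where open Powers A

  -- Every monomial but X^n contains the second argument, here a multiple of r.
  form-monic : ∀ n g → coeff g n ≡ + 1 → ∀ X r Y → ∃ λ z → form n g X (r * Y) ≈ X ^ n + r * z
  form-monic n       []      ()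
  form-monic zero    (a ∷ g) ≡.refl X r Y = 0# , (begin
    int (+ 1)    ≈⟨ 1#-homo ⟩
    1#           ≈⟨ +-identityʳ 1# ⟨
    1# + 0#      ≈⟨ +-congˡ (zeroʳ r) ⟨
    1# + r * 0# ∎)
  form-monic (suc n) (a ∷ g) monic X r Y with form-monic n g monic X r Y
  ... | z , e = int a * (Y * (r * Y) ^ n) + X * z , (begin
    int a * (r * Y * (r * Y) ^ n) + X * form n g X (r * Y) ≈⟨ +-congˡ (*-congˡ e) ⟩
    int a * (r * Y * (r * Y) ^ n) + X * (X ^ n + r * z)
      ≈⟨ solve 7 (λ a r y w x xn z → a :* (r :* y :* w) :+ x :* (xn :+ r :* z) := x :* xn :+ r :* (a :* (y :* w) :+ x :* z))
           refl (int a) r Y ((r * Y) ^ n) X (X ^ n) z ⟩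
    X ^ suc n + r * (int a * (Y * (r * Y) ^ n) + X * z) ∎)

module _ (A : ℤ-Algebra) where
  open ℤ-Algebra A
  open Quotient A

  -- The elementwise core of Dedekind's criterion. By `F-unit` the factor F is invertible modulo (p,
  -- r), so `relation` makes r a generator of (p, r) locally. `separated` is the substitute for
  -- localising at (p, r): it makes 1 - p c cancellable instead of invertible.
  module Dedekind (p : ℤ) (r F u a b : Carrier) (e : ℕ)
    (relation : r ^ suc e ≈ - (int p * F))
    (F-unit   : u * F ≈ int (+ 1) + (int p * a + r * b))
    (torsion-free : ∀ z → int p * z ≈ 0# → z ≈ 0#)
    (separated    : ∀ z c → z ≈ int p * c * z → z ≈ 0#)
    (radical      : ∀ n t → Span₂ (int p) r (t ^ n) → Span₂ (int p) r t) where

    open Solver A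
    open BinaryForm A
    open Powers A
    open import Relation.Binary.Reasoning.Setoid setoid

    private
      P : Carrier
      P = int p

      -- Multiplied by z, `F-unit` collapses to z = - p a z, and `separated` applies.
      F-cancel : ∀ z → F * z ≈ 0# → r * z ≈ 0# → z ≈ 0#
      F-cancel z Fz≈0 rz≈0 = separated z (- a) (begin
        z
          ≈⟨ solve 5 (λ z P a b r → z := (con (+ 1) :+ (P :* a :+ r :* b)) :* z :- P :* a :* z :- b :* (r :* z))
              refl z P a b r ⟩
        (int (+ 1) + (P * a + r * b)) * z - P * a * z - b * (r * z) ≈⟨ +-congʳ (+-congʳ (*-congʳ F-unit)) ⟨
        u * F * z - P * a * z - b * (r * z)
          ≈⟨ +-cong (+-congʳ (trans (*-assoc u F z) (trans (*-congˡ Fz≈0) (zeroʳ u)))) (-‿cong (trans (*-congˡ rz≈0) (zeroʳ b))) ⟩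
        0# - P * a * z - 0#
          ≈⟨ solve 4 (λ z P a o → o :- P :* a :* z :- o := P :* (:- a) :* z) refl z P a 0# ⟩
        P * - a * z ∎)

    -- r z = 0 gives p F z = - r^(e+1) z = 0, hence F z = 0 because p is torsion-free.
    r-cancel : ∀ z → r * z ≈ 0# → z ≈ 0#
    r-cancel z rz≈0 = F-cancel z (torsion-free (F * z) (begin
      P * (F * z)          ≈⟨ solve 3 (λ P F z → P :* (F :* z) := :- (:- (P :* F) :* z)) refl P F z ⟩
      - (- (P * F) * z)    ≈⟨ -‿cong (*-congʳ relation) ⟨
      - (r * r ^ e * z)    ≈⟨ solve 3 (λ r s z → :- (r :* s :* z) := :- s :* (r :* z)) refl r (r ^ e) z ⟩
      - r ^ e * (r * z)    ≈⟨ *-congˡ rz≈0 ⟩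
      - r ^ e * 0#         ≈⟨ zeroʳ _ ⟩
      0# ∎)) rz≈0

    r^-cancel : ∀ n z → r ^ n * z ≈ 0# → z ≈ 0#
    r^-cancel zero    z eq = trans (sym (*-identityˡ z)) eq
    r^-cancel (suc n) z eq = r^-cancel n z (r-cancel _ (trans (sym (*-assoc r (r ^ n) z)) eq))

    -- The vanishing form states that h / (p M) is a root of the monic g; the aim is that p divides
    -- h.
    module _ (n : ℕ) (g : List ℤ) (monic : coeff g n ≡ + 1) (h M : Carrier) (root : form n g h (P * M) ≈ 0#) where

      -- As p F = - r^(e+1), multiplying by F r^(e-i) turns both h and p M into
      -- multiples of r^e.  Once r^e is cancelled the second argument of the
      -- form is a multiple of r, so modulo r only X^n remains.
      raise : ∀ i → i ≤ e → Span₂ P (r ^ i) h → Span₂ P (r ^ suc i) h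
      raise i i≤e (s , t , h≈) = improve (radical n t (step′ (form-monic n g monic X r (- (r ^ j * M)))))
        where
        j : ℕ
        j = e ℕ.∸ i
        X c : Carrier
        X = F * t - r * r ^ j * s
        c = F * r ^ j
        r^e : r ^ e ≈ r ^ j * r ^ i
        r^e = trans (^-congᵉ r (≡.sym (ℕₚ.m∸n+n≡m i≤e))) (^-homo-* r j i)
        cX : r ^ e * X ≈ c * h
        cX = begin
          r ^ e * (F * t - r * r ^ j * s)
            ≈⟨ solve 6 (λ E F t r J s → E :* (F :* t :- r :* J :* s) := F :* (E :* t) :- r :* E :* (J :* s))
                refl (r ^ e) F t r (r ^ j) s ⟩
          F * (r ^ e * t) - r * r ^ e * (r ^ j * s)
            ≈⟨ +-cong (*-congˡ (*-congʳ r^e)) (-‿cong (*-congʳ relation)) ⟩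
          F * (r ^ j * r ^ i * t) - (- (P * F) * (r ^ j * s))
            ≈⟨ solve 6 (λ F J I t P s → F :* (J :* I :* t) :- (:- (P :* F) :* (J :* s)) := F :* J :* (P :* s :+ I :* t))
                refl F (r ^ j) (r ^ i) t P s ⟩
          F * r ^ j * (P * s + r ^ i * t) ≈⟨ *-congˡ h≈ ⟨
          c * h ∎
        cY : r ^ e * (r * - (r ^ j * M)) ≈ c * (P * M)
        cY = begin
          r ^ e * (r * - (r ^ j * M))
            ≈⟨ solve 4 (λ E r J M → E :* (r :* :- (J :* M)) := :- (r :* E) :* (J :* M))
                refl (r ^ e) r (r ^ j) M ⟩
          - (r * r ^ e) * (r ^ j * M)    ≈⟨ *-congʳ (-‿cong relation) ⟩
          - - (P * F) * (r ^ j * M)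
            ≈⟨ solve 4 (λ P F J M → :- (:- (P :* F)) :* (J :* M) := F :* J :* (P :* M)) refl P F (r ^ j) M ⟩
          c * (P * M) ∎
        root′ : form n g X (r * - (r ^ j * M)) ≈ 0#
        root′ = r^-cancel (e ℕ.* n) _ (begin
          r ^ (e ℕ.* n) * form n g X (r * - (r ^ j * M))   ≈⟨ *-congʳ (^-assocʳ r e n) ⟨
          (r ^ e) ^ n * form n g X (r * - (r ^ j * M))     ≈⟨ form-homogeneous n g (r ^ e) X _ ⟨
          form n g (r ^ e * X) (r ^ e * (r * - (r ^ j * M))) ≈⟨ form-cong n g cX cY ⟩
          form n g (c * h) (c * (P * M))                   ≈⟨ form-homogeneous n g c h (P * M) ⟩
          c ^ n * form n g h (P * M)                       ≈⟨ *-congˡ root ⟩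
          c ^ n * 0#                                       ≈⟨ zeroʳ _ ⟩
          0# ∎)
        module B = ℤ-Algebra (quotient (Span₂-isIdeal P r))
        step′ : (∃ λ z → form n g X (r * - (r ^ j * M)) ≈ X ^ n + r * z) → Span₂ P r (t ^ n)
        step′ (z , eq) = ≈0⇒∈ ideal (subst (B._≈ 0#) (^-quotient ideal t n)
          (Powers.multiple-nilpotent (quotient ideal) n {t} u X t≈uX (subst (B._≈ 0#) (≡.sym (^-quotient ideal X n)) X^n≈0)))
          where
          ideal = Span₂-isIdeal P r
          X^n≈0 : X ^ n B.≈ 0#
          X^n≈0 = ∈⇒≈0 (Span₂-isIdeal P r) (0# , - z , (begin
            X ^ n
              ≈⟨ solve 3 (λ x r z → x := (x :+ r :* z) :+ r :* :- z) refl (X ^ n) r z ⟩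
            X ^ n + r * z + r * - z          ≈⟨ +-congʳ (trans (sym eq) root′) ⟩
            0# + r * - z                     ≈⟨ +-congʳ (zeroʳ P) ⟨
            P * 0# + r * - z ∎))
          -- X is F t modulo r, and u inverts F modulo (p, r). So t inherits the nilpotence of X.
          t≈uX : t B.≈ u * X
          t≈uX = - (a * t) , - (b * t) + u * (r ^ j * s) , (begin
            t - u * (F * t - r * r ^ j * s)
              ≈⟨ solve 6 (λ t u F r J s → t :- u :* (F :* t :- r :* J :* s) := t :- u :* F :* t :+ r :* (u :* (J :* s)))
                  refl t u F r (r ^ j) s ⟩
            t - u * F * t + r * (u * (r ^ j * s))
              ≈⟨ +-congʳ (+-congˡ (-‿cong (*-congʳ F-unit))) ⟩
            t - (int (+ 1) + (P * a + r * b)) * t + r * (u * (r ^ j * s))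
              ≈⟨ solve 6 (λ t P a r b w → t :- (con (+ 1) :+ (P :* a :+ r :* b)) :* t :+ r :* w := P :* :- (a :* t) :+ r :* (:- (b :* t) :+ w))
                   refl t P a r b (u * (r ^ j * s)) ⟩
            P * - (a * t) + r * (- (b * t) + u * (r ^ j * s)) ∎)
        improve : Span₂ P r t → Span₂ P (r ^ suc i) h
        improve (s′ , t′ , t≈) = s + r ^ i * s′ , t′ , (begin
          h                                            ≈⟨ h≈ ⟩
          P * s + r ^ i * t                            ≈⟨ +-congˡ (*-congˡ t≈) ⟩
          P * s + r ^ i * (P * s′ + r * t′)
            ≈⟨ solve 6 (λ P s I s′ r t′ → P :* s :+ I :* (P :* s′ :+ r :* t′) := P :* (s :+ I :* s′) :+ r :* I :* t′)
                refl P s (r ^ i) s′ r t′ ⟩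
          P * (s + r ^ i * s′) + r ^ suc i * t′ ∎)

      climb : ∀ i → i ≤ suc e → Span₂ P (r ^ i) h
      climb zero    _         = 0# , h , trans (sym (*-identityˡ h)) (trans (sym (+-identityˡ _)) (+-congʳ (sym (zeroʳ P))))
      climb (suc i) (s≤s i≤e) = raise i i≤e (climb i (ℕₚ.m≤n⇒m≤1+n i≤e))

      -- The chain ends at (p, r^(e+1)), which is (p) because r^(e+1) = - p F.
      divisible : ∃ λ h′ → h ≈ P * h′
      divisible = conclude (climb (suc e) ℕₚ.≤-refl)
        where
        conclude : Span₂ P (r ^ suc e) h → ∃ λ h′ → h ≈ P * h′
        conclude (s , t , h≈) = s - F * t , (begin
          h                       ≈⟨ h≈ ⟩
          P * s + r ^ suc e * t   ≈⟨ +-congˡ (*-congʳ relation) ⟩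
          P * s + - (P * F) * t
            ≈⟨ solve 4 (λ P s F t → P :* s :+ :- (P :* F) :* t := P :* (s :- F :* t)) refl P s F t ⟩
          P * (s - F * t) ∎)

-- Division by a monic polynomial in ℤ[x] and its consequences for the quotients

open ℤ[x] using (X)

ℤ-algebra : ℤ-Algebra
ℤ-algebra = record
  { commutativeRing = ℤₚ.+-*-commutativeRing
  ; int             = id
  ; isHomomorphism  = record
    { isSemiringHomomorphism = record
      { isNearSemiringHomomorphism = record
        { +-isMonoidHomomorphism = record
          { isMagmaHomomorphism = record
            { isRelHomomorphism = record { cong = id }
            ; homo = λ a b → ≡.refl }
          ; ε-homo = ≡.refl }
        ; *-homo = λ a b → ≡.refl }
      ; 1#-homo = ≡.refl }
    ; -‿homo = λ a → ≡.refl } }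

module ℤP = PolynomialAlgebra ℤ-algebra

ℤX : ℤ-Algebra
ℤX = ℤP.polynomials

generated-by-X : GeneratedBy ℤX X
generated-by-X Q resp Q0 step []      = Q0
generated-by-X Q resp Q0 step (a ∷ t) = resp {_} {a ∷ t} (λ i → ≡.sym (ℤP.∷≋const+X* a t i)) (step a t (generated-by-X Q resp Q0 step t))

-- What the argument uses of division by a monic f, with `Reduced` in the role of a degree below
-- that of f. The later modules see only this interface and no coefficient lists.
record Reduction (P : ℤ-Algebra) (f : ℤ-Algebra.Carrier P) : Set₁ where
  open ℤ-Algebra P
  field
    Reduced        : Carrier → Set
    reduced-minus  : ∀ y z → Reduced y → Reduced z → Reduced (y - z)
    reduced-scale  : ∀ a z → Reduced z → Reduced (int a * z)
    reduced-zero   : ∀ z → Reduced z → f ∣ᴿ z → z ≈ 0#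
    divide         : ∀ z → ∃₂ λ q z₀ → z ≈ q * f + z₀ × Reduced z₀
    torsion-freeᴾ  : ∀ n .{{_ : ℕ.NonZero n}} z → int (+ n) * z ≈ 0# → z ≈ 0#
    separatedᴾ     : ∀ p → 2 ≤ p → ∀ z → (∀ j → ∃ λ w → z ≈ int ((+ p) ℤ.^ j) * w) → z ≈ 0#

module ReductionProperties {P : ℤ-Algebra} {f : ℤ-Algebra.Carrier P} (reduction : Reduction P f) where
  open ℤ-Algebra P
  open Reduction reduction
  open Quotient P

  private
    module A = ℤ-Algebra A/⟨ f ⟩
    module S = Solver P
    module SA = Solver A/⟨ f ⟩
    ideal = principal-isIdeal f

  reduce : ∀ z → ∃ λ z₀ → z A.≈ z₀ × Reduced z₀
  reduce z with divide z
  ... | q , z₀ , e , red = z₀ , (q , trans (S.solve 2 (λ u v → u S.:= (u S.:+ v) S.:- v)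
      refl (q * f) z₀) (+-congʳ (sym e))) , red

  reduced-unique : ∀ y z → Reduced y → Reduced z → y A.≈ z → y ≈ z
  reduced-unique y z ry rz y∼z = x∙y⁻¹≈ε⇒x≈y y z (reduced-zero (y - z) (reduced-minus y z ry rz) y∼z)
    where open import Algebra.Properties.Group +-group using (x∙y⁻¹≈ε⇒x≈y)

  -- Scaling keeps the remainder z₀ reduced, so n z₀ is a reduced multiple of f and vanishes already
  -- in P.
  torsion-free : ∀ n .{{_ : ℕ.NonZero n}} z → int (+ n) * z A.≈ 0# → z A.≈ 0#
  torsion-free n z nz∼0 with reduce z
  ... | z₀ , z∼z₀ , red = A.trans z∼z₀ (≈⇒≈/ ideal (torsion-freeᴾ n z₀ (reduced-zero _ (reduced-scale (+ n) z₀ red)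
    (≈0⇒∈ ideal (A.trans (A.*-congˡ (A.sym z∼z₀)) nz∼0)))))

  -- Iteration gives z = p^j c^j z for every j. Passing to remainders makes one fixed element of P
  -- divisible by all powers of p.
  separated : ∀ p → 2 ≤ p → ∀ z c → z A.≈ int (+ p) * c * z → z A.≈ 0#
  separated p 2≤p z c z∼ with reduce z
  ... | z₀ , z∼z₀ , red = A.trans z∼z₀ (≈⇒≈/ ideal (separatedᴾ p 2≤p z₀ divisible))
    where
    open import Relation.Binary.Reasoning.Setoid A.setoid
    iterate : ∀ j → ∃ λ w → z A.≈ int ((+ p) ℤ.^ j) * w
    iterate zero    = z , ≈⇒≈/ ideal (sym (trans (*-congʳ 1#-homo) (*-identityˡ z)))
    iterate (suc j) with iterate j
    ... | w , e = c * w , (begin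
      z                                        ≈⟨ z∼ ⟩
      int (+ p) * c * z                        ≈⟨ A.*-congˡ e ⟩
      int (+ p) * c * (int ((+ p) ℤ.^ j) * w)
        ≈⟨ SA.solve 4 (λ p c q w → p SA.:* c SA.:* (q SA.:* w) SA.:= p SA.:* q SA.:* (c SA.:* w))
             A.refl (int (+ p)) c (int ((+ p) ℤ.^ j)) w ⟩
      int (+ p) * int ((+ p) ℤ.^ j) * (c * w)  ≈⟨ A.*-congʳ (A.*-homo (+ p) ((+ p) ℤ.^ j)) ⟨
      int ((+ p) ℤ.^ suc j) * (c * w) ∎)
    divisible : ∀ j → ∃ λ w → z₀ ≈ int ((+ p) ℤ.^ j) * w
    divisible j with iterate j
    ... | w , e with reduce w
    ...   | w₀ , w∼w₀ , red′ = w₀ , reduced-unique z₀ (int ((+ p) ℤ.^ j) * w₀) red (reduced-scale ((+ p) ℤ.^ j) w₀ red′)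
              (A.trans (A.sym z∼z₀) (A.trans e (A.*-congˡ w∼w₀)))

∣+p^j∣ : ∀ p j → ∣ (+ p) ℤ.^ j ∣ ≡ p ℕ.^ j
∣+p^j∣ p zero    = ≡.refl
∣+p^j∣ p (suc j) = ≡.trans (ℤₚ.abs-* (+ p) ((+ p) ℤ.^ j)) (≡.cong (p ℕ.*_) (∣+p^j∣ p j))

-- The single exponent j = ∣ u ∣ suffices, because p^j exceeds j.
ℤ-separated : ∀ p → 2 ≤ p → ∀ u → (∀ j → ∃ λ a → u ≡ (+ p) ℤ.^ j ℤ.* a) → u ≡ + 0
ℤ-separated p 2≤p u divisible = ℤₚ.∣i∣≡0⇒i≡0 (vanish ∣ u ∣ ∣ proj₁ (divisible ∣ u ∣) ∣
  (≡.trans (≡.cong ∣_∣ (proj₂ (divisible ∣ u ∣))) (≡.trans (ℤₚ.abs-* ((+ p) ℤ.^ ∣ u ∣) _) (≡.cong (ℕ._* _) (∣+p^j∣ p ∣ u ∣)))))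
  where
  vanish : ∀ k l → k ≡ p ℕ.^ k ℕ.* l → k ≡ 0
  vanish k zero    eq = ≡.trans eq (ℕₚ.*-zeroʳ (p ℕ.^ k))
  vanish k (suc l) eq = contradiction (n<b^n k 2≤p)
    (ℕₚ.≤⇒≯ (ℕₚ.≤-trans (ℕₚ.m≤m*n (p ℕ.^ k) (suc l)) (ℕₚ.≤-reflexive (≡.sym eq))))

monic-reduction : ∀ f {N} → MonicOfDegree N f → Reduction ℤX f
monic-reduction f {N} monic = record
  { Reduced       = ℤP.Below N
  ; reduced-minus = λ y z by bz i N≤i → ≡.trans (ℤP.coeff-add y _ i) (≡.cong₂ ℤ._+_ (by i N≤i)
                      (≡.trans (ℤP.coeff-neg z i) (≡.cong ℤ.-_ (bz i N≤i))))
  ; reduced-scale = λ a z b i N≤i → ≡.trans (ℤP.mul-const a z i) (≡.trans (≡.cong (a ℤ.*_) (b i N≤i)) (ℤₚ.*-zeroʳ a))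
  ; reduced-zero  = λ { z b (q , e) i → ≡.trans (≡.sym (e i))
                      (ℤP.mul-zeroˡ q f (ℤP.below-multiple monic q λ j N≤j → ≡.trans (e j) (b j N≤j)) i) }
  ; divide        = ℤP.reduce monic
  ; torsion-freeᴾ = λ n z nz≈0 i → ℤₚ.*-cancelˡ-≡ (+ n) _ _ (≡.trans (≡.sym (ℤP.mul-const (+ n) z i))
                      (≡.trans (nz≈0 i) (≡.sym (ℤₚ.*-zeroʳ (+ n)))))
  ; separatedᴾ    = λ p 2≤p z d i → ℤ-separated p 2≤p (coeff z i) λ j →
                      coeff (proj₁ (d j)) i , ≡.trans (proj₂ (d j) i) (ℤP.mul-const ((+ p) ℤ.^ j) (proj₁ (d j)) i)
  }

generated-quotient : ∀ {P x} → GeneratedBy P x → ∀ {I} (ideal : Quotient.IsIdeal P I) →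
                     GeneratedBy (Quotient.quotient P ideal) x
generated-quotient {P} gen ideal Q resp = gen Q (λ s≈t → resp (Quotient.≈⇒≈/ P ideal s≈t))

module ResidueRing (P : ℤ-Algebra) (p : ℕ) (r : ℤ-Algebra.Carrier P) where
  open ℤ-Algebra P
  open Quotient P

  residue-isIdeal : IsIdeal (Span₂ (int (+ p)) r)
  residue-isIdeal = Span₂-isIdeal (int (+ p)) r

  residueRing : ℤ-Algebra
  residueRing = quotient residue-isIdeal

  private module B = ℤ-Algebra residueRing

  p∈ : ∀ z → Span₂ (int (+ p)) r (int (+ p) * z)
  p∈ z = z , 0# , sym (trans (+-congˡ (zeroʳ r)) (+-identityʳ _))

  r∈ : ∀ z → Span₂ (int (+ p)) r (r * z)
  r∈ z = 0# , z , sym (trans (+-congʳ (zeroʳ _)) (+-identityˡ _))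

  p≈0 : int (+ p) B.≈ 0#
  p≈0 = ∈⇒≈0 residue-isIdeal (IsIdeal.resp residue-isIdeal (*-identityʳ _) (p∈ 1#))

  r≈0 : r B.≈ 0#
  r≈0 = ∈⇒≈0 residue-isIdeal (IsIdeal.resp residue-isIdeal (*-identityʳ _) (r∈ 1#))

FrobeniusFixed : (P : ℤ-Algebra) (p : ℕ) (r x : ℤ-Algebra.Carrier P) → Set
FrobeniusFixed P p r x = ∃ λ N → 0 < N × x ^ (p ℕ.^ N) ≈ x
  where open ℤ-Algebra (ResidueRing.residueRing P p r)

-- Comparing the two expansions gives p (E - d) = r (b - r^e), and modulo r the factor p can be
-- cancelled. So modulo r the cofactor E is the value d of f / p at a root of r.
cofactor : ∀ (P : ℤ-Algebra) (let open ℤ-Algebra P) n .{{_ : ℕ.NonZero n}} {f r E b d} e → Reduction P r →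
  f ≈ r ^ suc e + int (+ n) * E → f ≈ int (+ n) * d + r * b → ∃ λ b′ → E ≈ d + r * b′
cofactor P n {f} {r} {E} {b} {d} e reduction-r f-mod-p f-mod-r = _∣ʳ_.quotient E-mod-r , (begin
  E                                    ≈⟨ solve 2 (λ E d → E := d :+ (E :- d)) refl E d ⟩
  d + (E - d)                          ≈⟨ +-congˡ (_∣ʳ_.equality E-mod-r) ⟨
  d + _∣ʳ_.quotient E-mod-r * r        ≈⟨ +-congˡ (*-comm _ r) ⟩
  d + r * _∣ʳ_.quotient E-mod-r ∎)
  where
  open ℤ-Algebra P
  open Quotient P
  open Solver P
  open import Relation.Binary.Reasoning.Setoid setoid
  module R = ℤ-Algebra A/⟨ r ⟩
  open import Algebra.Properties.Group R.+-group using (x∙y⁻¹≈ε⇒x≈y)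
  p′ = int (+ n)
  E-mod-r : E R.≈ d
  E-mod-r = x∙y⁻¹≈ε⇒x≈y E d (ReductionProperties.torsion-free reduction-r n (E - d) (∈⇒≈0 (principal-isIdeal r)
    (- (r ^ e) + b , (begin
      (- (r ^ e) + b) * r
        ≈⟨ solve 4 (λ r R b z → (:- R :+ b) :* r := (z :+ r :* b) :- (r :* R) :- z) refl r (r ^ e) b (p′ * d) ⟩
      (p′ * d + r * b) - r ^ suc e - p′ * d
        ≈⟨ +-congʳ (+-congʳ (trans (sym f-mod-r) f-mod-p)) ⟩
      (r ^ suc e + p′ * E) - r ^ suc e - p′ * d
        ≈⟨ solve 4 (λ R p E d → (R :+ p :* E) :- R :- p :* d := p :* (E :- d)) refl (r ^ suc e) p′ E d ⟩
      p′ * (E - d) ∎))))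

-- Maximality at p from an expansion of f

module _ (P : ℤ-Algebra) where
  open ℤ-Algebra P

  module PMaximal (x : Carrier) (gen : GeneratedBy P x)
    (p : ℕ) (pr : Prime p) (f r E a b : Carrier) (e : ℕ) (c u v : ℤ)
    (reduction-f : Reduction P f) (reduction-r : Reduction P r)
    (f-mod-p : f ≈ r ^ suc e + int (+ p) * E)
    (f-mod-r : f ≈ int (+ p) * (int c + int (+ p) * a) + r * b)
    (c-unit  : u ℤ.* c ≡ + 1 ℤ.+ + p ℤ.* v)
    (fixed   : FrobeniusFixed P p r x) where

    open Quotient P
    open Solver P
    open ResidueRing P p r
    open import Relation.Binary.Reasoning.Setoid setoid

    private
      instance _ = prime⇒nonZero pr
      module A = ℤ-Algebra A/⟨ f ⟩
      module QA = Quotient A/⟨ f ⟩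
      module B = ℤ-Algebra residueRing
      idealf = principal-isIdeal f
      p′ = int (+ p)
      d : Carrier
      d = int c + p′ * a

      E-cofactor : ∃ λ b′ → E ≈ d + r * b′
      E-cofactor = cofactor P p e reduction-r f-mod-p f-mod-r

      b′ : Carrier
      b′ = proj₁ E-cofactor

      E≈ : E ≈ d + r * b′
      E≈ = proj₂ E-cofactor

      E-unit : int u * E ≈ int (+ 1) + (p′ * (int v + int u * a) + r * (int u * b′))
      E-unit = begin
        int u * E                                   ≈⟨ *-congˡ E≈ ⟩
        int u * (int c + p′ * a + r * b′)
          ≈⟨ solve 6 (λ u c p a r b → u :* (c :+ p :* a :+ r :* b) := u :* c :+ (p :* (u :* a) :+ r :* (u :* b)))
              refl (int u) (int c) p′ a r b′ ⟩
        int u * int c + (p′ * (int u * a) + r * (int u * b′))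
          ≈⟨ +-congʳ (trans (sym (*-homo u c)) (trans (int-cong c-unit) (trans (+-homo (+ 1) _) (+-congˡ (*-homo (+ p) v))))) ⟩
        int (+ 1) + p′ * int v + (p′ * (int u * a) + r * (int u * b′))
          ≈⟨ solve 6 (λ o p v w r b → o :+ p :* v :+ (p :* w :+ r :* b) := o :+ (p :* (v :+ w) :+ r :* b))
              refl (int (+ 1)) p′ (int v) (int u * a) r (int u * b′) ⟩
        int (+ 1) + (p′ * (int v + int u * a) + r * (int u * b′)) ∎

      relation : r A.^ suc e A.≈ - (p′ * E)
      relation = subst (A._≈ - (p′ * E)) (≡.sym (^-quotient idealf r (suc e))) (int (+ 1) , (begin
        int (+ 1) * f                     ≈⟨ *-congˡ f-mod-p ⟩
        int (+ 1) * (r ^ suc e + p′ * E)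
          ≈⟨ solve 2 (λ R z → con (+ 1) :* (R :+ z) := R :- :- z) refl (r ^ suc e) (p′ * E) ⟩
        r ^ suc e - - (p′ * E) ∎))

      reduced : ∀ n t → t B.^ n B.≈ 0# → t B.≈ 0#
      reduced = Characteristic.reduced residueRing pr p≈0 (generated-quotient gen residue-isIdeal)
        (proj₁ fixed) (proj₁ (proj₂ fixed)) (proj₂ (proj₂ fixed))

      -- f itself lies in (p, r), so membership modulo f comes from membership in P.
      lower : ∀ {z} → QA.Span₂ p′ r z → Span₂ p′ r z
      lower {z} (s , t , (w , eq)) = s + w * E , t + w * r ^ e , (begin
        z
          ≈⟨ solve 2 (λ z s → z := (z :- s) :+ s) refl z (p′ * s + r * t) ⟩
        (z - (p′ * s + r * t)) + (p′ * s + r * t)    ≈⟨ +-congʳ (trans (sym eq) (*-congˡ f-mod-p)) ⟩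
        w * (r ^ suc e + p′ * E) + (p′ * s + r * t)
          ≈⟨ solve 7 (λ w r R p E s t → w :* (r :* R :+ p :* E) :+ (p :* s :+ r :* t) := p :* (s :+ w :* E) :+ r :* (t :+ w :* R))
              refl w r (r ^ e) p′ E s t ⟩
        p′ * (s + w * E) + r * (t + w * r ^ e) ∎)

      radical : ∀ n t → QA.Span₂ p′ r (t A.^ n) → QA.Span₂ p′ r t
      radical n t t^n∈ = raise (≈0⇒∈ residue-isIdeal (reduced n t (∈⇒≈0 residue-isIdeal
          (subst (Span₂ p′ r) (≡.trans (^-quotient idealf t n) (≡.sym (^-quotient residue-isIdeal t n))) (lower t^n∈)))))
        where
        raise : Span₂ p′ r t → QA.Span₂ p′ r t
        raise (y , z , eq) = y , z , ≈⇒≈/ idealf eq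

    p-maximal : ∀ n g → coeff g n ≡ + 1 → ∀ h M → BinaryForm.form A/⟨ f ⟩ n g h (p′ * M) A.≈ 0# →
                ∃ λ h′ → h A.≈ p′ * h′
    p-maximal = Dedekind.divisible A/⟨ f ⟩ (+ p) r E (int u) (int v + int u * a) (int u * b′) e relation
      (≈⇒≈/ idealf E-unit)
      (ReductionProperties.torsion-free reduction-f p)
      (ReductionProperties.separated reduction-f p (prime≥2 pr)) radical

-- Arithmetic modulo primes

prime-coprime : ∀ {p n} → Prime p → p ∤ n → Coprime p n
prime-coprime pr p∤n (d∣p , d∣n) with prime⇒irreducible pr d∣p
... | inj₁ d≡1 = d≡1
... | inj₂ ≡.refl = contradiction d∣n p∤n

strip-prime-power : ∀ {p n} → Prime p → p ∤ n → ∀ i {z} → n ∣ p ℕ.^ i ℕ.* z → n ∣ z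
strip-prime-power {p} {n} pr p∤n zero    {z} n∣ = subst (n ∣_) (ℕₚ.*-identityˡ z) n∣
strip-prime-power {p} {n} pr p∤n (suc i) {z} n∣ = strip-prime-power pr p∤n i
  (coprime-divisor (Coprimality.sym (prime-coprime pr p∤n)) (subst (n ∣_) (ℕₚ.*-assoc p (p ℕ.^ i) z) n∣))

opaque
  -- Two of the powers p^0, ..., p^M agree modulo M, and the smaller one can be cancelled from their
  -- difference because p does not divide M.
  power≡1-mod : ∀ {p M} → Prime p → p ∤ M → 0 < M → ∃₂ λ N t → 0 < N × p ℕ.^ N ≡ 1 ℕ.+ M ℕ.* t
  power≡1-mod {p} {M@(suc _)} pr p∤M _ with Finₚ.pigeonhole (ℕₚ.n<1+n M) (λ i → fromℕ< (m%n<n (p ℕ.^ toℕ i) M))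
  ... | i , j , i<j , eq = N , proj₁ t , ℕₚ.m<n⇒0<n∸m i<j , (begin
      p ℕ.^ N                   ≡⟨ ℕₚ.m+[n∸m]≡n 1≤p^N ⟨
      1 ℕ.+ (p ℕ.^ N ℕ.∸ 1)     ≡⟨ ≡.cong suc (proj₂ t) ⟩
      1 ℕ.+ M ℕ.* proj₁ t ∎)
    where
    open ≡.≡-Reasoning
    N a b : ℕ
    N = toℕ j ℕ.∸ toℕ i
    a = p ℕ.^ toℕ i
    b = p ℕ.^ toℕ j
    1≤p^N : 1 ≤ p ℕ.^ N
    1≤p^N = ℕₚ.m^n>0 p {{prime⇒nonZero pr}} N
    b≡ : b ≡ a ℕ.* p ℕ.^ N
    b≡ = ≡.trans (≡.cong (p ℕ.^_) (≡.sym (ℕₚ.m+[n∸m]≡n (ℕₚ.<⇒≤ i<j)))) (ℕₚ.^-distribˡ-+-* p (toℕ i) N)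
    a%M≡b%M : a % M ≡ b % M
    a%M≡b%M = ≡.trans (≡.sym (Finₚ.toℕ-fromℕ< (m%n<n a M))) (≡.trans (≡.cong toℕ eq) (Finₚ.toℕ-fromℕ< (m%n<n b M)))
    M∣b-a : M ∣ a ℕ.* (p ℕ.^ N ℕ.∸ 1)
    M∣b-a = ℕ∣.divides (b / M ℕ.∸ a / M) (begin
      a ℕ.* (p ℕ.^ N ℕ.∸ 1)                                              ≡⟨ ℕₚ.*-distribˡ-∸ a (p ℕ.^ N) 1 ⟩
      a ℕ.* p ℕ.^ N ℕ.∸ a ℕ.* 1
        ≡⟨ ≡.cong₂ ℕ._∸_ (≡.sym b≡) (ℕₚ.*-identityʳ a) ⟩
      b ℕ.∸ a
        ≡⟨ ≡.cong₂ ℕ._∸_ (m≡m%n+[m/n]*n b M) (m≡m%n+[m/n]*n a M) ⟩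
      (b % M ℕ.+ b / M ℕ.* M) ℕ.∸ (a % M ℕ.+ a / M ℕ.* M)
        ≡⟨ ≡.cong (λ r → (b % M ℕ.+ b / M ℕ.* M) ℕ.∸ (r ℕ.+ a / M ℕ.* M)) a%M≡b%M ⟩
      (b % M ℕ.+ b / M ℕ.* M) ℕ.∸ (b % M ℕ.+ a / M ℕ.* M)               ≡⟨ ℕₚ.[m+n]∸[m+o]≡n∸o (b % M) _ _ ⟩
      b / M ℕ.* M ℕ.∸ a / M ℕ.* M                                        ≡⟨ ℕₚ.*-distribʳ-∸ M (b / M) (a / M) ⟨
      (b / M ℕ.∸ a / M) ℕ.* M ∎)
    t : ∃ λ t → p ℕ.^ N ℕ.∸ 1 ≡ M ℕ.* t
    t with strip-prime-power pr p∤M (toℕ i) M∣b-a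
    ... | ℕ∣.divides q e = q , ≡.trans e (ℕₚ.*-comm q M)

opaque
  prime-to-part : ∀ {p} → Prime p → ∀ k → 0 < k → ∃₂ λ j k′ → k ≡ p ℕ.^ j ℕ.* k′ × p ∤ k′
  prime-to-part {p} pr k 0<k = go k 0<k (<-wellFounded k)
    where
    go : ∀ k → 0 < k → Acc _<_ k → ∃₂ λ j k′ → k ≡ p ℕ.^ j ℕ.* k′ × p ∤ k′
    go k 0<k (acc rec) with p ∣? k
    ... | no p∤k = 0 , k , ≡.sym (ℕₚ.*-identityˡ k) , p∤k
    ... | yes (ℕ∣.divides zero ≡.refl) = contradiction 0<k λ ()
    ... | yes (ℕ∣.divides q@(suc _) ≡.refl) with go q (s≤s z≤n) (rec (ℕₚ.m<m*n q p (prime≥2 pr)))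
    ...   | j , k′ , eq , p∤k′ = suc j , k′ , ≡.trans (≡.cong (ℕ._* p) eq)
              (≡.trans (ℕₚ.*-comm _ p) (≡.sym (ℕₚ.*-assoc p (p ℕ.^ j) k′))) , p∤k′

euclidℤ : ∀ {p} → Prime p → ∀ a b → + p ∣ˢ a ℤ.* b → + p ∣ˢ a ⊎ + p ∣ˢ b
euclidℤ {p} pr a b p∣ab with euclidsLemma ∣ a ∣ ∣ b ∣ pr (subst (p ∣_) (ℤₚ.abs-* a b) (∣⇒∣ᵤ p∣ab))
... | inj₁ p∣a = inj₁ (∣ᵤ⇒∣ p∣a)
... | inj₂ p∣b = inj₂ (∣ᵤ⇒∣ p∣b)

prime∣power⇒∣ℤ : ∀ {p} → Prime p → ∀ a n → + p ∣ˢ a ℤ.^ n → + p ∣ˢ a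
prime∣power⇒∣ℤ pr a zero    p∣1 = contradiction (∣⇒∣ᵤ p∣1) (prime∤1 pr)
prime∣power⇒∣ℤ pr a (suc n) p∣  = [ (λ p∣a → p∣a) , prime∣power⇒∣ℤ pr a n ]′ (euclidℤ pr a (a ℤ.^ n) p∣)

prime∤1ℤ : ∀ {p} → Prime p → ¬ (+ p ∣ˢ + 1)
prime∤1ℤ pr p∣1 = prime∤1 pr (∣⇒∣ᵤ p∣1)

module ModPrime (P : ℤ-Algebra) {p : ℕ} (pr : Prime p) where
  open ℤ-Algebra P
  open Quotient P

  private
    ideal = principal-isIdeal (int (+ p))

  P/p : ℤ-Algebra
  P/p = A/⟨ int (+ p) ⟩

  p≈0 : ℤ-Algebra._≈_ P/p (int (+ p)) 0#
  p≈0 = ∈⇒≈0 ideal (1# , *-identityˡ _)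

  fermat-divides : ∀ N a → int (+ p) ∣ᴿ (int a ^ (p ℕ.^ N) - int a)
  fermat-divides N a = subst (λ w → int (+ p) ∣ᴿ (w - int a)) (^-quotient ideal (int a) (p ℕ.^ N))
    (Characteristic.fermatᴺ P/p pr p≈0 N a)

ℤ-^ : ∀ a n → ℤ-Algebra._^_ ℤ-algebra a n ≡ a ℤ.^ n
ℤ-^ a zero    = ≡.refl
ℤ-^ a (suc n) = ≡.cong (a ℤ.*_) (ℤ-^ a n)

opaque
  fermat-ℤ : ∀ {p} → Prime p → ∀ N a → + p ∣ˢ a ℤ.^ (p ℕ.^ N) ℤ.- a
  fermat-ℤ {p} pr N a with ModPrime.fermat-divides ℤ-algebra pr N a
  ... | q , e = divides q (≡.trans (≡.cong (ℤ._- a) (≡.sym (ℤ-^ a (p ℕ.^ N)))) (≡.sym e))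

b^p-b : ∀ b {p} → 0 < p → b ℤ.^ p ℤ.- b ≡ b ℤ.* (b ℤ.^ (p ℕ.∸ 1) ℤ.- + 1)
b^p-b b {suc p} _ = solve 2 (λ a w → a :* w :- a := a :* (w :- con (+ 1))) ≡.refl b (b ℤ.^ p)
  where open +-*-Solver

opaque
  fermat-unit : ∀ {p} → Prime p → ∀ a → ¬ (+ p ∣ˢ a) → + p ∣ˢ a ℤ.^ (p ℕ.∸ 1) ℤ.- + 1
  fermat-unit {p} pr a p∤a = [ (λ p∣a → contradiction p∣a p∤a) , (λ p∣ → p∣) ]′ (euclidℤ pr a (a ℤ.^ (p ℕ.∸ 1) ℤ.- + 1) p∣)
    where
    p∣ : + p ∣ˢ a ℤ.* (a ℤ.^ (p ℕ.∸ 1) ℤ.- + 1)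
    p∣ = subst (+ p ∣ˢ_) (≡.trans (≡.cong (λ q → a ℤ.^ q ℤ.- a) (ℕₚ.*-identityʳ p)) (b^p-b a (prime>0 pr))) (fermat-ℤ pr 1 a)

opaque
  -- The inverse is a^(p-2), by Fermat.
  inverse-mod : ∀ {p} → Prime p → ∀ a → ¬ (+ p ∣ˢ a) → ∃₂ λ u v → u ℤ.* a ≡ + 1 ℤ.+ + p ℤ.* v
  inverse-mod {p} pr a p∤a with fermat-unit pr a p∤a
  ... | divides v e = a ℤ.^ (p ℕ.∸ 2) , v , (begin
      a ℤ.^ (p ℕ.∸ 2) ℤ.* a                ≡⟨ ℤₚ.*-comm (a ℤ.^ (p ℕ.∸ 2)) a ⟩
      a ℤ.^ suc (p ℕ.∸ 2)                  ≡⟨ ≡.cong (a ℤ.^_) (index p (prime≥2 pr)) ⟩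
      a ℤ.^ (p ℕ.∸ 1)
        ≡⟨ solve 1 (λ w → w := con (+ 1) :+ (w :- con (+ 1))) ≡.refl (a ℤ.^ (p ℕ.∸ 1)) ⟩
      + 1 ℤ.+ (a ℤ.^ (p ℕ.∸ 1) ℤ.- + 1)    ≡⟨ ≡.cong (ℤ._+_ (+ 1)) (≡.trans e (ℤₚ.*-comm v (+ p))) ⟩
      + 1 ℤ.+ + p ℤ.* v ∎)
    where
    open ≡.≡-Reasoning
    open +-*-Solver
    index : ∀ q → 2 ≤ q → suc (q ℕ.∸ 2) ≡ q ℕ.∸ 1
    index (suc zero)    (s≤s ())
    index (suc (suc q)) _ = ≡.refl

opaque
  -- The binomial expansion to first order in p; t collects everything of order p².
  power-shift : ∀ y z p n → ∃ λ t → (y ℤ.+ p ℤ.* z) ℤ.^ suc n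
                ≡ y ℤ.^ suc n ℤ.+ p ℤ.* (+ suc n ℤ.* (z ℤ.* y ℤ.^ n)) ℤ.+ p ℤ.* p ℤ.* t
  power-shift y z p zero    = + 0 , solve 3 (λ y z p → (y :+ p :* z) :* con (+ 1)
      := y :* con (+ 1) :+ p :* (con (+ 1) :* (z :* con (+ 1))) :+ p :* p :* con (+ 0)) ≡.refl y z p
    where open +-*-Solver
  power-shift y z p (suc n) with power-shift y z p n
  ... | t , e = (y ℤ.+ p ℤ.* z) ℤ.* t ℤ.+ + suc n ℤ.* (z ℤ.* z ℤ.* y ℤ.^ n) , (begin
      (y ℤ.+ p ℤ.* z) ℤ.* (y ℤ.+ p ℤ.* z) ℤ.^ suc n   ≡⟨ ≡.cong ((y ℤ.+ p ℤ.* z) ℤ.*_) e ⟩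
      (y ℤ.+ p ℤ.* z) ℤ.* (y ℤ.^ suc n ℤ.+ p ℤ.* (+ suc n ℤ.* (z ℤ.* y ℤ.^ n)) ℤ.+ p ℤ.* p ℤ.* t)
        ≡⟨ solve 6 (λ y z p Y n t → (y :+ p :* z) :* (y :* Y :+ p :* (n :* (z :* Y)) :+ p :* p :* t)
              := y :* (y :* Y) :+ p :* ((con (+ 1) :+ n) :* (z :* (y :* Y))) :+ p :* p :* ((y :+ p :* z) :* t :+ n :* (z :* z :* Y)))
            ≡.refl y z p (y ℤ.^ n) (+ suc n) t ⟩
      y ℤ.^ suc (suc n) ℤ.+ p ℤ.* (+ suc (suc n) ℤ.* (z ℤ.* y ℤ.^ suc n)) ℤ.+ p ℤ.* p ℤ.* ((y ℤ.+ p ℤ.* z) ℤ.* t ℤ.+ + suc n ℤ.* (z ℤ.* z ℤ.* y ℤ.^ n)) ∎)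
    where
    open ≡.≡-Reasoning
    open +-*-Solver

opaque
  -- In the expansion of (y + p q)^p the linear term carries the exponent p as a second factor p.
  lift-power : ∀ {p} → Prime p → ∀ x y → + p ∣ˢ x ℤ.- y → + p ℤ.* + p ∣ˢ x ℤ.^ p ℤ.- y ℤ.^ p
  lift-power {p} pr x y (divides q e) = go p ≡.refl
    where
    open ≡.≡-Reasoning
    open +-*-Solver
    x≡ : x ≡ y ℤ.+ + p ℤ.* q
    x≡ = ≡.trans (solve 2 (λ x y → x := y :+ (x :- y))
        ≡.refl x y) (≡.cong (ℤ._+_ y) (≡.trans e (ℤₚ.*-comm q (+ p))))
    go : ∀ n → p ≡ n → + p ℤ.* + p ∣ˢ x ℤ.^ n ℤ.- y ℤ.^ n
    go zero    eq = contradiction (subst (2 ≤_) eq (prime≥2 pr)) λ ()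
    go (suc n) eq with power-shift y q (+ p) n
    ... | t , e′ = divides (q ℤ.* y ℤ.^ n ℤ.+ t) (begin
      x ℤ.^ suc n ℤ.- y ℤ.^ suc n    ≡⟨ ≡.cong (λ x → x ℤ.^ suc n ℤ.- y ℤ.^ suc n) x≡ ⟩
      (y ℤ.+ + p ℤ.* q) ℤ.^ suc n ℤ.- y ℤ.^ suc n ≡⟨ ≡.cong (ℤ._- y ℤ.^ suc n) e′ ⟩
      (y ℤ.^ suc n ℤ.+ + p ℤ.* (+ suc n ℤ.* (q ℤ.* y ℤ.^ n)) ℤ.+ + p ℤ.* + p ℤ.* t) ℤ.- y ℤ.^ suc n
        ≡⟨ ≡.cong (λ m → (y ℤ.^ suc n ℤ.+ + p ℤ.* (+ m ℤ.* (q ℤ.* y ℤ.^ n)) ℤ.+ + p ℤ.* + p ℤ.* t) ℤ.- y ℤ.^ suc n) eq ⟨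
      (y ℤ.^ suc n ℤ.+ + p ℤ.* (+ p ℤ.* (q ℤ.* y ℤ.^ n)) ℤ.+ + p ℤ.* + p ℤ.* t) ℤ.- y ℤ.^ suc n
        ≡⟨ solve 4 (λ Y p w t → (Y :+ p :* (p :* w) :+ p :* p :* t) :- Y := (w :+ t) :* (p :* p))
            ≡.refl (y ℤ.^ suc n) (+ p) (q ℤ.* y ℤ.^ n) t ⟩
      (q ℤ.* y ℤ.^ n ℤ.+ t) ℤ.* (+ p ℤ.* + p) ∎)

opaque
  prime-square-divides : ∀ {p} → Prime p → ∀ a b → ¬ (+ p ∣ˢ a) → + p ℤ.* + p ∣ˢ a ℤ.* b → + p ℤ.* + p ∣ˢ b
  prime-square-divides {p} pr a b p∤a (divides q e) with euclidℤ pr a b (divides (q ℤ.* + p) (≡.trans e (≡.sym (ℤₚ.*-assoc q (+ p) (+ p)))))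
  ... | inj₁ p∣a = contradiction p∣a p∤a
  ... | inj₂ (divides b′ ≡.refl) with euclidℤ pr a b′ (divides q (ℤₚ.*-cancelʳ-≡ (a ℤ.* b′) (q ℤ.* + p) (+ p) {{prime⇒nonZero pr}}
           (≡.trans (ℤₚ.*-assoc a b′ (+ p)) (≡.trans e (≡.sym (ℤₚ.*-assoc q (+ p) (+ p)))))))
  ...   | inj₁ p∣a = contradiction p∣a p∤a
  ...   | inj₂ (divides b″ ≡.refl) = divides b″ (ℤₚ.*-assoc b″ (+ p) (+ p))

∣p²∣ : ∀ p → ∣ + p ℤ.* + p ∣ ≡ p ℕ.^ 2
∣p²∣ p = ≡.trans (ℤₚ.abs-* (+ p) (+ p)) (≡.cong (p ℕ.*_) (≡.sym (ℕₚ.*-identityʳ p)))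

Wieferich⇒ : ∀ {b p} → Wieferich b p → + p ℤ.* + p ∣ˢ (+ b) ℤ.^ p ℤ.- + b
Wieferich⇒ {b} {p} (pr , p²∣) = subst (+ p ℤ.* + p ∣ˢ_) (≡.sym (b^p-b (+ b) (prime>0 pr)))
  (Signed.∣n⇒∣m*n (+ b) (∣ᵤ⇒∣ (subst (_∣ ∣ (+ b) ℤ.^ (p ℕ.∸ 1) ℤ.- + 1 ∣) (≡.sym (∣p²∣ p)) p²∣)))

-- B = b^(p^j) is b modulo p, so B^p and b^p agree modulo p². The exponent p^(j+1) may thus be
-- lowered to p, and b is cancelled from b^p - b.
⇒Wieferich : ∀ {b p} → Prime p → ¬ (+ p ∣ˢ + b) → ∀ j → + p ℤ.* + p ∣ˢ (+ b) ℤ.^ (p ℕ.^ suc j) ℤ.- + b → Wieferich b p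
⇒Wieferich {b} {p} pr p∤b j p²∣ = pr , subst (_∣ ∣ (+ b) ℤ.^ (p ℕ.∸ 1) ℤ.- + 1 ∣) (∣p²∣ p) (∣⇒∣ᵤ (prime-square-divides pr (+ b) _ p∤b
    (subst (+ p ℤ.* + p ∣ˢ_) (b^p-b (+ b) (prime>0 pr)) p²∣b^p-b)))
  where
  open +-*-Solver
  B : ℤ
  B = (+ b) ℤ.^ (p ℕ.^ j)
  p²∣b^p-b : + p ℤ.* + p ∣ˢ (+ b) ℤ.^ p ℤ.- + b
  p²∣b^p-b = subst (+ p ℤ.* + p ∣ˢ_) (solve 3 (λ u v w → (u :- w) :- (u :- v) := v :- w)
      ≡.refl (B ℤ.^ p) ((+ b) ℤ.^ p) (+ b))
    (Signed.∣m∣n⇒∣m-n (subst (λ w → + p ℤ.* + p ∣ˢ w ℤ.- + b) (≡.trans (≡.cong ((+ b) ℤ.^_) (ℕₚ.*-comm p (p ℕ.^ j))) (≡.sym (ℤₚ.^-*-assoc (+ b) (p ℕ.^ j) p))) p²∣)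
      (lift-power pr B (+ b) (fermat-ℤ pr j (+ b))))

-- Expansions of the trinomial

odd⇒1+2l : ∀ n → 2 ∤ n → ∃ λ l → n ≡ suc (2 ℕ.* l)
odd⇒1+2l zero          2∤n = contradiction (2 ℕ∣.∣0) 2∤n
odd⇒1+2l (suc zero)    2∤n = 0 , ≡.refl
odd⇒1+2l (suc (suc n)) 2∤n with odd⇒1+2l n (λ 2∣n → 2∤n (ℕ∣.∣m∣n⇒∣m+n ℕ∣.∣-refl 2∣n))
... | l , ≡.refl = suc l , ≡.cong (λ m → suc (suc m)) (≡.sym (ℕₚ.+-suc l (l ℕ.+ 0)))

prime∣power⇒∣ : ∀ {p} → Prime p → ∀ n j → p ∣ n ℕ.^ j → p ∣ n
prime∣power⇒∣ pr n zero    p∣ = contradiction p∣ (prime∤1 pr)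
prime∣power⇒∣ pr n (suc j) p∣ = [ (λ d → d) , prime∣power⇒∣ pr n j ]′ (euclidsLemma n (n ℕ.^ j) pr p∣)

prime∤product : ∀ {p} → Prime p → ∀ m n → p ∤ m → p ∤ n → p ∤ m ℕ.* n
prime∤product pr m n p∤m p∤n p∣mn = [ p∤m , p∤n ]′ (euclidsLemma m n pr p∣mn)

prime∤pred : ∀ {p} → Prime p → p ∤ (p ℕ.∸ 1)
prime∤pred {p} pr p∣ with p | prime≥2 pr
... | suc zero    | s≤s ()
... | suc (suc n) | _ = contradiction (ℕ∣.∣⇒≤ p∣) (ℕₚ.<⇒≱ ℕₚ.≤-refl)

-- Formed in an arbitrary algebra, so that the same expression can be evaluated modulo p, modulo r
-- and modulo (p, r).
trinomial : (Q : ℤ-Algebra) → ℤ-Algebra.Carrier Q → ℕ → ℤ → ℤ → ℤ-Algebra.Carrier Q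
trinomial Q x k A b = x ^ (2 ℕ.* k) + int A * x ^ k + int b
  where open ℤ-Algebra Q

binomial : (Q : ℤ-Algebra) → ℤ-Algebra.Carrier Q → ℕ → ℤ → ℤ-Algebra.Carrier Q
binomial Q x k c = x ^ k + int c
  where open ℤ-Algebra Q

module Evaluations (Q : ℤ-Algebra) where
  open ℤ-Algebra Q
  open Solver Q
  open Powers Q
  open import Relation.Binary.Reasoning.Setoid setoid

  ∣⇒int≈0 : ∀ {n a} → int n ≈ 0# → n ∣ˢ a → int a ≈ 0#
  ∣⇒int≈0 {n} n≈0 (divides q ≡.refl) = trans (*-homo q n) (trans (*-congˡ n≈0) (zeroʳ _))

  ∣-⇒int≈ : ∀ {n a b} → int n ≈ 0# → n ∣ˢ a ℤ.- b → int a ≈ int b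
  ∣-⇒int≈ {n} {a} {b} n≈0 n∣ = begin
    int a                      ≈⟨ int-cong (ℤS.solve 2 (λ a b → a ℤS.:= b ℤS.:+ (a ℤS.:- b)) ≡.refl a b) ⟩
    int (b ℤ.+ (a ℤ.- b))      ≈⟨ +-homo b _ ⟩
    int b + int (a ℤ.- b)      ≈⟨ +-congˡ (∣⇒int≈0 n≈0 n∣) ⟩
    int b + 0#                 ≈⟨ +-identityʳ _ ⟩
    int b ∎
    where module ℤS = +-*-Solver

  binomial-root : ∀ {x n c} → binomial Q x n c ≈ 0# → x ^ n ≈ - int c
  binomial-root {x} {n} {c} e = begin
    x ^ n                      ≈⟨ solve 2 (λ u v → u := (u :+ v) :- v) refl (x ^ n) (int c) ⟩
    (x ^ n + int c) - int c    ≈⟨ +-congʳ e ⟩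
    0# - int c                 ≈⟨ +-identityˡ _ ⟩
    - int c ∎

  neg-odd-power : ∀ z l → (- z) ^ suc (2 ℕ.* l) ≈ - (z ^ suc (2 ℕ.* l))
  neg-odd-power z l = begin
    - z * (- z) ^ (2 ℕ.* l)     ≈⟨ *-congˡ (^-assocʳ (- z) 2 l) ⟨
    - z * ((- z) ^ 2) ^ l       ≈⟨ *-congˡ (^-congˡ l (solve 1 (λ z → (:- z) :^ 2 := z :^ 2) refl z)) ⟩
    - z * (z ^ 2) ^ l           ≈⟨ *-congˡ (^-assocʳ z 2 l) ⟩
    - z * z ^ (2 ℕ.* l)         ≈⟨ solve 2 (λ z w → :- z :* w := :- (z :* w)) refl z _ ⟩
    - (z * z ^ (2 ℕ.* l)) ∎

  trinomial-at : ∀ {x} k A b {y} → x ^ k ≈ y → trinomial Q x k A b ≈ y ^ 2 + int A * y + int b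
  trinomial-at {x} k A b {y} e = +-congʳ (+-cong (trans (^-congᵉ x (ℕₚ.*-comm 2 k)) (trans (sym (^-assocʳ x k 2)) (^-congˡ 2 e))) (*-congˡ e))

  module _ {p : ℕ} (pr : Prime p) (p≈0 : int (+ p) ≈ 0#) where
    open Characteristic Q pr p≈0

    -- In characteristic p the middle term vanishes, c is its own p^j-th power, and Frobenius is
    -- additive.
    trinomial≈binomial-power : ∀ x {k K j A b c} → K ℕ.* p ℕ.^ j ≡ 2 ℕ.* k → + p ∣ˢ A → + p ∣ˢ b ℤ.- c →
      trinomial Q x k A b ≈ binomial Q x K c ^ (p ℕ.^ j)
    trinomial≈binomial-power x {k} {K} {j} {A} {b} {c} eq p∣A p∣b-c = begin
      x ^ (2 ℕ.* k) + int A * x ^ k + int b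
        ≈⟨ +-cong (+-cong (^-congᵉ x (≡.sym eq)) (trans (*-congʳ (∣⇒int≈0 p≈0 p∣A)) (zeroˡ _))) (∣-⇒int≈ p≈0 p∣b-c) ⟩
      x ^ (K ℕ.* p ℕ.^ j) + 0# + int c
        ≈⟨ +-cong (trans (+-identityʳ _) (sym (^-assocʳ x K (p ℕ.^ j)))) (sym (fermatᴺ j c)) ⟩
      (x ^ K) ^ (p ℕ.^ j) + int c ^ (p ℕ.^ j)     ≈⟨ frobeniusᴺ j (x ^ K) (int c) ⟨
      (x ^ K + int c) ^ (p ℕ.^ j) ∎

    -- Some power p^N with N > 0 is 1 modulo the exponent M.
    fixed-by-order : ∀ x M → p ∤ M → 0 < M → x ^ M ≈ 1# → ∃ λ N → 0 < N × x ^ (p ℕ.^ N) ≈ x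
    fixed-by-order x M p∤M 0<M x^M≈1 with power≡1-mod pr p∤M 0<M
    ... | N , t , 0<N , eq = N , 0<N , (begin
      x ^ (p ℕ.^ N)         ≈⟨ ^-congᵉ x eq ⟩
      x * x ^ (M ℕ.* t)     ≈⟨ *-congˡ (1≈x^kn {k = M} t x^M≈1) ⟩
      x * 1#                ≈⟨ *-identityʳ x ⟩
      x ∎)

    fermat-inverse : ∀ c → ¬ (+ p ∣ˢ c) → int c ^ (p ℕ.∸ 1) ≈ 1#
    fermat-inverse c p∤c = trans (sym (int-^ c (p ℕ.∸ 1))) (trans (∣-⇒int≈ p≈0 (fermat-unit pr c p∤c)) 1#-homo)

    -- x^K = - c is a nonzero residue modulo p, so its (p - 1)-th power is 1, and p divides neither
    -- K nor p - 1.
    binomial-fixed : ∀ x K c → p ∤ K → 0 < K → ¬ (+ p ∣ˢ c) → binomial Q x K c ≈ 0# → ∃ λ N → 0 < N × x ^ (p ℕ.^ N) ≈ x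
    binomial-fixed x K c p∤K 0<K p∤c e = fixed-by-order x (K ℕ.* (p ℕ.∸ 1)) (prime∤product pr K (p ℕ.∸ 1) p∤K (prime∤pred pr))
      (ℕₚ.*-mono-< 0<K (ℕₚ.m<n⇒0<n∸m (prime≥2 pr))) (begin
      x ^ (K ℕ.* (p ℕ.∸ 1))         ≈⟨ ^-assocʳ x K (p ℕ.∸ 1) ⟨
      (x ^ K) ^ (p ℕ.∸ 1)
        ≈⟨ ^-congˡ (p ℕ.∸ 1) (trans (binomial-root {x} {K} {c} e) (sym (-‿homo c))) ⟩
      int (ℤ.- c) ^ (p ℕ.∸ 1)
        ≈⟨ fermat-inverse (ℤ.- c) (λ p∣ → p∤c (subst (+ p ∣ˢ_) (ℤₚ.neg-involutive c) (Signed.∣m⇒∣-m p∣))) ⟩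
      1# ∎)

    -- The root y = x^k lies in the field with p² elements, and x has order prime to p.
    separable-fixed : ∀ x k A b → p ∤ k → 0 < k → ¬ (+ p ∣ˢ b) → ¬ (+ p ∣ˢ A ℤ.* A ℤ.- + 4 ℤ.* b) →
      trinomial Q x k A b ≈ 0# → ∃ λ N → 0 < N × x ^ (p ℕ.^ N) ≈ x
    separable-fixed x k A b p∤k 0<k p∤b p∤Δ root = by-parity (2 ∣? p)
      where
      y : Carrier
      y = x ^ k
      quadratic : y ^ 2 + int A * y + int b ≈ 0#
      quadratic = trans (sym (trinomial-at k A b refl)) root
      by-parity : Dec (2 ∣ p) → ∃ λ N → 0 < N × x ^ (p ℕ.^ N) ≈ x
      -- For p = 2 both A and b are odd, so y² + y + 1 = 0 and y³ = 1.
      by-parity (yes 2∣p) = fixed-by-order x (k ℕ.* 3) (prime∤product pr k 3 p∤k (subst (_∤ 3) p≡2 (toWitnessFalse {a? = 2 ∣? 3} _)))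
          (ℕₚ.*-mono-< 0<k (s≤s z≤n)) (trans (sym (^-assocʳ x k 3)) (begin
            y ^ 3
              ≈⟨ solve 2 (λ y b → y :^ 3 := (y :- con (+ 1)) :* (y :^ 2 :+ con (+ 1) :* y :+ con (+ 1)) :+ con (+ 1))
                  refl y (int b) ⟩
            (y - int (+ 1)) * (y ^ 2 + int (+ 1) * y + int (+ 1)) + int (+ 1)
              ≈⟨ +-congʳ (*-congˡ (+-cong (+-congˡ (*-congʳ A≈1)) b≈1)) ⟨
            (y - int (+ 1)) * (y ^ 2 + int A * y + int b) + int (+ 1)
              ≈⟨ +-congʳ (trans (*-congˡ quadratic) (zeroʳ _)) ⟩
            0# + int (+ 1)   ≈⟨ +-identityˡ _ ⟩
            int (+ 1)        ≈⟨ 1#-homo ⟩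
            1# ∎))
        where
        p≡2 : 2 ≡ p
        p≡2 with prime⇒irreducible pr 2∣p
        ... | inj₂ e = e
        odd-int≈1 : ∀ c → ¬ (+ p ∣ˢ c) → int c ≈ int (+ 1)
        odd-int≈1 c p∤c = begin
          int c               ≈⟨ *-identityʳ _ ⟨
          int c ^ 1           ≈⟨ ^-congᵉ (int c) (≡.cong (ℕ._∸ 1) p≡2) ⟩
          int c ^ (p ℕ.∸ 1)   ≈⟨ fermat-inverse c p∤c ⟩
          1#                  ≈⟨ 1#-homo ⟨
          int (+ 1) ∎
        b≈1 : int b ≈ int (+ 1)
        b≈1 = odd-int≈1 b p∤b
        A≈1 : int A ≈ int (+ 1)
        A≈1 = odd-int≈1 A λ p∣A → p∤Δ (Signed.∣m∣n⇒∣m-n (Signed.∣m⇒∣m*n A p∣A) (Signed.∣m⇒∣m*n b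
          (subst (λ q → + q ∣ˢ + 4) p≡2 (divides (+ 2) ≡.refl))))
      by-parity (no 2∤p) = fixed-by-order x (k ℕ.* (2 ℕ.* l ℕ.* (2 ℕ.* suc l)))
          (prime∤product pr k _ p∤k p∤M) (ℕₚ.*-mono-< 0<k 0<M) (trans (sym (^-assocʳ x k M)) y^M≈1)
        where
        l = proj₁ (odd⇒1+2l p 2∤p)
        p≡ : p ≡ suc (2 ℕ.* l)
        p≡ = proj₂ (odd⇒1+2l p 2∤p)
        -- With p = 2 l + 1 this is p² - 1.
        M = 2 ℕ.* l ℕ.* (2 ℕ.* suc l)
        p²≡ : p ℕ.^ 2 ≡ suc M
        p²≡ = ≡.trans (≡.cong (ℕ._^ 2) p≡) (solveℕ 1 (λ l → (conℕ 1 ⊕ conℕ 2 ⊗ l) ⊗ ((conℕ 1 ⊕ conℕ 2 ⊗ l) ⊗ conℕ 1) ⊜ conℕ 1 ⊕ conℕ 2 ⊗ l ⊗ (conℕ 2 ⊗ (conℕ 1 ⊕ l)))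
            ≡.refl l)
          where open ℕ-Solver renaming (solve to solveℕ; con to conℕ; _:+_ to _⊕_; _:*_ to _⊗_; _:=_ to _⊜_)
        p∤M : p ∤ M
        p∤M p∣M = prime∤1 pr (ℕ∣.∣m+n∣m⇒∣n (subst (p ∣_) (≡.trans p²≡ (ℕₚ.+-comm 1 M)) (ℕ∣.∣m⇒∣m*n (p ℕ.* 1) ℕ∣.∣-refl)) p∣M)
        0<l : ∀ l → p ≡ suc (2 ℕ.* l) → 0 < l
        0<l zero    e = contradiction (subst (2 ≤_) e (prime≥2 pr)) λ { (s≤s ()) }
        0<l (suc l) e = s≤s z≤n
        0<M : 0 < M
        0<M = ℕₚ.*-mono-< (ℕₚ.*-mono-< {0} {2} {0} {l} (s≤s z≤n) (0<l l p≡)) (s≤s z≤n)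
        -- A square root of the discriminant: z^(p² - 1) is a power of Δ^(p - 1) = 1. Applying
        -- Frobenius twice to z = 2 y + A then gives y^(p²) = y without constructing the field with
        -- p² elements.
        z : Carrier
        z = int (+ 2) * y + int A
        Δ : ℤ
        Δ = A ℤ.* A ℤ.- + 4 ℤ.* b
        z²≈Δ : z ^ 2 ≈ int Δ
        z²≈Δ = begin
          z ^ 2
            ≈⟨ solve 3 (λ y A b → (con (+ 2) :* y :+ A) :^ 2 := con (+ 4) :* (y :^ 2 :+ A :* y :+ b) :+ (A :* A :- con (+ 4) :* b))
                refl y (int A) (int b) ⟩
          int (+ 4) * (y ^ 2 + int A * y + int b) + (int A * int A - int (+ 4) * int b)
            ≈⟨ +-cong (trans (*-congˡ quadratic) (zeroʳ _)) (+-cong (sym (*-homo A A)) (trans (-‿cong (sym (*-homo (+ 4) b))) (sym (-‿homo _)))) ⟩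
          0# + (int (A ℤ.* A) + int (ℤ.- (+ 4 ℤ.* b)))    ≈⟨ +-identityˡ _ ⟩
          int (A ℤ.* A) + int (ℤ.- (+ 4 ℤ.* b))           ≈⟨ +-homo _ _ ⟨
          int Δ ∎
        z^M≈1 : z ^ M ≈ 1#
        z^M≈1 = begin
          z ^ M
            ≈⟨ ^-congᵉ z (solveℕ 1 (λ l → conℕ 2 ⊗ l ⊗ (conℕ 2 ⊗ (conℕ 1 ⊕ l)) ⊜ conℕ 2 ⊗ (conℕ 2 ⊗ l ⊗ (conℕ 1 ⊕ l)))
                ≡.refl l) ⟩
          z ^ (2 ℕ.* (2 ℕ.* l ℕ.* suc l))     ≈⟨ ^-assocʳ z 2 (2 ℕ.* l ℕ.* suc l) ⟨
          (z ^ 2) ^ (2 ℕ.* l ℕ.* suc l)       ≈⟨ ^-congˡ (2 ℕ.* l ℕ.* suc l) z²≈Δ ⟩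
          int Δ ^ (2 ℕ.* l ℕ.* suc l)
            ≈⟨ 1≈x^kn {k = 2 ℕ.* l} (suc l) (trans (^-congᵉ (int Δ) (≡.cong (ℕ._∸ 1) (≡.sym p≡))) (fermat-inverse Δ p∤Δ)) ⟩
          1# ∎
          where open ℕ-Solver renaming (solve to solveℕ; con to conℕ; _:+_ to _⊕_; _:*_ to _⊗_; _:=_ to _⊜_)
        2y^p² : int (+ 2) * y ^ (p ℕ.^ 2) ≈ int (+ 2) * y
        2y^p² = begin
          int (+ 2) * y ^ (p ℕ.^ 2)
            ≈⟨ solve 2 (λ u A → u := (u :+ A) :- A) refl _ (int A) ⟩
          (int (+ 2) * y ^ (p ℕ.^ 2) + int A) - int A
            ≈⟨ +-congʳ (+-cong (*-congʳ (fermatᴺ 2 (+ 2))) (fermatᴺ 2 A)) ⟨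
          (int (+ 2) ^ (p ℕ.^ 2) * y ^ (p ℕ.^ 2) + int A ^ (p ℕ.^ 2)) - int A
            ≈⟨ +-congʳ (+-congʳ (^-distrib-* (int (+ 2)) y (p ℕ.^ 2))) ⟨
          ((int (+ 2) * y) ^ (p ℕ.^ 2) + int A ^ (p ℕ.^ 2)) - int A ≈⟨ +-congʳ (frobeniusᴺ 2 _ _) ⟨
          z ^ (p ℕ.^ 2) - int A                                    ≈⟨ +-congʳ (^-congᵉ z p²≡) ⟩
          z * z ^ M - int A
            ≈⟨ +-congʳ (trans (*-congˡ z^M≈1) (*-identityʳ z)) ⟩
          z - int A
            ≈⟨ solve 2 (λ u A → (u :+ A) :- A := u) refl _ (int A) ⟩
          int (+ 2) * y ∎
        -- 2 (l + 1) = p + 1, so l + 1 inverts 2.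
        half : ∀ w → int (+ suc l) * (int (+ 2) * w) ≈ w
        half w = begin
          int (+ suc l) * (int (+ 2) * w)     ≈⟨ *-assoc _ _ w ⟨
          int (+ suc l) * int (+ 2) * w       ≈⟨ *-congʳ (*-homo (+ suc l) (+ 2)) ⟨
          int (+ suc l ℤ.* + 2) * w           ≈⟨ *-congʳ (int-cong (≡.cong +_ suc-l*2)) ⟩
          int (+ 1 ℤ.+ + p) * w
            ≈⟨ *-congʳ (trans (+-homo (+ 1) (+ p)) (trans (+-cong 1#-homo p≈0) (+-identityʳ 1#))) ⟩
          1# * w                              ≈⟨ *-identityˡ w ⟩
          w ∎
          where
          suc-l*2 : suc l ℕ.* 2 ≡ suc p
          suc-l*2 = ≡.trans (≡.cong (λ n → suc (suc n)) (ℕₚ.*-comm l 2)) (≡.cong suc (≡.sym p≡))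
        y^p² : y ^ (p ℕ.^ 2) ≈ y
        y^p² = trans (sym (half _)) (trans (*-congˡ 2y^p²) (half y))
        -- y (y + A) = - b is a unit, so y can be cancelled from y^(p²) = y.
        y^M≈1 : y ^ M ≈ 1#
        y^M≈1 with inverse-mod pr b p∤b
        ... | w , v , wb≡ = begin
          y ^ M
            ≈⟨ solve 3 (λ Y q W → Y := Y :* W :* q :+ Y :* (con (+ 1) :- W :* q)) refl (y ^ M) (int b) (int w) ⟩
          y ^ M * int w * int b + y ^ M * (int (+ 1) - int w * int b)
            ≈⟨ +-congˡ (trans (*-congˡ (trans (+-congˡ (-‿cong wb≈1)) (-‿inverseʳ _))) (zeroʳ _)) ⟩
          y ^ M * int w * int b + 0#              ≈⟨ +-identityʳ _ ⟩
          y ^ M * int w * int b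
            ≈⟨ solve 5 (λ Y y A b w → Y :* w :* b := Y :* w :* (y :^ 2 :+ A :* y :+ b) :- w :* (y :+ A) :* (y :* Y))
                refl (y ^ M) y (int A) (int b) (int w) ⟩
          y ^ M * int w * (y ^ 2 + int A * y + int b) - int w * (y + int A) * (y * y ^ M)
            ≈⟨ +-cong (trans (*-congˡ quadratic) (sym (trans (*-congˡ quadratic) (trans (zeroʳ _) (sym (zeroʳ _)))))) (-‿cong (*-congˡ (trans (^-congᵉ y (≡.sym p²≡)) y^p²))) ⟩
          int w * (y ^ 2 + int A * y + int b) - int w * (y + int A) * y
            ≈⟨ solve 4 (λ y A b w → w :* (y :^ 2 :+ A :* y :+ b) :- w :* (y :+ A) :* y := w :* b)
                refl y (int A) (int b) (int w) ⟩
          int w * int b    ≈⟨ wb≈1 ⟩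
          int (+ 1)        ≈⟨ 1#-homo ⟩
          1# ∎
          where
          wb≈1 : int w * int b ≈ int (+ 1)
          wb≈1 = trans (sym (*-homo w b)) (trans (int-cong wb≡) (trans (+-homo (+ 1) _) (trans (+-congˡ (trans (*-homo (+ p) v) (trans (*-congʳ p≈0) (zeroˡ _)))) (+-identityʳ _))))

trinomial-quotient : ∀ (P : ℤ-Algebra) {I} (ideal : Quotient.IsIdeal P I) x k A b →
  trinomial (Quotient.quotient P ideal) x k A b ≡ trinomial P x k A b
trinomial-quotient P ideal x k A b = ≡.cong₂ (λ u v → u + int A * v + int b)
  (Quotient.^-quotient P ideal x (2 ℕ.* k)) (Quotient.^-quotient P ideal x k)
  where open ℤ-Algebra P

binomial-quotient : ∀ (P : ℤ-Algebra) {I} (ideal : Quotient.IsIdeal P I) x k c →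
  binomial (Quotient.quotient P ideal) x k c ≡ binomial P x k c
binomial-quotient P ideal x k c = ≡.cong (λ u → u + int c) (Quotient.^-quotient P ideal x k)
  where open ℤ-Algebra P

-- Only c modulo p matters; p a absorbs the rest of the value of f / p at a root of r.
record Expansion (P : ℤ-Algebra) (p : ℕ) (f r : ℤ-Algebra.Carrier P) (e : ℕ) (c : ℤ) : Set where
  open ℤ-Algebra P
  field
    E a b   : Carrier
    f-mod-p : f ≈ r ^ suc e + int (+ p) * E
    f-mod-r : f ≈ int (+ p) * (int c + int (+ p) * a) + r * b

module Expand (P : ℤ-Algebra) where
  open ℤ-Algebra P
  open Quotient P
  open Solver P
  open import Relation.Binary.Reasoning.Setoid setoid

  expansion : ∀ p f r e c a →
    ℤ-Algebra._≈_ A/⟨ int (+ p) ⟩ f (r ^ suc e) →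
    ℤ-Algebra._≈_ A/⟨ r ⟩ f (int (+ p) * (int c + int (+ p) * a)) → Expansion P p f r e c
  expansion p f r e c a (E , mod-p) (b , mod-r) = record
    { E = E ; a = a ; b = b ; f-mod-p = recover E mod-p ; f-mod-r = recover b mod-r }
    where
    recover : ∀ {u v w} q → q * w ≈ u - v → u ≈ v + w * q
    recover {u} {v} {w} q eq = begin
      u              ≈⟨ solve 2 (λ u v → u := v :+ (u :- v)) refl u v ⟩
      v + (u - v)    ≈⟨ +-congˡ eq ⟨
      v + q * w      ≈⟨ +-congˡ (*-comm q w) ⟩
      v + w * q ∎

module BinomialExpansions (P : ℤ-Algebra) (x : ℤ-Algebra.Carrier P) where
  open ℤ-Algebra P
  open Quotient P
  open Expand P

  private
    mod-p : ∀ {p} → Prime p → ∀ {k K j A b c} → K ℕ.* p ℕ.^ j ≡ 2 ℕ.* k → + p ∣ˢ A → + p ∣ˢ b ℤ.- c →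
      ℤ-Algebra._≈_ A/⟨ int (+ p) ⟩ (trinomial P x k A b) (binomial P x K c ^ (p ℕ.^ j))
    mod-p {p} pr {k} {K} {j} {A} {b} {c} eq p∣A p∣b-c = ≡.subst₂ P/p._≈_ (trinomial-quotient P ideal x k A b)
      (≡.trans (≡.cong (P/p._^ (p ℕ.^ j)) (binomial-quotient P ideal x K c)) (^-quotient ideal (binomial P x K c) (p ℕ.^ j)))
      (Evaluations.trinomial≈binomial-power A/⟨ int (+ p) ⟩ pr (ModPrime.p≈0 P pr) x {k} {K} {j} eq p∣A p∣b-c)
      where
      ideal = principal-isIdeal (int (+ p))
      module P/p = ℤ-Algebra A/⟨ int (+ p) ⟩

    module ModBinomial (K : ℕ) (c : ℤ) where
      r : Carrier
      r = binomial P x K c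
      ideal = principal-isIdeal r
      module R = ℤ-Algebra A/⟨ r ⟩
      r≈0 : binomial A/⟨ r ⟩ x K c R.≈ 0#
      r≈0 = subst (R._≈ 0#) (≡.sym (binomial-quotient P ideal x K c)) (∈⇒≈0 ideal (1# , *-identityˡ r))
      x^K : x R.^ K R.≈ - int c
      x^K = Evaluations.binomial-root A/⟨ r ⟩ {x} {K} {c} r≈0

    suc-pred-power : ∀ {p} → Prime p → ∀ j → suc (p ℕ.^ j ℕ.∸ 1) ≡ p ℕ.^ j
    suc-pred-power pr j = ℕₚ.m+[n∸m]≡n (ℕₚ.m^n>0 _ {{prime⇒nonZero pr}} j)

  -- At a root of r, x^(2k) = (- b)^q = - b^q because q is odd, while A x^k is a multiple of p². So
  -- f is - (b^q - b) = - w p modulo p².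
  odd-expansion : ∀ {p} → Prime p → 2 ∤ p → ∀ k′ j {A b A′ w} →
    A ≡ + p ℤ.* + p ℤ.* A′ → b ℤ.^ (p ℕ.^ j) ℤ.- b ≡ w ℤ.* + p →
    Expansion P p (trinomial P x (k′ ℕ.* p ℕ.^ j) A b) (binomial P x (2 ℕ.* k′) b) (p ℕ.^ j ℕ.∸ 1) (ℤ.- w)
  odd-expansion {p} pr 2∤p k′ j {A} {b} {A′} {w} A≡ w≡ = expansion p _ r (q ℕ.∸ 1) (ℤ.- w) (int A′ * x ^ k)
      (subst (λ e → ℤ-Algebra._≈_ A/⟨ int (+ p) ⟩ (trinomial P x k A b) (r ^ e)) (≡.sym (suc-pred-power pr j))
        (mod-p pr {k} {2 ℕ.* k′} {j} (ℕₚ.*-assoc 2 k′ q)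
          (divides (+ p ℤ.* A′) (≡.trans A≡ (ℤS.solve 2 (λ p a → p ℤS.:* p ℤS.:* a ℤS.:= p ℤS.:* a ℤS.:* p)
              ≡.refl (+ p) A′)))
          (subst (+ p ∣ˢ_) (≡.sym (ℤₚ.+-inverseʳ b)) (divides (+ 0) ≡.refl))))
      (subst (R._≈ int (+ p) * (int (ℤ.- w) + int (+ p) * (int A′ * x ^ k))) (trinomial-quotient P ideal x k A b)
        (subst (λ y → trinomial A/⟨ r ⟩ x k A b R.≈ int (+ p) * (int (ℤ.- w) + int (+ p) * (int A′ * y))) (^-quotient ideal x k) at-root))
    where
    module ℤS = +-*-Solver
    q = p ℕ.^ j
    k = k′ ℕ.* q
    open ModBinomial (2 ℕ.* k′) b
    open import Relation.Binary.Reasoning.Setoid R.setoid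
    module S = Solver A/⟨ r ⟩
    q-odd = odd⇒1+2l q (λ 2∣q → 2∤p (prime∣power⇒∣ prime[2] p j 2∣q))
    l = proj₁ q-odd
    x^2k : x R.^ (2 ℕ.* k) R.≈ - int (b ℤ.^ q)
    x^2k = begin
      x R.^ (2 ℕ.* k)             ≈⟨ R.^-congᵉ x (ℕₚ.*-assoc 2 k′ q) ⟨
      x R.^ (2 ℕ.* k′ ℕ.* q)      ≈⟨ R.^-assocʳ x (2 ℕ.* k′) q ⟨
      (x R.^ (2 ℕ.* k′)) R.^ q    ≈⟨ R.^-congˡ q x^K ⟩
      (- int b) R.^ q             ≈⟨ R.^-congᵉ (- int b) (proj₂ q-odd) ⟩
      (- int b) R.^ suc (2 ℕ.* l) ≈⟨ Evaluations.neg-odd-power A/⟨ r ⟩ (int b) l ⟩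
      - (int b R.^ suc (2 ℕ.* l)) ≈⟨ R.-‿cong (R.^-congᵉ (int b) (proj₂ q-odd)) ⟨
      - (int b R.^ q)             ≈⟨ R.-‿cong (R.int-^ b q) ⟨
      - int (b ℤ.^ q) ∎
    b^q : int (b ℤ.^ q) R.≈ int w * int (+ p) + int b
    b^q = begin
      int (b ℤ.^ q)
        ≈⟨ R.int-cong (≡.trans (ℤS.solve 2 (λ u b → u ℤS.:= (u ℤS.:- b) ℤS.:+ b)
            ≡.refl (b ℤ.^ q) b) (≡.cong (ℤ._+ b) w≡)) ⟩
      int (w ℤ.* + p ℤ.+ b)          ≈⟨ R.+-homo _ b ⟩
      int (w ℤ.* + p) + int b        ≈⟨ R.+-congʳ (R.*-homo w (+ p)) ⟩
      int w * int (+ p) + int b ∎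
    at-root : trinomial A/⟨ r ⟩ x k A b R.≈ int (+ p) * (int (ℤ.- w) + int (+ p) * (int A′ * x R.^ k))
    at-root = begin
      x R.^ (2 ℕ.* k) + int A * x R.^ k + int b
        ≈⟨ R.+-congʳ (R.+-cong (R.trans x^2k (R.-‿cong b^q)) (R.*-congʳ (R.trans (R.int-cong A≡) (R.trans (R.*-homo _ A′) (R.*-congʳ (R.*-homo (+ p) (+ p))))))) ⟩
      - (int w * int (+ p) + int b) + int (+ p) * int (+ p) * int A′ * x R.^ k + int b
        ≈⟨ S.solve 5 (λ w p b A X → S.:- (w S.:* p S.:+ b) S.:+ p S.:* p S.:* A S.:* X S.:+ b S.:= p S.:* (S.:- w S.:+ p S.:* (A S.:* X))) R.refl
             (int w) (int (+ p)) (int b) (int A′) (x R.^ k) ⟩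
      int (+ p) * (- int w + int (+ p) * (int A′ * x R.^ k))  ≈⟨ R.*-congˡ (R.+-congʳ (R.-‿homo w)) ⟨
      int (+ p) * (int (ℤ.- w) + int (+ p) * (int A′ * x R.^ k)) ∎

  -- The exponent 2k contributes a factor 2 even if k is odd, hence 2^(j+1). At a root of r, x^(2k)
  -- = (- 1)^(2^(j+1)) = 1, and f is 1 + b modulo 4.
  even-expansion : ∀ k′ j {A b A′ w} → A ≡ + 2 ℤ.* + 2 ℤ.* A′ → + 1 ℤ.+ b ≡ w ℤ.* + 2 →
    Expansion P 2 (trinomial P x (k′ ℕ.* 2 ℕ.^ j) A b) (binomial P x k′ (+ 1)) (2 ℕ.^ suc j ℕ.∸ 1) w
  even-expansion k′ j {A} {b} {A′} {w} A≡ w≡ = expansion 2 _ r (q ℕ.∸ 1) w (int A′ * x ^ k)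
      (subst (λ e → ℤ-Algebra._≈_ A/⟨ int (+ 2) ⟩ (trinomial P x k A b) (r ^ e)) (≡.sym (suc-pred-power prime[2] (suc j)))
        (mod-p prime[2] {k} {k′} {suc j} 2k≡
          (divides (+ 2 ℤ.* A′) (≡.trans A≡ (ℤS.solve 2 (λ p a → p ℤS.:* p ℤS.:* a ℤS.:= p ℤS.:* a ℤS.:* p)
              ≡.refl (+ 2) A′)))
          (divides (w ℤ.- + 1) (≡.trans (ℤS.solve 1 (λ b → b ℤS.:- ℤS.con (+ 1) ℤS.:= (ℤS.con (+ 1) ℤS.:+ b) ℤS.:- ℤS.con (+ 2))
              ≡.refl b)
            (≡.trans (≡.cong (ℤ._- + 2) w≡) (ℤS.solve 1 (λ w → w ℤS.:* ℤS.con (+ 2) ℤS.:- ℤS.con (+ 2) ℤS.:= (w ℤS.:- ℤS.con (+ 1)) ℤS.:* ℤS.con (+ 2))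
                ≡.refl w))))))
      (subst (R._≈ int (+ 2) * (int w + int (+ 2) * (int A′ * x ^ k))) (trinomial-quotient P ideal x k A b)
        (subst (λ y → trinomial A/⟨ r ⟩ x k A b R.≈ int (+ 2) * (int w + int (+ 2) * (int A′ * y))) (^-quotient ideal x k) at-root))
    where
    module ℤS = +-*-Solver
    q = 2 ℕ.^ suc j
    k = k′ ℕ.* 2 ℕ.^ j
    2k≡ : k′ ℕ.* q ≡ 2 ℕ.* k
    2k≡ = ≡.trans (≡.sym (ℕₚ.*-assoc k′ 2 (2 ℕ.^ j))) (≡.trans (≡.cong (ℕ._* 2 ℕ.^ j) (ℕₚ.*-comm k′ 2)) (ℕₚ.*-assoc 2 k′ (2 ℕ.^ j)))
    open ModBinomial k′ (+ 1)
    open import Relation.Binary.Reasoning.Setoid R.setoid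
    module S = Solver A/⟨ r ⟩
    x^2k : x R.^ (2 ℕ.* k) R.≈ int (+ 1)
    x^2k = begin
      x R.^ (2 ℕ.* k)                          ≈⟨ R.^-congᵉ x 2k≡ ⟨
      x R.^ (k′ ℕ.* q)                         ≈⟨ R.^-assocʳ x k′ q ⟨
      (x R.^ k′) R.^ q                         ≈⟨ R.^-congˡ q x^K ⟩
      (- int (+ 1)) R.^ (2 ℕ.* 2 ℕ.^ j)        ≈⟨ R.^-assocʳ (- int (+ 1)) 2 (2 ℕ.^ j) ⟨
      ((- int (+ 1)) R.^ 2) R.^ (2 ℕ.^ j)
        ≈⟨ R.^-congˡ (2 ℕ.^ j) (R.trans (S.solve 0 ((S.:- S.con (+ 1)) S.:^ 2 S.:= S.con (+ 1)) R.refl) R.1#-homo) ⟩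
      1# R.^ (2 ℕ.^ j)                         ≈⟨ Powers.1^n≈1 A/⟨ r ⟩ (2 ℕ.^ j) ⟩
      1#                                       ≈⟨ R.1#-homo ⟨
      int (+ 1) ∎
    at-root : trinomial A/⟨ r ⟩ x k A b R.≈ int (+ 2) * (int w + int (+ 2) * (int A′ * x R.^ k))
    at-root = begin
      x R.^ (2 ℕ.* k) + int A * x R.^ k + int b
        ≈⟨ R.+-congʳ (R.+-cong x^2k (R.*-congʳ (R.trans (R.int-cong A≡) (R.trans (R.*-homo _ A′) (R.*-congʳ (R.*-homo (+ 2) (+ 2))))))) ⟩
      int (+ 1) + int (+ 2) * int (+ 2) * int A′ * x R.^ k + int b
        ≈⟨ S.solve 4 (λ o b A X → o S.:+ A S.:* X S.:+ b S.:= (o S.:+ b) S.:+ A S.:* X)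
            R.refl (int (+ 1)) (int b) (int (+ 2) * int (+ 2) * int A′) (x R.^ k) ⟩
      (int (+ 1) + int b) + int (+ 2) * int (+ 2) * int A′ * x R.^ k
        ≈⟨ R.+-congʳ (R.trans (R.sym (R.+-homo (+ 1) b)) (R.trans (R.int-cong w≡) (R.*-homo w (+ 2)))) ⟩
      int w * int (+ 2) + int (+ 2) * int (+ 2) * int A′ * x R.^ k
        ≈⟨ S.solve 4 (λ w p A X → w S.:* p S.:+ p S.:* p S.:* A S.:* X S.:= p S.:* (w S.:+ p S.:* (A S.:* X)))
            R.refl (int w) (int (+ 2)) (int A′) (x R.^ k) ⟩
      int (+ 2) * (int w + int (+ 2) * (int A′ * x R.^ k)) ∎

  -- Modulo p the trinomial is the square of r, and c p is its exact value at x^k = - c₀.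
  square-expansion : ∀ {p} k {A b c₀ c} → + p ∣ˢ A ℤ.- + 2 ℤ.* c₀ → + p ∣ˢ b ℤ.- c₀ ℤ.* c₀ →
    c₀ ℤ.* c₀ ℤ.- A ℤ.* c₀ ℤ.+ b ≡ c ℤ.* + p →
    Expansion P p (trinomial P x k A b) (binomial P x k c₀) 1 c
  square-expansion {p} k {A} {b} {c₀} {c} p∣A-2c₀ p∣b-c₀² c≡ = expansion p _ r 1 c 0#
      (≡.subst₂ P/p._≈_ (trinomial-quotient P idealp x k A b)
        (≡.trans (≡.cong (P/p._^ 2) (binomial-quotient P idealp x k c₀)) (^-quotient idealp r 2)) square)
      (subst (R._≈ int (+ p) * (int c + int (+ p) * 0#)) (trinomial-quotient P ideal x k A b) at-root)
    where
    idealp = principal-isIdeal (int (+ p))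
    module P/p = ℤ-Algebra A/⟨ int (+ p) ⟩
    module Sp = Solver A/⟨ int (+ p) ⟩
    module EP = Evaluations A/⟨ int (+ p) ⟩
    open ModBinomial k c₀
    module S = Solver A/⟨ r ⟩
    p≈0 : int (+ p) P/p.≈ 0#
    p≈0 = ∈⇒≈0 idealp (1# , *-identityˡ _)
    square : trinomial A/⟨ int (+ p) ⟩ x k A b P/p.≈ binomial A/⟨ int (+ p) ⟩ x k c₀ P/p.^ 2
    square = begin
      trinomial A/⟨ int (+ p) ⟩ x k A b                         ≈⟨ EP.trinomial-at k A b {x P/p.^ k} P/p.refl ⟩
      (x P/p.^ k) P/p.^ 2 + int A * x P/p.^ k + int b           ≈⟨ P/p.+-cong (P/p.+-congˡ (P/p.*-congʳ (P/p.trans (EP.∣-⇒int≈ p≈0 p∣A-2c₀) (P/p.*-homo (+ 2) c₀))))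
                                                                     (P/p.trans (EP.∣-⇒int≈ p≈0 p∣b-c₀²) (P/p.*-homo c₀ c₀)) ⟩
      (x P/p.^ k) P/p.^ 2 + int (+ 2) * int c₀ * x P/p.^ k + int c₀ * int c₀
        ≈⟨ Sp.solve 2 (λ y c → y Sp.:^ 2 Sp.:+ Sp.con (+ 2) Sp.:* c Sp.:* y Sp.:+ c Sp.:* c Sp.:= (y Sp.:+ c) Sp.:^ 2)
            P/p.refl (x P/p.^ k) (int c₀) ⟩
      (x P/p.^ k + int c₀) P/p.^ 2 ∎
      where open import Relation.Binary.Reasoning.Setoid P/p.setoid
    at-root : trinomial A/⟨ r ⟩ x k A b R.≈ int (+ p) * (int c + int (+ p) * 0#)
    at-root = begin
      trinomial A/⟨ r ⟩ x k A b                          ≈⟨ Evaluations.trinomial-at A/⟨ r ⟩ k A b x^K ⟩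
      (- int c₀) R.^ 2 + int A * - int c₀ + int b
        ≈⟨ S.solve 3 (λ A b c → (S.:- c) S.:^ 2 S.:+ A S.:* (S.:- c) S.:+ b S.:= c S.:* c S.:- A S.:* c S.:+ b)
            R.refl (int A) (int b) (int c₀) ⟩
      int c₀ * int c₀ - int A * int c₀ + int b
        ≈⟨ R.+-congʳ (R.+-cong (R.*-homo c₀ c₀) (R.trans (R.-‿homo (A ℤ.* c₀)) (R.-‿cong (R.*-homo A c₀)))) ⟨
      int (c₀ ℤ.* c₀) + int (ℤ.- (A ℤ.* c₀)) + int b
        ≈⟨ R.trans (R.+-homo _ b) (R.+-congʳ (R.+-homo (c₀ ℤ.* c₀) _)) ⟨
      int (c₀ ℤ.* c₀ ℤ.- A ℤ.* c₀ ℤ.+ b)                 ≈⟨ R.trans (R.int-cong c≡) (R.*-homo c (+ p)) ⟩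
      int c * int (+ p)
        ≈⟨ S.solve 3 (λ c p o → c S.:* p S.:= p S.:* (c S.:+ p S.:* o) S.:- p S.:* p S.:* o)
            R.refl (int c) (int (+ p)) 0# ⟩
      int (+ p) * (int c + int (+ p) * 0#) - int (+ p) * int (+ p) * 0# ≈⟨ R.+-congˡ (R.-‿cong (R.zeroʳ _)) ⟩
      int (+ p) * (int c + int (+ p) * 0#) - 0#          ≈⟨ R.trans (R.+-congˡ R-0) (R.+-identityʳ _) ⟩
      int (+ p) * (int c + int (+ p) * 0#) ∎
      where
      open import Relation.Binary.Reasoning.Setoid R.setoid
      open import Algebra.Properties.Group R.+-group using () renaming (ε⁻¹≈ε to R-0)

  eisenstein-expansion : ∀ {p} k {A b c} → + p ∣ˢ A → b ≡ c ℤ.* + p → 0 < k →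
    Expansion P p (trinomial P x k A b) x (2 ℕ.* k ℕ.∸ 1) c
  eisenstein-expansion {p} (suc k) {A} {b} {c} (divides A′ A≡) b≡ _ = record
    { E = int A′ * x ^ suc k + int c ; a = 0# ; b = x ^ (k ℕ.+ suc (k ℕ.+ 0)) + int A * x ^ k
    ; f-mod-p = begin
        x ^ (2 ℕ.* suc k) + int A * x ^ suc k + int b
          ≈⟨ +-cong (+-congˡ (*-congʳ (trans (int-cong A≡) (*-homo A′ (+ p))))) (trans (int-cong b≡) (*-homo c (+ p))) ⟩
        x ^ (2 ℕ.* suc k) + int A′ * int (+ p) * x ^ suc k + int c * int (+ p)
          ≈⟨ S.solve 5 (λ X A p Y c → X S.:+ A S.:* p S.:* Y S.:+ c S.:* p S.:= X S.:+ p S.:* (A S.:* Y S.:+ c))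
              refl (x ^ (2 ℕ.* suc k)) (int A′) (int (+ p)) (x ^ suc k) (int c) ⟩
        x ^ (2 ℕ.* suc k) + int (+ p) * (int A′ * x ^ suc k + int c) ∎
    ; f-mod-r = begin
        x ^ (2 ℕ.* suc k) + int A * x ^ suc k + int b
          ≈⟨ +-congˡ (trans (int-cong b≡) (*-homo c (+ p))) ⟩
        x * x ^ (k ℕ.+ suc (k ℕ.+ 0)) + int A * (x * x ^ k) + int c * int (+ p)
          ≈⟨ S.solve 7 (λ x X A Y c p o → x S.:* X S.:+ A S.:* (x S.:* Y) S.:+ c S.:* p S.:= p S.:* (c S.:+ p S.:* o) S.:+ x S.:* (X S.:+ A S.:* Y) S.:- p S.:* p S.:* o)
               refl x (x ^ (k ℕ.+ suc (k ℕ.+ 0))) (int A) (x ^ k) (int c) (int (+ p)) 0# ⟩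
        int (+ p) * (int c + int (+ p) * 0#) + x * (x ^ (k ℕ.+ suc (k ℕ.+ 0)) + int A * x ^ k) - int (+ p) * int (+ p) * 0#
          ≈⟨ trans (+-congˡ (trans (-‿cong (zeroʳ _)) ε⁻¹≈ε)) (+-identityʳ _) ⟩
        int (+ p) * (int c + int (+ p) * 0#) + x * (x ^ (k ℕ.+ suc (k ℕ.+ 0)) + int A * x ^ k) ∎ }
    where
    module S = Solver P
    open import Relation.Binary.Reasoning.Setoid setoid
    open import Algebra.Properties.Group +-group using (ε⁻¹≈ε)

  -- With r = f the cofactor would be 0. The shift by p leaves r equal to f modulo p and makes the
  -- cofactor 1.
  trivial-expansion : ∀ p f → Expansion P p f (f - int (+ p)) 0 (+ 1)
  trivial-expansion p f = record
    { E = int (+ 1) ; a = int (+ 0) ; b = int (+ 1)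
    ; f-mod-p = trans (S.solve 2 (λ f p → f S.:= (f S.:- p) S.:+ p S.:* S.con (+ 1))
        refl f (int (+ p))) (+-congʳ (sym (*-identityʳ _)))
    ; f-mod-r = S.solve 2 (λ f p → f S.:= p S.:* (S.con (+ 1) S.:+ p S.:* S.con (+ 0)) S.:+ (f S.:- p) S.:* S.con (+ 1))
        refl f (int (+ p)) }
    where module S = Solver P

-- Maximality of the trinomial order at every prime

-- p-maximality expressed without the maximal order: if h / (p M) is a root of a monic g, then p
-- divides h in ℤ[θ].
MaximalAt : (P : ℤ-Algebra) → ℤ-Algebra.Carrier P → ℕ → Set
MaximalAt P f p = ∀ n g → coeff g n ≡ + 1 → ∀ h M → BinaryForm.form A/⟨ f ⟩ n g h (int (+ p) * M) A.≈ 0# →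
                  ∃ λ h′ → h A.≈ int (+ p) * h′
  where
  open ℤ-Algebra P
  open Quotient P
  module A = ℤ-Algebra A/⟨ f ⟩

maximal-from-expansion : ∀ P x → GeneratedBy P x → ∀ {p} → Prime p → ∀ {f r e c} →
  Reduction P f → Reduction P r → Expansion P p f r e c → ¬ (+ p ∣ˢ c) → FrobeniusFixed P p r x → MaximalAt P f p
maximal-from-expansion P x gen {p} pr {f} {r} {e} {c} red-f red-r ex p∤c fixed with inverse-mod pr c p∤c
... | u , v , uc≡ = PMaximal.p-maximal P x gen p pr f r E a b e c u v red-f red-r f-mod-p f-mod-r uc≡ fixed
  where open Expansion ex

module Fixed (P : ℤ-Algebra) (x : ℤ-Algebra.Carrier P) {p : ℕ} (pr : Prime p) where
  open ℤ-Algebra P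
  open Quotient P

  fixed-binomial : ∀ K c → p ∤ K → 0 < K → ¬ (+ p ∣ˢ c) → FrobeniusFixed P p (binomial P x K c) x
  fixed-binomial K c p∤K 0<K p∤c = Evaluations.binomial-fixed residueRing pr p≈0 x K c p∤K 0<K p∤c
    (subst (B._≈ 0#) (≡.sym (binomial-quotient P residue-isIdeal x K c)) r≈0)
    where
    open ResidueRing P p (binomial P x K c)
    module B = ℤ-Algebra residueRing

  fixed-x : FrobeniusFixed P p x x
  fixed-x = 1 , s≤s z≤n , B.trans (Powers.^-≤-zero residueRing {x} {1} {p ℕ.^ 1} (ℕₚ.m^n>0 p {{prime⇒nonZero pr}} 1) (B.trans (B.*-identityʳ x) r≈0)) (B.sym r≈0)
    where
    open ResidueRing P p x
    module B = ℤ-Algebra residueRing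

  fixed-trinomial : ∀ k A b → p ∤ k → 0 < k → ¬ (+ p ∣ˢ b) → ¬ (+ p ∣ˢ A ℤ.* A ℤ.- + 4 ℤ.* b) →
    FrobeniusFixed P p (trinomial P x k A b - int (+ p)) x
  fixed-trinomial k A b p∤k 0<k p∤b p∤Δ = Evaluations.separable-fixed residueRing pr p≈0 x k A b p∤k 0<k p∤b p∤Δ
    (subst (B._≈ 0#) (≡.sym (trinomial-quotient P residue-isIdeal x k A b)) (B.trans (B.trans (≈⇒≈/ residue-isIdeal split) (B.+-cong r≈0 p≈0)) (B.+-identityˡ 0#)))
    where
    open ResidueRing P p (trinomial P x k A b - int (+ p))
    module B = ℤ-Algebra residueRing
    module S = Solver P
    split : trinomial P x k A b ≈ (trinomial P x k A b - int (+ p)) + int (+ p)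
    split = S.solve 2 (λ f p → f S.:= (f S.:- p) S.:+ p) refl _ (int (+ p))

strip-4 : ∀ {p} → Prime p → 2 ∤ p → ∀ z → + p ∣ˢ + 4 ℤ.* z → + p ∣ˢ z
strip-4 {p} pr 2∤p z p∣ = [ (λ p∣4 → contradiction p∣4 p∤4) , (λ p∣z → p∣z) ]′ (euclidℤ pr (+ 4) z p∣)
  where
  p∤2 : p ∤ 2
  p∤2 p∣2 = 2∤p (subst (_∣ p) (ℕₚ.≤-antisym (ℕ∣.∣⇒≤ p∣2) (prime≥2 pr)) ℕ∣.∣-refl)
  p∤4 : ¬ (+ p ∣ˢ + 4)
  p∤4 p∣4 = prime∤product pr 2 2 p∤2 p∤2 (∣⇒∣ᵤ p∣4)

-- For c₀ with 2 c₀ = A (1 + p²) the trinomial y² + A y + b takes the value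
-- (b D + A² p⁴) / 4 at - c₀.
module SquareIdentities (A b D′ p c₀ : ℤ) (2c₀ : + 2 ℤ.* c₀ ≡ A ℤ.* (+ 1 ℤ.+ p ℤ.* p))
  (4b : + 4 ℤ.* b ≡ b ℤ.* (D′ ℤ.* p) ℤ.+ A ℤ.* A) where
  open +-*-Solver
  open ≡.≡-Reasoning

  opaque
    linear : A ℤ.- + 2 ℤ.* c₀ ≡ (ℤ.- (A ℤ.* p)) ℤ.* p
    linear = ≡.trans (≡.cong (ℤ._-_ A) 2c₀)
      (solve 2 (λ A p → A :- A :* (con (+ 1) :+ p :* p) := (:- (A :* p)) :* p) ≡.refl A p)

    constant : + 4 ℤ.* (b ℤ.- c₀ ℤ.* c₀) ≡ (b ℤ.* D′ ℤ.- A ℤ.* A ℤ.* (+ 2 ℤ.* p ℤ.+ p ℤ.* p ℤ.* p)) ℤ.* p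
    constant = begin
      + 4 ℤ.* (b ℤ.- c₀ ℤ.* c₀)
        ≡⟨ solve 2 (λ b c → con (+ 4) :* (b :- c :* c) := con (+ 4) :* b :- (con (+ 2) :* c) :* (con (+ 2) :* c))
            ≡.refl b c₀ ⟩
      + 4 ℤ.* b ℤ.- (+ 2 ℤ.* c₀) ℤ.* (+ 2 ℤ.* c₀)                ≡⟨ ≡.cong₂ (λ u v → u ℤ.- v ℤ.* v) 4b 2c₀ ⟩
      b ℤ.* (D′ ℤ.* p) ℤ.+ A ℤ.* A ℤ.- A ℤ.* (+ 1 ℤ.+ p ℤ.* p) ℤ.* (A ℤ.* (+ 1 ℤ.+ p ℤ.* p))
        ≡⟨ solve 4 (λ b D p A → b :* (D :* p) :+ A :* A :- A :* (con (+ 1) :+ p :* p) :* (A :* (con (+ 1) :+ p :* p))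
             := (b :* D :- A :* A :* (con (+ 2) :* p :+ p :* p :* p)) :* p) ≡.refl b D′ p A ⟩
      (b ℤ.* D′ ℤ.- A ℤ.* A ℤ.* (+ 2 ℤ.* p ℤ.+ p ℤ.* p ℤ.* p)) ℤ.* p ∎

    value : + 4 ℤ.* (c₀ ℤ.* c₀ ℤ.- A ℤ.* c₀ ℤ.+ b) ≡ (b ℤ.* D′ ℤ.+ A ℤ.* A ℤ.* (p ℤ.* p ℤ.* p)) ℤ.* p
    value = begin
      + 4 ℤ.* (c₀ ℤ.* c₀ ℤ.- A ℤ.* c₀ ℤ.+ b)
        ≡⟨ solve 3 (λ c A b → con (+ 4) :* (c :* c :- A :* c :+ b) := (con (+ 2) :* c :- A) :* (con (+ 2) :* c :- A) :+ (con (+ 4) :* b :- A :* A))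
            ≡.refl c₀ A b ⟩
      (+ 2 ℤ.* c₀ ℤ.- A) ℤ.* (+ 2 ℤ.* c₀ ℤ.- A) ℤ.+ (+ 4 ℤ.* b ℤ.- A ℤ.* A)
        ≡⟨ ≡.cong₂ (λ u v → (u ℤ.- A) ℤ.* (u ℤ.- A) ℤ.+ (v ℤ.- A ℤ.* A)) 2c₀ 4b ⟩
      (A ℤ.* (+ 1 ℤ.+ p ℤ.* p) ℤ.- A) ℤ.* (A ℤ.* (+ 1 ℤ.+ p ℤ.* p) ℤ.- A) ℤ.+ ((b ℤ.* (D′ ℤ.* p) ℤ.+ A ℤ.* A) ℤ.- A ℤ.* A)
        ≡⟨ solve 4 (λ b D p A → (A :* (con (+ 1) :+ p :* p) :- A) :* (A :* (con (+ 1) :+ p :* p) :- A) :+ ((b :* (D :* p) :+ A :* A) :- A :* A)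
             := (b :* D :+ A :* A :* (p :* p :* p)) :* p) ≡.refl b D′ p A ⟩
      (b ℤ.* D′ ℤ.+ A ℤ.* A ℤ.* (p ℤ.* p ℤ.* p)) ℤ.* p ∎

record Square (A b : ℤ) (p : ℕ) : Set where
  field
    c₀ c     : ℤ
    A-2c₀    : + p ∣ˢ A ℤ.- + 2 ℤ.* c₀
    b-c₀²    : + p ∣ˢ b ℤ.- c₀ ℤ.* c₀
    value    : c₀ ℤ.* c₀ ℤ.- A ℤ.* c₀ ℤ.+ b ≡ c ℤ.* + p
    p∤c      : ¬ (+ p ∣ˢ c)
    p∤c₀     : ¬ (+ p ∣ˢ c₀)

opaque
  -- 1 + p² is even and is 1 modulo p², so its half is an integer that inverts 2 modulo p². For p =
  -- 2 L + 1 it is 2 L² + 2 L + 1.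
  half-of-1+p² : ∀ {p} → 2 ∤ p → ∃ λ h → + 2 ℤ.* h ≡ + 1 ℤ.+ + p ℤ.* + p
  half-of-1+p² {p} 2∤p with odd⇒1+2l p 2∤p
  ... | l , ≡.refl = h (+ l) , ≡.trans (identity (+ l)) (≡.cong (λ z → + 1 ℤ.+ z ℤ.* z) (≡.sym (≡.cong (ℤ._+_ (+ 1)) (ℤₚ.pos-* 2 l))))
    where
    h : ℤ → ℤ
    h L = + 2 ℤ.* L ℤ.* L ℤ.+ + 2 ℤ.* L ℤ.+ + 1
    identity : ∀ L → + 2 ℤ.* h L ≡ + 1 ℤ.+ (+ 1 ℤ.+ + 2 ℤ.* L) ℤ.* (+ 1 ℤ.+ + 2 ℤ.* L)
    identity = solve 1 (λ L → con (+ 2) :* (con (+ 2) :* L :* L :+ con (+ 2) :* L :+ con (+ 1))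
            := con (+ 1) :+ (con (+ 1) :+ con (+ 2) :* L) :* (con (+ 1) :+ con (+ 2) :* L)) ≡.refl
      where open +-*-Solver

  -- With D = D′ p the identity 4 c = b D′ + A² p³ holds, so p dividing c would put p² into D. And b
  -- ≡ c₀² modulo p keeps c₀ prime to p.
  square-data : ∀ {p} → Prime p → 2 ∤ p → ∀ A b D → + 4 ℤ.* b ≡ b ℤ.* D ℤ.+ A ℤ.* A →
    ¬ (+ p ∣ˢ b) → + p ∣ˢ D → ¬ (+ p ℤ.* + p ∣ˢ D) → Square A b p
  square-data {p} pr 2∤p A b D 4b p∤b (divides D′ D≡) p²∤D = record
    { c₀ = c₀ ; c = c ; A-2c₀ = divides (ℤ.- (A ℤ.* + p)) I.linear ; b-c₀² = p∣b-c₀² ; value = Signed._∣_.equality p∣value ; p∤c = p∤c ; p∤c₀ = p∤c₀ }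
    where
    h : ∃ λ h → + 2 ℤ.* h ≡ + 1 ℤ.+ + p ℤ.* + p
    h = half-of-1+p² 2∤p
    c₀ : ℤ
    c₀ = A ℤ.* proj₁ h
    2c₀ : + 2 ℤ.* c₀ ≡ A ℤ.* (+ 1 ℤ.+ + p ℤ.* + p)
    2c₀ = ≡.trans (2*[A*h]≡A*[2*h] A (proj₁ h)) (≡.cong (A ℤ.*_) (proj₂ h))
      where
      2*[A*h]≡A*[2*h] : ∀ A h → + 2 ℤ.* (A ℤ.* h) ≡ A ℤ.* (+ 2 ℤ.* h)
      2*[A*h]≡A*[2*h] = solve 2 (λ A h → con (+ 2) :* (A :* h) := A :* (con (+ 2) :* h)) ≡.refl
        where open +-*-Solver
    module I = SquareIdentities A b D′ (+ p) c₀ 2c₀ (≡.trans 4b (≡.cong (λ z → b ℤ.* z ℤ.+ A ℤ.* A) D≡))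
    p∣b-c₀² : + p ∣ˢ b ℤ.- c₀ ℤ.* c₀
    p∣b-c₀² = strip-4 pr 2∤p (b ℤ.- c₀ ℤ.* c₀) (divides (b ℤ.* D′ ℤ.- A ℤ.* A ℤ.* (+ 2 ℤ.* + p ℤ.+ + p ℤ.* + p ℤ.* + p)) I.constant)
    p∣value : + p ∣ˢ c₀ ℤ.* c₀ ℤ.- A ℤ.* c₀ ℤ.+ b
    p∣value = strip-4 pr 2∤p (c₀ ℤ.* c₀ ℤ.- A ℤ.* c₀ ℤ.+ b) (divides (b ℤ.* D′ ℤ.+ A ℤ.* A ℤ.* (+ p ℤ.* + p ℤ.* + p)) I.value)
    c w : ℤ
    c = Signed.quotient p∣value
    w = b ℤ.* D′ ℤ.+ A ℤ.* A ℤ.* (+ p ℤ.* + p ℤ.* + p)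
    4c≡w : + 4 ℤ.* c ≡ w
    4c≡w = ℤₚ.*-cancelʳ-≡ (+ 4 ℤ.* c) w (+ p) {{prime⇒nonZero pr}}
      (≡.trans (ℤₚ.*-assoc (+ 4) c (+ p)) (≡.trans (≡.cong (+ 4 ℤ.*_) (≡.sym (Signed._∣_.equality p∣value))) I.value))
    square∣D : + p ∣ˢ D′ → + p ℤ.* + p ∣ˢ D
    square∣D (divides D″ e) = divides D″ (≡.trans D≡ (≡.trans (≡.cong (ℤ._* + p) e) (ℤₚ.*-assoc D″ (+ p) (+ p))))
    p∤c : ¬ (+ p ∣ˢ c)
    p∤c p∣c = [ p∤b , (λ p∣D′ → p²∤D (square∣D p∣D′)) ]′ (euclidℤ pr b D′
      (Signed.∣m+n∣n⇒∣m (subst (+ p ∣ˢ_) 4c≡w (Signed.∣n⇒∣m*n (+ 4) p∣c))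
        (Signed.∣n⇒∣m*n (A ℤ.* A) (Signed.∣n⇒∣m*n (+ p ℤ.* + p) Signed.∣-refl))))
    p∤c₀ : ¬ (+ p ∣ˢ c₀)
    p∤c₀ p∣c₀ = p∤b (Signed.∣m+n∣n⇒∣m p∣b-c₀² (Signed.∣m⇒∣-m (Signed.∣m⇒∣m*n c₀ p∣c₀)))

-- The discriminant of y² + A y + b is A² - 4b = - b D.
record Hypotheses (m : ℤ) (b k : ℕ) : Set where
  field
    0<k                 : 0 < k
    b-squarefree        : ∀ {p} → Prime p → ¬ (+ p ℤ.* + p ∣ˢ + b)
    b-coprime-m         : ∀ {p} → Prime p → + p ∣ˢ + b → ¬ (+ p ∣ˢ m)
    k-radical           : ∀ {p} → Prime p → p ∣ k → + p ∣ˢ m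
    D-squarefree        : ∀ {p} → Prime p → ¬ (+ p ∣ˢ + b) → ¬ (+ p ∣ˢ m) → ¬ (+ p ℤ.* + p ∣ˢ + 4 ℤ.- + b ℤ.* m ℤ.^ 4)

  D A : ℤ
  D = + 4 ℤ.- + b ℤ.* m ℤ.^ 4
  A = + b ℤ.* m ℤ.^ 2

module Arithmetic {m b k} (H : Hypotheses m b k) where
  open Hypotheses H
  open +-*-Solver

  private
    square-identity : ∀ b q p → b ℤ.* (q ℤ.* p) ℤ.^ 2 ≡ p ℤ.* p ℤ.* (b ℤ.* (q ℤ.* q))
    square-identity = solve 3 (λ b q p → b :* ((q :* p) :* ((q :* p) :* con (+ 1))) := p :* p :* (b :* (q :* q))) ≡.refl

    discriminant-identity : ∀ b m → + 4 ℤ.* b ≡ b ℤ.* (+ 4 ℤ.- b ℤ.* m ℤ.^ 4) ℤ.+ (b ℤ.* m ℤ.^ 2) ℤ.* (b ℤ.* m ℤ.^ 2)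
    discriminant-identity = solve 2 (λ b m → con (+ 4) :* b :=
      b :* (con (+ 4) :- b :* (m :* (m :* (m :* (m :* con (+ 1)))))) :+ (b :* (m :* (m :* con (+ 1)))) :* (b :* (m :* (m :* con (+ 1))))) ≡.refl

    negated-discriminant : ∀ A b D → + 4 ℤ.* b ≡ b ℤ.* D ℤ.+ A ℤ.* A → ℤ.- (A ℤ.* A ℤ.- + 4 ℤ.* b) ≡ b ℤ.* D
    negated-discriminant A b D e = ≡.trans (≡.cong (λ z → ℤ.- (A ℤ.* A ℤ.- z)) e)
      (solve 2 (λ u v → :- (u :- (v :+ u)) := v) ≡.refl (A ℤ.* A) (b ℤ.* D))

  opaque
    square∣A : ∀ p → + p ∣ˢ m → ∃ λ A′ → A ≡ + p ℤ.* + p ℤ.* A′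
    square∣A p (divides q m≡) = + b ℤ.* (q ℤ.* q) , ≡.trans (≡.cong (λ z → + b ℤ.* z ℤ.^ 2) m≡) (square-identity (+ b) q (+ p))

    4b : + 4 ℤ.* + b ≡ + b ℤ.* D ℤ.+ A ℤ.* A
    4b = discriminant-identity (+ b) m

  p∤D⇒p∤Δ : ∀ {p} → Prime p → ¬ (+ p ∣ˢ + b) → ¬ (+ p ∣ˢ D) → ¬ (+ p ∣ˢ A ℤ.* A ℤ.- + 4 ℤ.* + b)
  p∤D⇒p∤Δ {p} pr p∤b p∤D p∣Δ = [ p∤b , p∤D ]′ (euclidℤ pr (+ b) D (subst (+ p ∣ˢ_) (negated-discriminant A (+ b) D 4b) (Signed.∣m⇒∣-m p∣Δ)))

module _ (P : ℤ-Algebra) (x : ℤ-Algebra.Carrier P) (gen : GeneratedBy P x) {m : ℤ} {b k : ℕ} (H : Hypotheses m b k) where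
  open ℤ-Algebra P
  open Hypotheses H
  open Arithmetic H

  module AllPrimes (reduction-binomial  : ∀ n → 0 < n → ∀ c → Reduction P (binomial P x n c))
    (reduction-x         : Reduction P x)
    (reduction-trinomial : Reduction P (trinomial P x k A (+ b)))
    (reduction-shifted   : ∀ p → Reduction P (trinomial P x k A (+ b) - int (+ p)))
    (no-Wieferich        : ∀ p → Prime p → 2 ∤ p → p ∣ k → ¬ Wieferich b p)
    (b≡1-mod-4           : + 2 ∣ˢ m → + 4 ∣ˢ + b ℤ.- + 1) where

    open BinomialExpansions P x
    open Expand P

    private
      f : Carrier
      f = trinomial P x k A (+ b)

      p∤b-if-p∣m : ∀ {p} → Prime p → + p ∣ˢ m → ¬ (+ p ∣ˢ + b)
      p∤b-if-p∣m pr p∣m p∣b = b-coprime-m pr p∣b p∣m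

      at-divisor-of-b : ∀ {p} → Prime p → + p ∣ˢ + b → MaximalAt P f p
      at-divisor-of-b {p} pr p∣b@(divides c b≡) = maximal-from-expansion P x gen pr reduction-trinomial reduction-x
        (eisenstein-expansion {p} k {A} {+ b} {c} (Signed.∣m⇒∣m*n (m ℤ.^ 2) p∣b) b≡ 0<k)
        (λ { (divides c′ c≡) → b-squarefree pr (divides c′ (≡.trans b≡ (≡.trans (≡.cong (ℤ._* + p) c≡) (ℤₚ.*-assoc c′ (+ p) (+ p))))) })
        (Fixed.fixed-x P x pr)

      positive : ∀ {k′} q → k ≡ q ℕ.* k′ → 0 < k′
      positive {zero}  q k≡ = contradiction (subst (0 <_) (≡.trans k≡ (ℕₚ.*-zeroʳ q)) 0<k) λ ()
      positive {suc _} q k≡ = s≤s z≤n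

      at-2 : + 2 ∣ˢ m → MaximalAt P f 2
      at-2 2∣m with prime-to-part prime[2] k 0<k | square∣A 2 2∣m | b≡1-mod-4 2∣m
      ... | j , k′ , k≡ , 2∤k′ | A′ , A≡ | divides q b-1≡ = subst (λ k → MaximalAt P (trinomial P x k A (+ b)) 2) (≡.sym k≡′)
          (maximal-from-expansion P x gen prime[2] (subst (λ k → Reduction P (trinomial P x k A (+ b))) k≡′ reduction-trinomial)
            (reduction-binomial k′ (positive (2 ℕ.^ j) k≡) (+ 1)) (even-expansion k′ j A≡ 1+b≡) 2∤w
            (Fixed.fixed-binomial P x prime[2] k′ (+ 1) 2∤k′ (positive (2 ℕ.^ j) k≡) (prime∤1ℤ prime[2])))
        where
        k≡′ : k ≡ k′ ℕ.* 2 ℕ.^ j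
        k≡′ = ≡.trans k≡ (ℕₚ.*-comm (2 ℕ.^ j) k′)
        -- b = 1 + 4 q, so (1 + b) / 2 = 1 + 2 q is odd.
        w : ℤ
        w = + 1 ℤ.+ q ℤ.* + 2
        1+b≡ : + 1 ℤ.+ + b ≡ w ℤ.* + 2
        1+b≡ = ≡.trans (solve 1 (λ b → con (+ 1) :+ b := (b :- con (+ 1)) :+ con (+ 2))
            ≡.refl (+ b)) (≡.trans (≡.cong (ℤ._+ + 2) b-1≡)
          (solve 1 (λ q → q :* con (+ 4) :+ con (+ 2) := (con (+ 1) :+ q :* con (+ 2)) :* con (+ 2)) ≡.refl q))
          where open +-*-Solver
        2∤w : ¬ (+ 2 ∣ˢ w)
        2∤w 2∣w = prime∤1ℤ prime[2] (Signed.∣m+n∣n⇒∣m 2∣w (Signed.∣n⇒∣m*n q Signed.∣-refl))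

      at-odd-divisor-of-k : ∀ {p} → Prime p → 2 ∤ p → p ∣ k → MaximalAt P f p
      at-odd-divisor-of-k {p} pr 2∤p p∣k with prime-to-part pr k 0<k | square∣A p (k-radical pr p∣k)
      ... | zero , k′ , k≡ , p∤k′ | _ = contradiction (subst (p ∣_) (≡.trans k≡ (ℕₚ.*-identityˡ k′)) p∣k) p∤k′
      ... | suc j , k′ , k≡ , p∤k′ | A′ , A≡ with fermat-ℤ pr (suc j) (+ b)
      ...   | divides w w≡ = subst (λ k → MaximalAt P (trinomial P x k A (+ b)) p) (≡.sym k≡′)
          (maximal-from-expansion P x gen pr (subst (λ k → Reduction P (trinomial P x k A (+ b))) k≡′ reduction-trinomial)
            (reduction-binomial (2 ℕ.* k′) 0<2k′ (+ b)) (odd-expansion pr 2∤p k′ (suc j) A≡ w≡) p∤w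
            (Fixed.fixed-binomial P x pr (2 ℕ.* k′) (+ b) (prime∤product pr 2 k′ p∤2 p∤k′) 0<2k′ p∤b))
        where
        p∤b = p∤b-if-p∣m pr (k-radical pr p∣k)
        0<2k′ : 0 < 2 ℕ.* k′
        0<2k′ = ℕₚ.*-mono-< {0} {2} {0} {k′} (s≤s z≤n) (positive (p ℕ.^ suc j) k≡)
        k≡′ : k ≡ k′ ℕ.* p ℕ.^ suc j
        k≡′ = ≡.trans k≡ (ℕₚ.*-comm (p ℕ.^ suc j) k′)
        p∤2 : p ∤ 2
        p∤2 p∣2 = 2∤p (subst (_∣ p) (ℕₚ.≤-antisym (ℕ∣.∣⇒≤ p∣2) (prime≥2 pr)) ℕ∣.∣-refl)
        -- A further factor p in w = (b^(p^(j+1)) - b) / p would make p a Wieferich prime.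
        p∤w : ¬ (+ p ∣ˢ ℤ.- w)
        p∤w p∣-w = no-Wieferich p pr 2∤p p∣k (⇒Wieferich pr p∤b j (square (subst (+ p ∣ˢ_) (ℤₚ.neg-involutive w) (Signed.∣m⇒∣-m p∣-w))))
          where
          square : + p ∣ˢ w → + p ℤ.* + p ∣ˢ (+ b) ℤ.^ (p ℕ.^ suc j) ℤ.- + b
          square (divides w′ e) = divides w′ (≡.trans w≡ (≡.trans (≡.cong (ℤ._* + p) e) (ℤₚ.*-assoc w′ (+ p) (+ p))))

      at-separable : ∀ {p} → Prime p → ¬ (+ p ∣ˢ + b) → p ∤ k → ¬ (+ p ∣ˢ D) → MaximalAt P f p
      at-separable {p} pr p∤b p∤k p∤D = maximal-from-expansion P x gen pr reduction-trinomial (reduction-shifted p)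
        (trivial-expansion p f) (prime∤1ℤ pr) (Fixed.fixed-trinomial P x pr k A (+ b) p∤k 0<k p∤b (p∤D⇒p∤Δ pr p∤b p∤D))

      at-discriminant : ∀ {p} → Prime p → 2 ∤ p → ¬ (+ p ∣ˢ + b) → p ∤ k → ¬ (+ p ∣ˢ m) → + p ∣ˢ D → MaximalAt P f p
      at-discriminant {p} pr 2∤p p∤b p∤k p∤m p∣D = maximal-from-expansion P x gen pr reduction-trinomial (reduction-binomial k 0<k c₀)
        (square-expansion k A-2c₀ b-c₀² value) p∤c (Fixed.fixed-binomial P x pr k c₀ p∤k 0<k p∤c₀)
        where open Square (square-data pr 2∤p A (+ b) D 4b p∤b p∣D (D-squarefree pr p∤b p∤m))

      even-prime : ∀ {p} → Prime p → 2 ∣ p → 2 ≡ p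
      even-prime pr 2∣p with prime⇒irreducible pr 2∣p
      ... | inj₂ e = e

      -- p divides 4 = D + b m⁴.
      D-divisor : ∀ {p} → Prime p → + p ∣ˢ D → + p ∣ˢ + b ℤ.* m ℤ.^ 4 → 2 ∣ p
      D-divisor {p} pr p∣D p∣bm⁴ = subst (2 ∣_) 2≡p ℕ∣.∣-refl
        where
        p∣4 : p ∣ 2 ℕ.* 2
        p∣4 = ∣⇒∣ᵤ (Signed.∣m+n∣n⇒∣m {+ p} {+ 4} {ℤ.- (+ b ℤ.* m ℤ.^ 4)} p∣D (Signed.∣m⇒∣-m p∣bm⁴))
        2≡p : 2 ≡ p
        2≡p = ℕₚ.≤-antisym (prime≥2 pr) (ℕ∣.∣⇒≤ ([ (λ d → d) , (λ d → d) ]′ (euclidsLemma 2 2 pr p∣4)))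

    maximal-at : ∀ {p} → Prime p → MaximalAt P f p
    maximal-at {p} pr = by-cases (+ p ∣ˢ? + b) (2 ∣? p) (+ p ∣ˢ? m) (p ∣? k) (+ p ∣ˢ? D)
      where
      open +-*-Solver
      -- With b and m odd, D = 4 - b m⁴ is odd.
      2-separable : 2 ∣ p → ¬ (+ p ∣ˢ + b) → ¬ (+ p ∣ˢ m) → ¬ (+ p ∣ˢ D)
      2-separable 2∣p p∤b p∤m p∣D = [ p∤b , (λ d → p∤m (prime∣power⇒∣ℤ pr m 4 d)) ]′ (euclidℤ pr (+ b) (m ℤ.^ 4)
        (subst (+ p ∣ˢ_) (solve 1 (λ z → con (+ 4) :- (con (+ 4) :- z) := z) ≡.refl (+ b ℤ.* m ℤ.^ 4))
          (Signed.∣m∣n⇒∣m-n {+ p} {+ 4} (subst (λ q → + q ∣ˢ + 4) (even-prime pr 2∣p) (divides (+ 2) ≡.refl)) p∣D)))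
      by-cases : Dec (+ p ∣ˢ + b) → Dec (2 ∣ p) → Dec (+ p ∣ˢ m) → Dec (p ∣ k) → Dec (+ p ∣ˢ D) → MaximalAt P f p
      by-cases (yes p∣b) _         _         _         _         = at-divisor-of-b pr p∣b
      by-cases (no p∤b)  (yes 2∣p) (yes p∣m) _         _         =
        subst (MaximalAt P f) (even-prime pr 2∣p) (at-2 (subst (λ p → + p ∣ˢ m) (≡.sym (even-prime pr 2∣p)) p∣m))
      by-cases (no p∤b)  (yes 2∣p) (no p∤m)  _         _         =
        at-separable pr p∤b (λ p∣k → p∤m (k-radical pr p∣k)) (2-separable 2∣p p∤b p∤m)
      by-cases (no p∤b)  (no 2∤p)  _         (yes p∣k) _         = at-odd-divisor-of-k pr 2∤p p∣k
      -- Here D is 4 modulo the odd prime p, so f stays separable modulo p although p divides m.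
      by-cases (no p∤b)  (no 2∤p)  (yes p∣m) (no p∤k)  _         =
        at-separable pr p∤b p∤k λ p∣D → 2∤p (D-divisor pr p∣D (Signed.∣n⇒∣m*n (+ b) (Signed.∣m⇒∣m*n (m ℤ.^ 3) p∣m)))
      by-cases (no p∤b)  (no 2∤p)  (no p∤m)  (no p∤k)  (yes p∣D) = at-discriminant pr 2∤p p∤b p∤k p∤m p∣D
      by-cases (no p∤b)  (no 2∤p)  (no p∤m)  (no p∤k)  (no p∤D)  = at-separable pr p∤b p∤k p∤D

-- Integral elements

module Evaluation (A : ℤ-Algebra) where
  open ℤ-Algebra A
  open BinaryForm A
  open Powers A
  open import Relation.Binary.Reasoning.Setoid setoid

  evaluate : List ℤ → Carrier → Carrier
  evaluate []      α = 0#
  evaluate (a ∷ g) α = int a + α * evaluate g α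

  evaluate-zero : ∀ g α → (∀ i → coeff g i ≡ + 0) → evaluate g α ≈ 0#
  evaluate-zero []      α g≡0 = refl
  evaluate-zero (a ∷ g) α g≡0 = trans (+-cong (trans (int-cong (g≡0 0)) 0#-homo)
    (trans (*-congˡ (evaluate-zero g α (λ i → g≡0 (suc i)))) (zeroʳ α))) (+-identityˡ 0#)

  form≈evaluate : ∀ n g α → (∀ i → n < i → coeff g i ≡ + 0) → form n g α 1# ≈ evaluate g α
  form≈evaluate n       []      α _ = refl
  form≈evaluate zero    (a ∷ g) α b = sym (trans (+-congˡ (trans (*-congˡ (evaluate-zero g α (λ i → b (suc i) (s≤s z≤n)))) (zeroʳ α))) (+-identityʳ _))
  form≈evaluate (suc n) (a ∷ g) α b = +-cong (trans (*-congˡ (1^n≈1 (suc n))) (*-identityʳ _))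
    (*-congˡ (form≈evaluate n g α (λ i lt → b (suc i) (s≤s lt))))

form-quotient : ∀ (P : ℤ-Algebra) {I} (ideal : Quotient.IsIdeal P I) n g X Y →
  BinaryForm.form (Quotient.quotient P ideal) n g X Y ≡ BinaryForm.form P n g X Y
form-quotient P ideal n       []      X Y = ≡.refl
form-quotient P ideal zero    (a ∷ g) X Y = ≡.refl
form-quotient P ideal (suc n) (a ∷ g) X Y = ≡.cong₂ (λ u v → int a * u + X * v)
  (Quotient.^-quotient P ideal Y (suc n)) (form-quotient P ideal n g X Y)
  where open ℤ-Algebra P

prime-factor-of : ∀ n → 2 ≤ n → ∃₂ λ p n′ → Prime p × n ≡ p ℕ.* n′
prime-factor-of n 2≤n = go (factors F) (factorsPrime F) (isFactorisation F)
  where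
  open PrimeFactorisation
  F = factorise n {{ℕ.>-nonZero (ℕₚ.≤-trans (s≤s z≤n) 2≤n)}}
  go : ∀ ps → All Prime ps → n ≡ product ps → ∃₂ λ p n′ → Prime p × n ≡ p ℕ.* n′
  go []       _         eq with subst (2 ≤_) eq 2≤n
  ... | s≤s ()
  go (p ∷ ps) (pr ∷ _) eq = p , product ps , pr , eq

-- Clearing the denominator of an integral element

record Homomorphism (P Q : ℤ-Algebra) : Set where
  private
    module P = ℤ-Algebra P
    module Q = ℤ-Algebra Q
  field
    ι      : P.Carrier → Q.Carrier
    ι-cong : ∀ {x y} → x P.≈ y → ι x Q.≈ ι y
    ι-+    : ∀ x y → ι (x P.+ y) Q.≈ ι x Q.+ ι y
    ι-*    : ∀ x y → ι (x P.* y) Q.≈ ι x Q.* ι y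
    ι-int  : ∀ a → ι (P.int a) Q.≈ Q.int a

  ι-0 : ι P.0# Q.≈ Q.0#
  ι-0 = Q.trans (ι-cong (P.sym P.0#-homo)) (Q.trans (ι-int (+ 0)) Q.0#-homo)

  ι-1 : ι P.1# Q.≈ Q.1#
  ι-1 = Q.trans (ι-cong (P.sym P.1#-homo)) (Q.trans (ι-int (+ 1)) Q.1#-homo)

  ι-^ : ∀ x n → ι (x P.^ n) Q.≈ ι x Q.^ n
  ι-^ x zero    = ι-1
  ι-^ x (suc n) = Q.trans (ι-* x (x P.^ n)) (Q.*-congˡ (ι-^ x n))

  ι-neg : ∀ x → ι (P.- x) Q.≈ Q.- ι x
  ι-neg x = Q.trans (ι-cong (SP.solve 1 (λ x → SP.:- x SP.:= SP.con (ℤ.- + 1) SP.:* x) P.refl x))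
    (Q.trans (ι-* _ x) (Q.trans (Q.*-congʳ (ι-int (ℤ.- + 1))) (SQ.solve 1 (λ x → SQ.con (ℤ.- + 1) SQ.:* x SQ.:= SQ.:- x)
        Q.refl (ι x))))
    where
    module SP = Solver P
    module SQ = Solver Q

  ι-form : ∀ n g X Y → ι (BinaryForm.form P n g X Y) Q.≈ BinaryForm.form Q n g (ι X) (ι Y)
  ι-form n       []      X Y = ι-0
  ι-form zero    (a ∷ g) X Y = ι-int a
  ι-form (suc n) (a ∷ g) X Y = Q.trans (ι-+ _ _) (Q.+-cong
    (Q.trans (ι-* _ _) (Q.*-cong (ι-int a) (ι-^ Y (suc n))))
    (Q.trans (ι-* X _) (Q.*-congˡ (ι-form n g X Y))))

-- P plays ℤ[x] and Q plays ℚ[x].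
module _ {P Q : ℤ-Algebra} (hom : Homomorphism P Q) where
  open Homomorphism hom

  -- `descent` embeds ℤ[θ] into ℚ[θ]; `denominator` and `inverse` make ℚ[θ] its localisation at the
  -- positive integers.
  module Localisation (f : ℤ-Algebra.Carrier P)
    (descent : ∀ z → ℤ-Algebra._∣ᴿ_ Q (ι f) (ι z) → ℤ-Algebra._∣ᴿ_ P f z)
    (denominator : ∀ α → ∃₂ λ N h → 0 < N × ℤ-Algebra._≈_ Q (ℤ-Algebra._*_ Q (ℤ-Algebra.int Q (+ N)) α) (ι h))
    (inverse : ∀ N → 0 < N → ∃ λ i → ℤ-Algebra._≈_ Q (ℤ-Algebra._*_ Q i (ℤ-Algebra.int Q (+ N))) (ℤ-Algebra.1# Q)) where

    private
      module P = ℤ-Algebra P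
      module Q = ℤ-Algebra Q
      idealP = Quotient.principal-isIdeal P f
      idealQ = Quotient.principal-isIdeal Q (ι f)

    ℤ[θ] ℚ[θ] : ℤ-Algebra
    ℤ[θ] = Quotient.A/⟨_⟩ P f
    ℚ[θ] = Quotient.A/⟨_⟩ Q (ι f)

    private
      module A = ℤ-Algebra ℤ[θ]
      module K = ℤ-Algebra ℚ[θ]
      lift≈ : ∀ {x y} → x Q.≈ y → x K.≈ y
      lift≈ = Quotient.≈⇒≈/ Q idealQ

    ι-residue : ∀ {x y} → x A.≈ y → ι x K.≈ ι y
    ι-residue {x} {y} (q , e) = ι q , Q.trans (Q.sym (ι-* q f)) (Q.trans (ι-cong e) (Q.trans (ι-+ x (P.- y)) (Q.+-congˡ (ι-neg y))))

    ι-residue⁻¹ : ∀ {x y} → ι x K.≈ ι y → x A.≈ y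
    ι-residue⁻¹ {x} {y} (q , e) = descent (x P.- y) (q , Q.trans e (Q.sym (Q.trans (ι-+ x (P.- y)) (Q.+-congˡ (ι-neg y)))))

    cancel : ∀ N → 0 < N → ∀ α β → K.int (+ N) K.* α K.≈ K.int (+ N) K.* β → α K.≈ β
    cancel N 0<N α β e with inverse N 0<N
    ... | i , i*N = begin
      α                          ≈⟨ unit α ⟨
      i K.* (K.int (+ N) K.* α)  ≈⟨ K.*-congˡ e ⟩
      i K.* (K.int (+ N) K.* β)  ≈⟨ unit β ⟩
      β ∎
      where
      open import Relation.Binary.Reasoning.Setoid K.setoid
      unit : ∀ α → i K.* (K.int (+ N) K.* α) K.≈ α
      unit α = K.trans (K.sym (K.*-assoc i _ α)) (K.trans (K.*-congʳ (lift≈ i*N)) (K.*-identityˡ α))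

    -- Writing N α = h and N = p M makes h / (p M) a root of g. Maximality at p divides h by p, and
    -- the induction continues with the smaller denominator M.
    integral-is-polynomial : (∀ {p} → Prime p → MaximalAt P f p) → ∀ α n g → MonicOfDegree n g →
      Evaluation.evaluate ℚ[θ] g α K.≈ K.0# → ∃ λ h → α K.≈ ι h
    integral-is-polynomial maximal α n g (monic , degree) root with denominator α
    ... | N , h , 0<N , e = go N 0<N h (lift≈ e) (<-wellFounded N)
      where
      open import Relation.Binary.Reasoning.Setoid K.setoid
      open BinaryForm ℚ[θ]
      go : ∀ N → 0 < N → ∀ h → K.int (+ N) K.* α K.≈ ι h → Acc _<_ N → ∃ λ h → α K.≈ ι h
      go 1 0<N h e _ = h , K.trans (K.sym (K.trans (K.*-congʳ K.1#-homo) (K.*-identityˡ α))) e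
      go N@(suc (suc _)) 0<N h e (acc rec) with prime-factor-of N (s≤s (s≤s z≤n))
      ... | p , M , pr , N≡ = go M 0<M h′ (cancel p 0<p _ _ pMα) (rec M<N)
        where
        0<p : 0 < p
        0<p = prime>0 pr
        0<M : 0 < M
        0<M = positive M N≡
          where
          positive : ∀ M → N ≡ p ℕ.* M → 0 < M
          positive zero    eq with ≡.trans eq (ℕₚ.*-zeroʳ p)
          ... | ()
          positive (suc M) eq = s≤s z≤n
        M<N : M < N
        M<N = subst (M <_) (≡.trans (ℕₚ.*-comm M p) (≡.sym N≡)) (ℕₚ.m<m*n M p {{ℕ.>-nonZero 0<M}} (prime≥2 pr))
        -- N is kept factored as p M, the shape in which `MaximalAt` takes the second argument of
        -- the form.
        Y : P.Carrier
        Y = P.int (+ p) P.* P.int (+ M)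
        ιY : ι Y Q.≈ Q.int (+ N)
        ιY = Q.trans (ι-* _ _) (Q.trans (Q.*-cong (ι-int (+ p)) (ι-int (+ M))) (Q.trans (Q.sym (Q.*-homo (+ p) (+ M)))
          (Q.int-cong (≡.trans (≡.sym (ℤₚ.pos-* p M)) (≡.cong +_ (≡.sym N≡))))))
        root-K : form n g (ι h) (ι Y) K.≈ K.0#
        root-K = begin
          form n g (ι h) (ι Y)
            ≈⟨ form-cong n g (K.sym e) (K.trans (lift≈ ιY) (K.sym (K.*-identityʳ _))) ⟩
          form n g (K.int (+ N) K.* α) (K.int (+ N) K.* K.1#) ≈⟨ form-homogeneous n g (K.int (+ N)) α K.1# ⟩
          K.int (+ N) K.^ n K.* form n g α K.1#
            ≈⟨ K.*-congˡ (K.trans (Evaluation.form≈evaluate ℚ[θ] n g α degree) root) ⟩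
          K.int (+ N) K.^ n K.* K.0#                      ≈⟨ K.zeroʳ _ ⟩
          K.0# ∎
        root-A : BinaryForm.form ℤ[θ] n g h Y A.≈ A.0#
        root-A = subst (A._≈ A.0#) (≡.sym (form-quotient P idealP n g h Y)) (ι-residue⁻¹ (begin
          ι (BinaryForm.form P n g h Y)         ≈⟨ lift≈ (ι-form n g h Y) ⟩
          BinaryForm.form Q n g (ι h) (ι Y)     ≡⟨ form-quotient Q idealQ n g (ι h) (ι Y) ⟨
          form n g (ι h) (ι Y)                  ≈⟨ root-K ⟩
          K.0#                                  ≈⟨ lift≈ ι-0 ⟨
          ι P.0# ∎))
        divided = maximal pr n g monic h (P.int (+ M)) root-A
        h′ : P.Carrier
        h′ = proj₁ divided
        pMα : K.int (+ p) K.* (K.int (+ M) K.* α) K.≈ K.int (+ p) K.* ι h′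
        pMα = begin
          K.int (+ p) K.* (K.int (+ M) K.* α)   ≈⟨ K.*-assoc _ _ α ⟨
          K.int (+ p) K.* K.int (+ M) K.* α
            ≈⟨ K.*-congʳ (lift≈ (Q.trans (Q.sym (Q.*-homo (+ p) (+ M))) (Q.int-cong (≡.trans (≡.sym (ℤₚ.pos-* p M)) (≡.cong +_ (≡.sym N≡)))))) ⟩
          K.int (+ N) K.* α                     ≈⟨ e ⟩
          ι h                                   ≈⟨ ι-residue (proj₂ divided) ⟩
          ι (P.int (+ p) P.* h′)                ≈⟨ lift≈ (Q.trans (ι-* _ h′) (Q.*-congʳ (ι-int (+ p)))) ⟩
          K.int (+ p) K.* ι h′ ∎

-- Integrality over ℤ by elimination in a finitely generated module

below-suc : ∀ {n p} → ℤP.Below n p → ℤP.Below (suc n) p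
below-suc b i n<i = b i (ℕₚ.<⇒≤ n<i)

below-mul : ∀ {m n} p q → coeff p m ℤ.* coeff q n ≡ + 0 → ℤP.Below (suc m) p → ℤP.Below (suc n) q → ℤP.Below (m ℕ.+ n) (mul p q)
below-mul {m} {n} p q top bp bq i le with ℕₚ.m≤n⇒m<n∨m≡n le | ℤP.below-mul-top {m} {n} p q bp bq
... | inj₁ lt     | _ , rest = rest i lt
... | inj₂ ≡.refl | eq , _   = ≡.trans eq top

monic-mul : ∀ {m n} p q → MonicOfDegree m p → MonicOfDegree n q → MonicOfDegree (m ℕ.+ n) (mul p q)
monic-mul {m} {n} p q (p1 , bp) (q1 , bq) with ℤP.below-mul-top {m} {n} p q bp bq
... | eq , rest = ≡.trans eq (≡.cong₂ ℤ._*_ p1 q1) , rest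

monic-add : ∀ {n} p q → MonicOfDegree n p → ℤP.Below n q → MonicOfDegree n (add p q)
monic-add {n} p q (p1 , bp) bq =
  ≡.trans (ℤP.coeff-add p q n) (≡.cong₂ ℤ._+_ p1 (bq n ℕₚ.≤-refl)) ,
  λ i n<i → ≡.trans (ℤP.coeff-add p q i) (≡.cong₂ ℤ._+_ (bp i n<i) (bq i (ℕₚ.<⇒≤ n<i)))

below-add : ∀ {n} p q → ℤP.Below n p → ℤP.Below n q → ℤP.Below n (add p q)
below-add p q bp bq i le = ≡.trans (ℤP.coeff-add p q i) (≡.cong₂ ℤ._+_ (bp i le) (bq i le))

below-neg : ∀ {n} p → ℤP.Below n p → ℤP.Below n (List.map ℤ.-_ p)
below-neg p bp i le = ≡.trans (ℤP.coeff-neg p i) (≡.cong ℤ.-_ (bp i le))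

module EvaluationHomomorphism (K : ℤ-Algebra) where
  open ℤ-Algebra K
  open Evaluation K
  open Solver K
  open import Relation.Binary.Reasoning.Setoid setoid

  evaluate-add : ∀ p q α → evaluate (add p q) α ≈ evaluate p α + evaluate q α
  evaluate-add []      q       α = sym (+-identityˡ _)
  evaluate-add (a ∷ p) []      α = sym (+-identityʳ _)
  evaluate-add (a ∷ p) (b ∷ q) α = begin
    int (a ℤ.+ b) + α * evaluate (add p q) α             ≈⟨ +-cong (+-homo a b) (*-congˡ (evaluate-add p q α)) ⟩
    int a + int b + α * (evaluate p α + evaluate q α)
      ≈⟨ solve 5 (λ a b α p q → a :+ b :+ α :* (p :+ q) := (a :+ α :* p) :+ (b :+ α :* q))
          refl (int a) (int b) α _ _ ⟩
    evaluate (a ∷ p) α + evaluate (b ∷ q) α ∎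

  evaluate-scale : ∀ a q α → evaluate (List.map (a ℤ.*_) q) α ≈ int a * evaluate q α
  evaluate-scale a []      α = sym (zeroʳ _)
  evaluate-scale a (b ∷ q) α = begin
    int (a ℤ.* b) + α * evaluate (List.map (a ℤ.*_) q) α
      ≈⟨ +-cong (*-homo a b) (*-congˡ (evaluate-scale a q α)) ⟩
    int a * int b + α * (int a * evaluate q α)
      ≈⟨ solve 4 (λ a b α q → a :* b :+ α :* (a :* q) := a :* (b :+ α :* q)) refl (int a) (int b) α _ ⟩
    int a * evaluate (b ∷ q) α ∎

  evaluate-neg : ∀ q α → evaluate (List.map ℤ.-_ q) α ≈ - evaluate q α
  evaluate-neg []      α = sym (trans (sym (+-identityˡ _)) (-‿inverseʳ 0#))
  evaluate-neg (b ∷ q) α = begin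
    int (ℤ.- b) + α * evaluate (List.map ℤ.-_ q) α ≈⟨ +-cong (-‿homo b) (*-congˡ (evaluate-neg q α)) ⟩
    - int b + α * - evaluate q α
      ≈⟨ solve 3 (λ b α q → :- b :+ α :* (:- q) := :- (b :+ α :* q)) refl (int b) α _ ⟩
    - evaluate (b ∷ q) α ∎

  evaluate-mul : ∀ p q α → evaluate (mul p q) α ≈ evaluate p α * evaluate q α
  evaluate-mul []      q α = sym (zeroˡ _)
  evaluate-mul (a ∷ p) q α = begin
    evaluate (add (List.map (a ℤ.*_) q) (+ 0 ∷ mul p q)) α    ≈⟨ evaluate-add (List.map (a ℤ.*_) q) _ α ⟩
    evaluate (List.map (a ℤ.*_) q) α + (int (+ 0) + α * evaluate (mul p q) α)
      ≈⟨ +-cong (evaluate-scale a q α) (+-congˡ (*-congˡ (evaluate-mul p q α))) ⟩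
    int a * evaluate q α + (int (+ 0) + α * (evaluate p α * evaluate q α))
      ≈⟨ solve 4 (λ a q α p → a :* q :+ (con (+ 0) :+ α :* (p :* q)) := (a :+ α :* p) :* q)
          refl (int a) (evaluate q α) α (evaluate p α) ⟩
    evaluate (a ∷ p) α * evaluate q α ∎

module _ (K : ℤ-Algebra) where
  open ℤ-Algebra K

  module Elimination (γ : Carrier) where
    open Evaluation K
    open EvaluationHomomorphism K
    open Solver K
    open import Algebra.Properties.Semiring.Sum semiring using (sum; sum-cong-≋; ∑-distrib-+; *-distribˡ-sum; sum-replicate-zero)
    open import Relation.Binary.Reasoning.Setoid setoid

    ⟦_⟧ : List ℤ → Carrier
    ⟦ p ⟧ = evaluate p γ

    private
      sum-zero : ∀ {n} (t : Vector Carrier n) → (∀ i → t i ≈ 0#) → sum t ≈ 0#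
      sum-zero {n} t t≈0 = trans (sum-cong-≋ t≈0) (sum-replicate-zero n)

    -- Fraction-free elimination: the diagonal stays monic of a common degree
    -- that strictly bounds the degrees of all other entries.
    annihilator : ∀ n d (P : Fin n → Fin n → List ℤ) (v : Vector Carrier n) →
      (∀ i → MonicOfDegree d (P i i)) → (∀ i j → i ≢ j → ℤP.Below d (P i j)) →
      (∀ i → sum (λ j → ⟦ P i j ⟧ * v j) ≈ 0#) →
      ∃₂ λ e g → MonicOfDegree e g × (∀ i → ⟦ g ⟧ * v i ≈ 0#)
    annihilator zero    d P v diagonal off relation = 0 , const (+ 1) , (≡.refl , λ { (suc i) _ → ≡.refl }) , λ ()
    annihilator (suc n) d P v diagonal off relation = conclude (annihilator n (d ℕ.+ d) P′ (v ∘ suc) diagonal′ off′ relation′)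
      where
      P₀₀ : List ℤ
      P₀₀ = P zero zero
      P′ : Fin n → Fin n → List ℤ
      P′ i j = add (mul P₀₀ (P (suc i) (suc j))) (List.map ℤ.-_ (mul (P (suc i) zero) (P zero (suc j))))
      below₂ : ∀ i j → ℤP.Below (d ℕ.+ d) (List.map ℤ.-_ (mul (P (suc i) zero) (P zero (suc j))))
      below₂ i j = below-neg (mul (P (suc i) zero) (P zero (suc j))) (below-mul {d} {d} (P (suc i) zero) (P zero (suc j))
        (≡.cong (ℤ._* _) (off (suc i) zero (λ ()) d ℕₚ.≤-refl)) (below-suc {p = P (suc i) zero} (off (suc i) zero λ ())) (below-suc {p = P zero (suc j)} (off zero (suc j) λ ())))
      diagonal′ : ∀ i → MonicOfDegree (d ℕ.+ d) (P′ i i)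
      diagonal′ i = monic-add (mul P₀₀ (P (suc i) (suc i))) _ (monic-mul P₀₀ (P (suc i) (suc i)) (diagonal zero) (diagonal (suc i))) (below₂ i i)
      off′ : ∀ i j → i ≢ j → ℤP.Below (d ℕ.+ d) (P′ i j)
      off′ i j i≢j = below-add (mul P₀₀ Pᵢⱼ) _ (below-mul {d} {d} P₀₀ Pᵢⱼ
          (≡.trans (≡.cong (coeff P₀₀ d ℤ.*_) (b d ℕₚ.≤-refl)) (ℤₚ.*-zeroʳ (coeff P₀₀ d))) (proj₂ (diagonal zero)) (below-suc {p = Pᵢⱼ} b)) (below₂ i j)
        where
        Pᵢⱼ = P (suc i) (suc j)
        b : ℤP.Below d Pᵢⱼ
        b = off (suc i) (suc j) (λ e → i≢j (Finₚ.suc-injective e))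
      row : ∀ i → Carrier
      row i = sum (λ j → ⟦ P i (suc j) ⟧ * v (suc j))
      row≈ : ∀ i → row i ≈ - (⟦ P i zero ⟧ * v zero)
      row≈ i = begin
        row i
          ≈⟨ solve 2 (λ u r → r := (u :+ r) :- u) refl (⟦ P i zero ⟧ * v zero) (row i) ⟩
        (⟦ P i zero ⟧ * v zero + row i) - ⟦ P i zero ⟧ * v zero        ≈⟨ +-congʳ (relation i) ⟩
        0# - ⟦ P i zero ⟧ * v zero                                     ≈⟨ +-identityˡ _ ⟩
        - (⟦ P i zero ⟧ * v zero) ∎
      entry : ∀ i j → ⟦ P′ i j ⟧ * v (suc j) ≈ ⟦ P₀₀ ⟧ * (⟦ P (suc i) (suc j) ⟧ * v (suc j)) + - ⟦ P (suc i) zero ⟧ * (⟦ P zero (suc j) ⟧ * v (suc j))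
      entry i j = begin
        ⟦ P′ i j ⟧ * v (suc j)
          ≈⟨ *-congʳ (trans (evaluate-add (mul P₀₀ (P (suc i) (suc j))) _ γ) (+-cong (evaluate-mul P₀₀ (P (suc i) (suc j)) γ)
               (trans (evaluate-neg (mul (P (suc i) zero) (P zero (suc j))) γ) (-‿cong (evaluate-mul (P (suc i) zero) (P zero (suc j)) γ))))) ⟩
        (⟦ P₀₀ ⟧ * ⟦ P (suc i) (suc j) ⟧ + - (⟦ P (suc i) zero ⟧ * ⟦ P zero (suc j) ⟧)) * v (suc j)
          ≈⟨ solve 5 (λ a b c d v → (a :* b :+ :- (c :* d)) :* v := a :* (b :* v) :+ (:- c) :* (d :* v))
              refl ⟦ P₀₀ ⟧ ⟦ P (suc i) (suc j) ⟧ ⟦ P (suc i) zero ⟧ ⟦ P zero (suc j) ⟧ (v (suc j)) ⟩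
        ⟦ P₀₀ ⟧ * (⟦ P (suc i) (suc j) ⟧ * v (suc j)) + - ⟦ P (suc i) zero ⟧ * (⟦ P zero (suc j) ⟧ * v (suc j)) ∎
      relation′ : ∀ i → sum (λ j → ⟦ P′ i j ⟧ * v (suc j)) ≈ 0#
      relation′ i = begin
        sum (λ j → ⟦ P′ i j ⟧ * v (suc j))                                   ≈⟨ sum-cong-≋ (entry i) ⟩
        sum (λ j → ⟦ P₀₀ ⟧ * (⟦ P (suc i) (suc j) ⟧ * v (suc j)) + - ⟦ P (suc i) zero ⟧ * (⟦ P zero (suc j) ⟧ * v (suc j)))
          ≈⟨ ∑-distrib-+ (λ j → ⟦ P₀₀ ⟧ * (⟦ P (suc i) (suc j) ⟧ * v (suc j))) (λ j → - ⟦ P (suc i) zero ⟧ * (⟦ P zero (suc j) ⟧ * v (suc j))) ⟩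
        sum (λ j → ⟦ P₀₀ ⟧ * (⟦ P (suc i) (suc j) ⟧ * v (suc j))) + sum (λ j → - ⟦ P (suc i) zero ⟧ * (⟦ P zero (suc j) ⟧ * v (suc j)))
          ≈⟨ +-cong (*-distribˡ-sum ⟦ P₀₀ ⟧ (λ j → ⟦ P (suc i) (suc j) ⟧ * v (suc j))) (*-distribˡ-sum (- ⟦ P (suc i) zero ⟧) (λ j → ⟦ P zero (suc j) ⟧ * v (suc j))) ⟨
        ⟦ P₀₀ ⟧ * row (suc i) + - ⟦ P (suc i) zero ⟧ * row zero
          ≈⟨ +-cong (*-congˡ (row≈ (suc i))) (*-congˡ (row≈ zero)) ⟩
        ⟦ P₀₀ ⟧ * - (⟦ P (suc i) zero ⟧ * v zero) + - ⟦ P (suc i) zero ⟧ * - (⟦ P₀₀ ⟧ * v zero)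
          ≈⟨ solve 3 (λ a b v → a :* (:- (b :* v)) :+ (:- b) :* (:- (a :* v)) := con (+ 0))
              refl ⟦ P₀₀ ⟧ ⟦ P (suc i) zero ⟧ (v zero) ⟩
        int (+ 0)   ≈⟨ 0#-homo ⟩
        0# ∎
      conclude : (∃₂ λ e g → MonicOfDegree e g × (∀ i → ⟦ g ⟧ * v (suc i) ≈ 0#)) →
                 ∃₂ λ e g → MonicOfDegree e g × (∀ i → ⟦ g ⟧ * v i ≈ 0#)
      -- g kills all but the first vector, and the first row expresses P₀₀ v₀ through the killed
      -- ones; hence the additional factor P₀₀.
      conclude (e , g , monic , kills) = e ℕ.+ d , mul g P₀₀ , monic-mul g P₀₀ monic (diagonal zero) , λ
        { zero → begin
            ⟦ mul g P₀₀ ⟧ * v zero                 ≈⟨ *-congʳ (evaluate-mul g P₀₀ γ) ⟩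
            ⟦ g ⟧ * ⟦ P₀₀ ⟧ * v zero
              ≈⟨ solve 3 (λ g a v → g :* a :* v := :- (g :* (:- (a :* v)))) refl ⟦ g ⟧ ⟦ P₀₀ ⟧ (v zero) ⟩
            - (⟦ g ⟧ * - (⟦ P₀₀ ⟧ * v zero))       ≈⟨ -‿cong (*-congˡ (row≈ zero)) ⟨
            - (⟦ g ⟧ * row zero)
              ≈⟨ -‿cong (*-distribˡ-sum ⟦ g ⟧ (λ j → ⟦ P zero (suc j) ⟧ * v (suc j))) ⟩
            - sum (λ j → ⟦ g ⟧ * (⟦ P zero (suc j) ⟧ * v (suc j)))
              ≈⟨ -‿cong (sum-zero (λ j → ⟦ g ⟧ * (⟦ P zero (suc j) ⟧ * v (suc j))) λ j →
                   trans (solve 3 (λ g a v → g :* (a :* v) := a :* (g :* v))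
                       refl ⟦ g ⟧ ⟦ P zero (suc j) ⟧ (v (suc j))) (trans (*-congˡ (kills j)) (zeroʳ _))) ⟩
            - 0#                                   ≈⟨ trans (sym (+-identityˡ _)) (-‿inverseʳ 0#) ⟩
            0# ∎
        ; (suc i) → begin
            ⟦ mul g P₀₀ ⟧ * v (suc i)              ≈⟨ *-congʳ (evaluate-mul g P₀₀ γ) ⟩
            ⟦ g ⟧ * ⟦ P₀₀ ⟧ * v (suc i)
              ≈⟨ solve 3 (λ g a v → g :* a :* v := a :* (g :* v)) refl ⟦ g ⟧ ⟦ P₀₀ ⟧ (v (suc i)) ⟩
            ⟦ P₀₀ ⟧ * (⟦ g ⟧ * v (suc i))          ≈⟨ *-congˡ (kills i) ⟩
            ⟦ P₀₀ ⟧ * 0#                           ≈⟨ zeroʳ _ ⟩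
            0# ∎ }

    Spanned : ∀ {n} → Vector Carrier n → Carrier → Set
    Spanned {n} v x = ∃ λ (a : Vector ℤ n) → x ≈ sum (λ j → int (a j) * v j)

    private
      -- The scalar matrix X I, whose entries are polynomials to be evaluated at γ.
      δ : ∀ {n} → Fin n → Fin n → List ℤ
      δ zero    zero    = + 0 ∷ + 1 ∷ []
      δ zero    (suc j) = + 0 ∷ []
      δ (suc i) zero    = + 0 ∷ []
      δ (suc i) (suc j) = δ i j

      minus-const : List ℤ → ℤ → List ℤ
      minus-const p a = add p (const (ℤ.- a))

      δ-monic : ∀ {n} (i : Fin n) → MonicOfDegree 1 (δ i i)
      δ-monic zero    = ≡.refl , λ { (suc (suc i)) _ → ≡.refl ; (suc zero) (s≤s ()) }
      δ-monic (suc i) = δ-monic i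

      δ-off : ∀ {n} (i j : Fin n) → i ≢ j → ℤP.Below 1 (δ i j)
      δ-off zero    zero    i≢j = contradiction ≡.refl i≢j
      δ-off zero    (suc j) i≢j (suc i) _ = ≡.refl
      δ-off (suc i) zero    i≢j (suc j) _ = ≡.refl
      δ-off (suc i) (suc j) i≢j = δ-off i j (λ e → i≢j (≡.cong suc e))

      const-below : ∀ a → ℤP.Below 1 (const a)
      const-below a (suc i) _ = ≡.refl

      off-δ≈0 : ∀ v → ⟦ + 0 ∷ [] ⟧ * v ≈ 0#
      off-δ≈0 v = trans (*-congʳ (trans (+-cong 0#-homo (zeroʳ γ)) (+-identityʳ 0#))) (zeroˡ v)

      sum-δ : ∀ {n} (i : Fin n) (v : Vector Carrier n) → sum (λ j → ⟦ δ i j ⟧ * v j) ≈ γ * v i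
      sum-δ {suc n} zero v = begin
        ⟦ + 0 ∷ + 1 ∷ [] ⟧ * v zero + sum (λ j → ⟦ + 0 ∷ [] ⟧ * v (suc j))
          ≈⟨ +-congˡ (sum-zero (λ j → ⟦ + 0 ∷ [] ⟧ * v (suc j)) (λ j → off-δ≈0 (v (suc j)))) ⟩
        (int (+ 0) + γ * (int (+ 1) + γ * 0#)) * v zero + 0#
          ≈⟨ solve 3 (λ γ o v → (con (+ 0) :+ γ :* (con (+ 1) :+ γ :* o)) :* v :+ o := γ :* v :+ (γ :* γ :* v :+ con (+ 1)) :* o)
              refl γ 0# (v zero) ⟩
        γ * v zero + (γ * γ * v zero + int (+ 1)) * 0#   ≈⟨ trans (+-congˡ (zeroʳ _)) (+-identityʳ _) ⟩
        γ * v zero ∎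
      sum-δ {suc n} (suc i) v = trans (+-cong (off-δ≈0 (v zero)) (sum-δ i (v ∘ suc))) (+-identityˡ _)

    -- The determinant trick: the matrix γ I - a kills v, elimination turns it into a monic g with
    -- g(γ) v = 0, and g(γ) = 0 follows because 1 lies in the span of v.
    integral-of-stable : ∀ {n} (v : Vector Carrier n) → Spanned v 1# → (∀ i → Spanned v (γ * v i)) →
      ∃₂ λ e g → MonicOfDegree e g × ⟦ g ⟧ ≈ 0#
    integral-of-stable {n} v (c , 1≈) stable = conclude (annihilator n 1 P v diagonal off relation)
      where
      a : Fin n → Fin n → ℤ
      a i = proj₁ (stable i)
      P : Fin n → Fin n → List ℤ
      P i j = minus-const (δ i j) (a i j)
      diagonal : ∀ i → MonicOfDegree 1 (P i i)
      diagonal i = monic-add (δ i i) _ (δ-monic i) (const-below _)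
      off : ∀ i j → i ≢ j → ℤP.Below 1 (P i j)
      off i j i≢j = below-add (δ i j) _ (δ-off i j i≢j) (const-below _)
      entry : ∀ i j → ⟦ P i j ⟧ * v j ≈ ⟦ δ i j ⟧ * v j + int (ℤ.- + 1) * (int (a i j) * v j)
      entry i j = trans (*-congʳ (trans (evaluate-add (δ i j) _ γ) (+-congˡ (trans (+-cong (-‿homo (a i j)) (zeroʳ γ)) (+-identityʳ _)))))
        (solve 3 (λ d a v → (d :+ :- a) :* v := d :* v :+ con (ℤ.- + 1) :* (a :* v))
            refl ⟦ δ i j ⟧ (int (a i j)) (v j))
      relation : ∀ i → sum (λ j → ⟦ P i j ⟧ * v j) ≈ 0#
      relation i = begin
        sum (λ j → ⟦ P i j ⟧ * v j)        ≈⟨ sum-cong-≋ (entry i) ⟩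
        sum (λ j → ⟦ δ i j ⟧ * v j + int (ℤ.- + 1) * (int (a i j) * v j))
          ≈⟨ ∑-distrib-+ (λ j → ⟦ δ i j ⟧ * v j) (λ j → int (ℤ.- + 1) * (int (a i j) * v j)) ⟩
        sum (λ j → ⟦ δ i j ⟧ * v j) + sum (λ j → int (ℤ.- + 1) * (int (a i j) * v j))
          ≈⟨ +-cong (sum-δ i v) (sym (*-distribˡ-sum (int (ℤ.- + 1)) (λ j → int (a i j) * v j))) ⟩
        γ * v i + int (ℤ.- + 1) * sum (λ j → int (a i j) * v j)   ≈⟨ +-congˡ (*-congˡ (proj₂ (stable i))) ⟨
        γ * v i + int (ℤ.- + 1) * (γ * v i)
          ≈⟨ solve 1 (λ x → x :+ con (ℤ.- + 1) :* x := con (+ 0)) refl (γ * v i) ⟩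
        int (+ 0)  ≈⟨ 0#-homo ⟩
        0# ∎
      conclude : (∃₂ λ e g → MonicOfDegree e g × (∀ i → ⟦ g ⟧ * v i ≈ 0#)) → ∃₂ λ e g → MonicOfDegree e g × ⟦ g ⟧ ≈ 0#
      conclude (e , g , monic , kills) = e , g , monic , (begin
        ⟦ g ⟧                                     ≈⟨ *-identityʳ _ ⟨
        ⟦ g ⟧ * 1#                                ≈⟨ *-congˡ 1≈ ⟩
        ⟦ g ⟧ * sum (λ j → int (c j) * v j)       ≈⟨ *-distribˡ-sum ⟦ g ⟧ (λ j → int (c j) * v j) ⟩
        sum (λ j → ⟦ g ⟧ * (int (c j) * v j))
          ≈⟨ sum-zero (λ j → ⟦ g ⟧ * (int (c j) * v j)) (λ j → trans (solve 3 (λ g c v → g :* (c :* v) := c :* (g :* v))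
              refl ⟦ g ⟧ (int (c j)) (v j)) (trans (*-congˡ (kills j)) (zeroʳ _))) ⟩
        0# ∎)

    private
      sum-++ : ∀ {m n} (xs : Vector Carrier m) (ys : Vector Carrier n) → sum (xs ++ ys) ≈ sum xs + sum ys
      sum-++ {zero}  xs ys = sym (+-identityˡ _)
      sum-++ {suc m} xs ys = trans (+-congˡ (trans (sum-cong-≋ tail) (sum-++ (xs ∘ suc) ys))) (sym (+-assoc _ _ _))
        where
        tail : ∀ i → (xs ++ ys) (suc i) ≈ ((xs ∘ suc) ++ ys) i
        tail i with splitAt m i
        ... | inj₁ _ = refl
        ... | inj₂ _ = refl

    spanned-++ : ∀ {m n} (u : Vector Carrier m) (w : Vector Carrier n) {x y} → Spanned u x → Spanned w y → Spanned (u ++ w) (x + y)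
    spanned-++ {m} u w (a , x≈) (c , y≈) = a ++ c , trans (+-cong x≈ y≈) (trans (sym (sum-++ (λ j → int (a j) * u j) (λ j → int (c j) * w j))) (sum-cong-≋ pointwise))
      where
      pointwise : ∀ i → ((λ j → int (a j) * u j) ++ (λ j → int (c j) * w j)) i ≈ int ((a ++ c) i) * (u ++ w) i
      pointwise i with splitAt m i
      ... | inj₁ _ = refl
      ... | inj₂ _ = refl

    spanned-scale : ∀ {n} (u : Vector Carrier n) {x} → Spanned u x → Spanned (λ j → γ * u j) (γ * x)
    spanned-scale u (a , x≈) = a , trans (*-congˡ x≈) (trans (*-distribˡ-sum γ (λ j → int (a j) * u j))
      (sum-cong-≋ λ j → solve 3 (λ γ a u → γ :* (a :* u) := a :* (γ :* u)) refl γ (int (a j)) (u j)))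

    spanned-resp : ∀ {n} (u : Vector Carrier n) {x y} → x ≈ y → Spanned u x → Spanned u y
    spanned-resp u e (a , x≈) = a , trans (sym e) x≈

    -- The module spanned by u and γ u is stable under γ, because γ (γ uⱼ) = t uⱼ + γ (s uⱼ) and the
    -- span of u contains s uⱼ and t uⱼ. In the application u spans ℤ[θ].
    integral-of-quadratic : ∀ {n} (u : Vector Carrier n) → Spanned u 1# → Spanned u 0# → ∀ s t → γ * γ ≈ s * γ + t →
      (∀ i → Spanned u (u i)) → (∀ i → Spanned u (s * u i)) → (∀ i → Spanned u (t * u i)) →
      ∃₂ λ e g → MonicOfDegree e g × ⟦ g ⟧ ≈ 0#
    integral-of-quadratic {n} u one zero′ s t γ² self by-s by-t = integral-of-stable (u ++ γu)
        (spanned-resp (u ++ γu) (trans (+-congˡ (zeroʳ γ)) (+-identityʳ 1#)) (spanned-++ u γu one (spanned-scale u zero′)))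
        stable
      where
      γu : Vector Carrier n
      γu j = γ * u j
      stable : ∀ i → Spanned (u ++ γu) (γ * (u ++ γu) i)
      stable i with splitAt n i
      ... | inj₁ j = spanned-resp (u ++ γu) (+-identityˡ _) (spanned-++ u γu zero′ (spanned-scale u (self j)))
      ... | inj₂ j = spanned-resp (u ++ γu) (begin
          t * u j + γ * (s * u j)
            ≈⟨ solve 4 (λ t u γ s → t :* u :+ γ :* (s :* u) := (s :* γ :+ t) :* u) refl t (u j) γ s ⟩
          (s * γ + t) * u j             ≈⟨ *-congʳ γ² ⟨
          γ * γ * u j                   ≈⟨ *-assoc γ γ (u j) ⟩
          γ * (γ * u j) ∎) (spanned-++ u γu (by-t j) (spanned-scale u (by-s j)))

-- With f = r^(e+2) + p E and E = p w + r b′, the element γ = r^(e+1) / p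
-- satisfies γ² + b′ γ + w r^e = 0.
module _ {P Q : ℤ-Algebra} (hom : Homomorphism P Q) where
  open Homomorphism hom

  module NonMaximal (f : ℤ-Algebra.Carrier P)
    (descent : ∀ z → ℤ-Algebra._∣ᴿ_ Q (ι f) (ι z) → ℤ-Algebra._∣ᴿ_ P f z)
    (denominator : ∀ α → ∃₂ λ N h → 0 < N × ℤ-Algebra._≈_ Q (ℤ-Algebra._*_ Q (ℤ-Algebra.int Q (+ N)) α) (ι h))
    (inverse : ∀ N → 0 < N → ∃ λ i → ℤ-Algebra._≈_ Q (ℤ-Algebra._*_ Q i (ℤ-Algebra.int Q (+ N))) (ℤ-Algebra.1# Q))
    {p : ℕ} (pr : Prime p) {r : ℤ-Algebra.Carrier P} {e : ℕ} {c c′ : ℤ} (c≡ : c ≡ + p ℤ.* c′)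
    (reduction-r : Reduction P r) (ex : Expansion P p f r (suc e) c) where

    open Localisation hom f descent denominator inverse

    private
      module P = ℤ-Algebra P
      module Q = ℤ-Algebra Q
      module A = ℤ-Algebra ℤ[θ]
      module K = ℤ-Algebra ℚ[θ]
      module S = Solver ℚ[θ]
      module Ex = Expansion ex
      instance _ = prime⇒nonZero pr
      lift≈ : ∀ {x y} → x Q.≈ y → x K.≈ y
      lift≈ = Quotient.≈⇒≈/ Q (Quotient.principal-isIdeal Q (ι f))
      0<p : 0 < p
      0<p = prime>0 pr
      i : K.Carrier
      i = proj₁ (inverse p 0<p)
      i*p : i K.* K.int (+ p) K.≈ K.1#
      i*p = lift≈ (proj₂ (inverse p 0<p))
      E-cofactor : ∃ λ b′ → Ex.E P.≈ (P.int c P.+ P.int (+ p) P.* Ex.a) P.+ r P.* b′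
      E-cofactor = cofactor P p (suc e) reduction-r Ex.f-mod-p Ex.f-mod-r
      b′ w : P.Carrier
      b′ = proj₁ E-cofactor
      w = P.int c′ P.+ Ex.a
      E≈ : Ex.E P.≈ P.int (+ p) P.* w P.+ r P.* b′
      E≈ = P.trans (proj₂ E-cofactor) (P.+-congʳ (P.trans (P.+-congʳ (P.trans (P.int-cong c≡) (P.*-homo (+ p) c′))) (P.sym (P.distribˡ _ _ _))))
      R W B : K.Carrier
      R = ι r
      W = ι w
      B = ι b′
      R^ : K.Carrier
      R^ = ι (r P.^ e)

    γ : K.Carrier
    γ = i K.* ι (r P.^ suc e)

    private
      open import Relation.Binary.Reasoning.Setoid K.setoid

      f≈0 : ι f K.≈ K.0#
      f≈0 = Quotient.∈⇒≈0 Q (Quotient.principal-isIdeal Q (ι f)) (Q.1# , Q.*-identityˡ (ι f))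

      r^e : ι (r P.^ suc e) K.≈ R K.* R^
      r^e = lift≈ (ι-* r _)

      relation : R K.* (R K.* R^) K.≈ K.- (K.int (+ p) K.* (K.int (+ p) K.* W K.+ R K.* B))
      relation = begin
        R K.* (R K.* R^)      ≈⟨ K.*-congˡ r^e ⟨
        R K.* ι (r P.^ suc e) ≈⟨ lift≈ (ι-* r _) ⟨
        ι (r P.^ suc (suc e))
          ≈⟨ S.solve 2 (λ x y → x S.:= (x S.:+ y) S.:- y) K.refl _ (ι (P.int (+ p) P.* Ex.E)) ⟩
        (ι (r P.^ suc (suc e)) K.+ ι (P.int (+ p) P.* Ex.E)) K.- ι (P.int (+ p) P.* Ex.E)
          ≈⟨ K.+-congʳ (lift≈ (Q.trans (ι-cong Ex.f-mod-p) (ι-+ _ _))) ⟨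
        ι f K.- ι (P.int (+ p) P.* Ex.E) ≈⟨ K.trans (K.+-congʳ f≈0) (K.+-identityˡ _) ⟩
        K.- ι (P.int (+ p) P.* Ex.E)     ≈⟨ K.-‿cong (lift≈ (Q.trans (ι-* _ _) (Q.*-cong (ι-int (+ p)) (Q.trans (ι-cong E≈)
                                              (Q.trans (ι-+ _ _) (Q.+-cong (Q.trans (ι-* _ _) (Q.*-congʳ (ι-int (+ p)))) (ι-* r b′))))))) ⟩
        K.- (K.int (+ p) K.* (K.int (+ p) K.* W K.+ R K.* B)) ∎

      s t : P.Carrier
      s = P.- b′
      t = P.- (w P.* r P.^ e)

    -- p² γ² = r^e r^(e+2), and r^(e+2) = - p E = - p (p w + r b′). Division by p² leaves - w r^e -
    -- b′ γ.
    γ-quadratic : γ K.* γ K.≈ ι s K.* γ K.+ ι t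
    γ-quadratic = begin
      γ K.* γ                                       ≈⟨ K.*-cong (K.*-congˡ r^e) (K.*-congˡ r^e) ⟩
      i K.* (R K.* R^) K.* (i K.* (R K.* R^))
        ≈⟨ S.solve 3 (λ i R X → i S.:* (R S.:* X) S.:* (i S.:* (R S.:* X)) S.:= i S.:* i S.:* X S.:* (R S.:* (R S.:* X)))
            K.refl i R R^ ⟩
      i K.* i K.* R^ K.* (R K.* (R K.* R^))         ≈⟨ K.*-congˡ relation ⟩
      i K.* i K.* R^ K.* (K.- (K.int (+ p) K.* (K.int (+ p) K.* W K.+ R K.* B)))
        ≈⟨ S.solve 6 (λ i X p W R B → i S.:* i S.:* X S.:* (S.:- (p S.:* (p S.:* W S.:+ R S.:* B)))
             S.:= (i S.:* p) S.:* ((S.:- B) S.:* (i S.:* (R S.:* X)) S.:- (i S.:* p) S.:* (W S.:* X))) K.refl i R^ (K.int (+ p)) W R B ⟩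
      (i K.* K.int (+ p)) K.* (K.- B K.* (i K.* (R K.* R^)) K.- (i K.* K.int (+ p)) K.* (W K.* R^))
        ≈⟨ K.*-cong i*p (K.+-congˡ (K.-‿cong (K.*-congʳ i*p))) ⟩
      K.1# K.* (K.- B K.* (i K.* (R K.* R^)) K.- K.1# K.* (W K.* R^))
        ≈⟨ K.trans (K.*-identityˡ _) (K.+-congˡ (K.-‿cong (K.*-identityˡ _))) ⟩
      K.- B K.* (i K.* (R K.* R^)) K.- W K.* R^
        ≈⟨ K.+-cong (K.*-cong (lift≈ (ι-neg b′)) (K.*-congˡ r^e)) (K.trans (lift≈ (ι-neg _)) (K.-‿cong (lift≈ (ι-* w _)))) ⟨
      ι s K.* γ K.+ ι t ∎

    γ-integral : ∀ {n} (u : Vector P.Carrier n) → (∀ h → Elimination.Spanned ℚ[θ] γ (λ j → ι (u j)) (ι h)) →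
      ∃₂ λ d g → MonicOfDegree d g × Evaluation.evaluate ℚ[θ] g γ K.≈ K.0#
    γ-integral u spans = integral-of-quadratic ιu
        (spanned-resp ιu (lift≈ ι-1) (spans P.1#)) (spanned-resp ιu (lift≈ ι-0) (spans P.0#)) (ι s) (ι t) γ-quadratic
        (λ j → spans (u j))
        (λ j → spanned-resp ιu (lift≈ (ι-* s (u j))) (spans (s P.* u j)))
        (λ j → spanned-resp ιu (lift≈ (ι-* t (u j))) (spans (t P.* u j)))
      where
      open Elimination ℚ[θ] γ
      ιu : Vector K.Carrier _
      ιu j = ι (u j)

    γ-polynomial⇒ : ∀ h → γ K.≈ ι h → r P.^ suc e A.≈ P.int (+ p) P.* h
    γ-polynomial⇒ h γ≈ = ι-residue⁻¹ (begin
      ι (r P.^ suc e)                               ≈⟨ K.*-identityˡ _ ⟨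
      K.1# K.* ι (r P.^ suc e)                      ≈⟨ K.*-congʳ i*p ⟨
      i K.* K.int (+ p) K.* ι (r P.^ suc e)
        ≈⟨ S.solve 3 (λ i p x → i S.:* p S.:* x S.:= p S.:* (i S.:* x))
            K.refl i (K.int (+ p)) (ι (r P.^ suc e)) ⟩
      K.int (+ p) K.* γ                             ≈⟨ K.*-congˡ γ≈ ⟩
      K.int (+ p) K.* ι h                           ≈⟨ lift≈ (Q.trans (ι-* _ h) (Q.*-congʳ (ι-int (+ p)))) ⟨
      ι (P.int (+ p) P.* h) ∎)

-- Rational polynomials

opaque
  -- Identities between rationals are reduced to unnormalised fractions, where equality is cross
  -- multiplication.
  toℚᵘ-ℤ⇒ℚ : ∀ a → toℚᵘ (ℤ⇒ℚ a) ≃ᵘ mkℚᵘ a 0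
  toℚᵘ-ℤ⇒ℚ a = ℚₚ.toℚᵘ-fromℚᵘ (mkℚᵘ a 0)

  ℤ⇒ℚ-injective : ∀ {a b} → ℤ⇒ℚ a ≡ ℤ⇒ℚ b → a ≡ b
  ℤ⇒ℚ-injective {a} {b} eq with ℚᵘₚ.≃-trans (ℚᵘₚ.≃-sym (toℚᵘ-ℤ⇒ℚ a)) (ℚᵘₚ.≃-trans (ℚᵘₚ.≃-reflexive (≡.cong toℚᵘ eq)) (toℚᵘ-ℤ⇒ℚ b))
  ... | *≡* e = ≡.trans (≡.sym (ℤₚ.*-identityʳ a)) (≡.trans e (ℤₚ.*-identityʳ b))

  ℤ⇒ℚ-+ : ∀ a b → ℤ⇒ℚ (a ℤ.+ b) ≡ ℤ⇒ℚ a ℚ.+ ℤ⇒ℚ b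
  ℤ⇒ℚ-+ a b = ℚₚ.toℚᵘ-injective (begin
    toℚᵘ (ℤ⇒ℚ (a ℤ.+ b))                 ≈⟨ toℚᵘ-ℤ⇒ℚ (a ℤ.+ b) ⟩
    mkℚᵘ (a ℤ.+ b) 0
      ≈⟨ *≡* (≡.cong (ℤ._* + 1) (≡.sym (≡.cong₂ ℤ._+_ (ℤₚ.*-identityʳ a) (ℤₚ.*-identityʳ b)))) ⟩
    mkℚᵘ a 0 ℚᵘ.+ mkℚᵘ b 0               ≈⟨ ℚᵘₚ.+-cong (toℚᵘ-ℤ⇒ℚ a) (toℚᵘ-ℤ⇒ℚ b) ⟨
    toℚᵘ (ℤ⇒ℚ a) ℚᵘ.+ toℚᵘ (ℤ⇒ℚ b)       ≈⟨ ℚₚ.toℚᵘ-homo-+ (ℤ⇒ℚ a) (ℤ⇒ℚ b) ⟨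
    toℚᵘ (ℤ⇒ℚ a ℚ.+ ℤ⇒ℚ b) ∎)
    where open import Relation.Binary.Reasoning.Setoid ℚᵘₚ.≃-setoid

  ℤ⇒ℚ-* : ∀ a b → ℤ⇒ℚ (a ℤ.* b) ≡ ℤ⇒ℚ a ℚ.* ℤ⇒ℚ b
  ℤ⇒ℚ-* a b = ℚₚ.toℚᵘ-injective (begin
    toℚᵘ (ℤ⇒ℚ (a ℤ.* b))                 ≈⟨ toℚᵘ-ℤ⇒ℚ (a ℤ.* b) ⟩
    mkℚᵘ a 0 ℚᵘ.* mkℚᵘ b 0               ≈⟨ ℚᵘₚ.*-cong (toℚᵘ-ℤ⇒ℚ a) (toℚᵘ-ℤ⇒ℚ b) ⟨
    toℚᵘ (ℤ⇒ℚ a) ℚᵘ.* toℚᵘ (ℤ⇒ℚ b)       ≈⟨ ℚₚ.toℚᵘ-homo-* (ℤ⇒ℚ a) (ℤ⇒ℚ b) ⟨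
    toℚᵘ (ℤ⇒ℚ a ℚ.* ℤ⇒ℚ b) ∎)
    where open import Relation.Binary.Reasoning.Setoid ℚᵘₚ.≃-setoid

  ℤ⇒ℚ-neg : ∀ a → ℤ⇒ℚ (ℤ.- a) ≡ ℚ.- ℤ⇒ℚ a
  ℤ⇒ℚ-neg a = ℚₚ.toℚᵘ-injective (begin
    toℚᵘ (ℤ⇒ℚ (ℤ.- a))                   ≈⟨ toℚᵘ-ℤ⇒ℚ (ℤ.- a) ⟩
    ℚᵘ.- mkℚᵘ a 0                        ≈⟨ ℚᵘₚ.-‿cong (toℚᵘ-ℤ⇒ℚ a) ⟨
    ℚᵘ.- toℚᵘ (ℤ⇒ℚ a)                    ≈⟨ ℚₚ.toℚᵘ-homo‿- (ℤ⇒ℚ a) ⟨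
    toℚᵘ (ℚ.- ℤ⇒ℚ a) ∎)
    where open import Relation.Binary.Reasoning.Setoid ℚᵘₚ.≃-setoid

  ℚ-denominator : ∀ q → ∃₂ λ N n → 0 < N × ℤ⇒ℚ (+ N) ℚ.* q ≡ ℤ⇒ℚ n
  ℚ-denominator q@(mkℚ n d-1 _) = suc d-1 , n , s≤s z≤n , ℚₚ.toℚᵘ-injective (begin
    toℚᵘ (ℤ⇒ℚ (+ suc d-1) ℚ.* q)              ≈⟨ ℚₚ.toℚᵘ-homo-* (ℤ⇒ℚ (+ suc d-1)) q ⟩
    toℚᵘ (ℤ⇒ℚ (+ suc d-1)) ℚᵘ.* toℚᵘ q        ≈⟨ ℚᵘₚ.*-cong (toℚᵘ-ℤ⇒ℚ (+ suc d-1)) (ℚᵘₚ.≃-refl {toℚᵘ q}) ⟩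
    mkℚᵘ (+ suc d-1) 0 ℚᵘ.* mkℚᵘ n d-1
      ≈⟨ *≡* (≡.trans (ℤₚ.*-identityʳ (+ suc d-1 ℤ.* n)) (≡.trans (ℤₚ.*-comm (+ suc d-1) n) (≡.cong (λ k → n ℤ.* + suc k) (≡.sym (ℕₚ.+-identityʳ d-1))))) ⟩
    mkℚᵘ n 0                                  ≈⟨ toℚᵘ-ℤ⇒ℚ n ⟨
    toℚᵘ (ℤ⇒ℚ n) ∎)
    where open import Relation.Binary.Reasoning.Setoid ℚᵘₚ.≃-setoid

ℚ-inverse : ∀ q → q ≢ ℚ.0ℚ → ∃ λ i → i ℚ.* q ≡ ℚ.1ℚ
ℚ-inverse q q≢0 = ℚ.1/_ q {{ℚ.≢-nonZero q≢0}} , ℚₚ.*-inverseˡ q {{ℚ.≢-nonZero q≢0}}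

ℤ⇒ℚ-≢0 : ∀ {a} → a ≢ + 0 → ℤ⇒ℚ a ≢ ℚ.0ℚ
ℤ⇒ℚ-≢0 a≢0 e = a≢0 (ℤ⇒ℚ-injective e)

positive≢0 : ∀ {N} → 0 < N → + N ≢ + 0
positive≢0 (s≤s _) ()

ℚ-algebra : ℤ-Algebra
ℚ-algebra = record
  { commutativeRing = ℚₚ.+-*-commutativeRing
  ; int             = ℤ⇒ℚ
  ; isHomomorphism  = record
    { isSemiringHomomorphism = record
      { isNearSemiringHomomorphism = record
        { +-isMonoidHomomorphism = record
          { isMagmaHomomorphism = record
            { isRelHomomorphism = record { cong = ≡.cong ℤ⇒ℚ }
            ; homo = ℤ⇒ℚ-+ }
          ; ε-homo = ≡.refl }
        ; *-homo = ℤ⇒ℚ-* }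
      ; 1#-homo = ≡.refl }
    ; -‿homo = ℤ⇒ℚ-neg } }

module ℚP = PolynomialAlgebra ℚ-algebra

ℚX : ℤ-Algebra
ℚX = ℚP.polynomials

coeff-ι : ∀ p i → ℚ[x].coeff (ℤ[x]⇒ℚ[x] p) i ≡ ℤ⇒ℚ (coeff p i)
coeff-ι []      i       = ≡.refl
coeff-ι (a ∷ p) zero    = ≡.refl
coeff-ι (a ∷ p) (suc i) = coeff-ι p i

ι-add : ∀ p q → ℤ[x]⇒ℚ[x] (add p q) ℚP.≋ ℚ[x].add (ℤ[x]⇒ℚ[x] p) (ℤ[x]⇒ℚ[x] q)
ι-add p q i = ≡.trans (coeff-ι (add p q) i) (≡.trans (≡.cong ℤ⇒ℚ (ℤP.coeff-add p q i)) (≡.trans (ℤ⇒ℚ-+ (coeff p i) (coeff q i))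
  (≡.trans (≡.sym (≡.cong₂ ℚ._+_ (coeff-ι p i) (coeff-ι q i))) (≡.sym (ℚP.coeff-add (ℤ[x]⇒ℚ[x] p) (ℤ[x]⇒ℚ[x] q) i)))))

ι-mul : ∀ p q → ℤ[x]⇒ℚ[x] (mul p q) ℚP.≋ ℚ[x].mul (ℤ[x]⇒ℚ[x] p) (ℤ[x]⇒ℚ[x] q)
ι-mul p q i = ≡.trans (coeff-ι (mul p q) i) (go p i)
  where
  go : ∀ p i → ℤ⇒ℚ (coeff (mul p q) i) ≡ ℚ[x].coeff (ℚ[x].mul (ℤ[x]⇒ℚ[x] p) (ℤ[x]⇒ℚ[x] q)) i
  go []      i       = ≡.refl
  go (a ∷ p) zero    = ≡.trans (≡.cong ℤ⇒ℚ (ℤP.mul-zero a p q)) (≡.trans (ℤ⇒ℚ-* a (coeff q 0))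
    (≡.trans (≡.cong (ℤ⇒ℚ a ℚ.*_) (≡.sym (coeff-ι q 0))) (≡.sym (ℚP.mul-zero (ℤ⇒ℚ a) (ℤ[x]⇒ℚ[x] p) (ℤ[x]⇒ℚ[x] q)))))
  go (a ∷ p) (suc i) = ≡.trans (≡.cong ℤ⇒ℚ (ℤP.mul-suc a p q i)) (≡.trans (ℤ⇒ℚ-+ (a ℤ.* coeff q (suc i)) (coeff (mul p q) i)) (≡.trans (≡.cong₂ ℚ._+_
      (≡.trans (ℤ⇒ℚ-* a (coeff q (suc i))) (≡.cong (ℤ⇒ℚ a ℚ.*_) (≡.sym (coeff-ι q (suc i))))) (go p i))
    (≡.sym (ℚP.mul-suc (ℤ⇒ℚ a) (ℤ[x]⇒ℚ[x] p) (ℤ[x]⇒ℚ[x] q) i))))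

scalars : Homomorphism ℤX ℚX
scalars = record
  { ι      = ℤ[x]⇒ℚ[x]
  ; ι-cong = λ {x} {y} e i → ≡.trans (coeff-ι x i) (≡.trans (≡.cong ℤ⇒ℚ (e i)) (≡.sym (coeff-ι y i)))
  ; ι-+    = ι-add
  ; ι-*    = ι-mul
  ; ι-int  = λ a i → ≡.refl
  }

ι-injective : ∀ p q → ℤ[x]⇒ℚ[x] p ℚP.≋ ℤ[x]⇒ℚ[x] q → p ℤP.≋ q
ι-injective p q e i = ℤ⇒ℚ-injective (≡.trans (≡.sym (coeff-ι p i)) (≡.trans (e i) (coeff-ι q i)))

ι-monic : ∀ {N} f → MonicOfDegree N f → ℚ[x].MonicOfDegree N (ℤ[x]⇒ℚ[x] f)
ι-monic {N} f (top , rest) = ≡.trans (coeff-ι f N) (≡.cong ℤ⇒ℚ top) , λ i N<i → ≡.trans (coeff-ι f i) (≡.cong ℤ⇒ℚ (rest i N<i))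

polynomial-denominator : ∀ α → ∃₂ λ N h → 0 < N × (∀ i → ℤ⇒ℚ (+ N) ℚ.* ℚ[x].coeff α i ≡ ℤ⇒ℚ (coeff h i))
polynomial-denominator []      = 1 , [] , s≤s z≤n , λ i → ℚₚ.*-zeroʳ (ℤ⇒ℚ (+ 1))
polynomial-denominator (q ∷ α) with ℚ-denominator q | polynomial-denominator α
... | N , n , 0<N , Nq≡n | M , h , 0<M , Mα≡h = N ℕ.* M , + M ℤ.* n ∷ List.map (+ N ℤ.*_) h , ℕₚ.*-mono-< 0<N 0<M , λ
    { zero    → begin
        ℤ⇒ℚ (+ (N ℕ.* M)) ℚ.* q
          ≡⟨ ≡.cong (λ k → ℤ⇒ℚ k ℚ.* q) (≡.trans (≡.cong +_ (ℕₚ.*-comm N M)) (ℤₚ.pos-* M N)) ⟩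
        ℤ⇒ℚ (+ M ℤ.* + N) ℚ.* q             ≡⟨ ≡.cong (ℚ._* q) (ℤ⇒ℚ-* (+ M) (+ N)) ⟩
        ℤ⇒ℚ (+ M) ℚ.* ℤ⇒ℚ (+ N) ℚ.* q       ≡⟨ ℚₚ.*-assoc (ℤ⇒ℚ (+ M)) (ℤ⇒ℚ (+ N)) q ⟩
        ℤ⇒ℚ (+ M) ℚ.* (ℤ⇒ℚ (+ N) ℚ.* q)     ≡⟨ ≡.cong (ℤ⇒ℚ (+ M) ℚ.*_) Nq≡n ⟩
        ℤ⇒ℚ (+ M) ℚ.* ℤ⇒ℚ n                 ≡⟨ ℤ⇒ℚ-* (+ M) n ⟨
        ℤ⇒ℚ (+ M ℤ.* n) ∎
    ; (suc i) → begin
        ℤ⇒ℚ (+ (N ℕ.* M)) ℚ.* ℚ[x].coeff α i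
          ≡⟨ ≡.cong (λ k → ℤ⇒ℚ k ℚ.* ℚ[x].coeff α i) (ℤₚ.pos-* N M) ⟩
        ℤ⇒ℚ (+ N ℤ.* + M) ℚ.* ℚ[x].coeff α i            ≡⟨ ≡.cong (ℚ._* ℚ[x].coeff α i) (ℤ⇒ℚ-* (+ N) (+ M)) ⟩
        ℤ⇒ℚ (+ N) ℚ.* ℤ⇒ℚ (+ M) ℚ.* ℚ[x].coeff α i      ≡⟨ ℚₚ.*-assoc (ℤ⇒ℚ (+ N)) (ℤ⇒ℚ (+ M)) (ℚ[x].coeff α i) ⟩
        ℤ⇒ℚ (+ N) ℚ.* (ℤ⇒ℚ (+ M) ℚ.* ℚ[x].coeff α i)    ≡⟨ ≡.cong (ℤ⇒ℚ (+ N) ℚ.*_) (Mα≡h i) ⟩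
        ℤ⇒ℚ (+ N) ℚ.* ℤ⇒ℚ (coeff h i)              ≡⟨ ℤ⇒ℚ-* (+ N) (coeff h i) ⟨
        ℤ⇒ℚ (+ N ℤ.* coeff h i)                    ≡⟨ ≡.cong ℤ⇒ℚ (ℤP.coeff-scale (+ N) h i) ⟨
        ℤ⇒ℚ (coeff (List.map (+ N ℤ.*_) h) i) ∎ }
  where open ≡.≡-Reasoning

denominatorℚX : ∀ α → ∃₂ λ N h → 0 < N × ℤ-Algebra._≈_ ℚX (ℤ-Algebra._*_ ℚX (ℤ-Algebra.int ℚX (+ N)) α) (ℤ[x]⇒ℚ[x] h)
denominatorℚX α with polynomial-denominator α
... | N , h , 0<N , e = N , h , 0<N , λ i → ≡.trans (ℚP.mul-const (ℤ⇒ℚ (+ N)) α i) (≡.trans (e i) (≡.sym (coeff-ι h i)))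

inverseℚX : ∀ N → 0 < N → ∃ λ i → ℤ-Algebra._≈_ ℚX (ℤ-Algebra._*_ ℚX i (ℤ-Algebra.int ℚX (+ N))) (ℤ-Algebra.1# ℚX)
inverseℚX N 0<N with ℚ-inverse (ℤ⇒ℚ (+ N)) (ℤ⇒ℚ-≢0 (positive≢0 0<N))
... | i , e = ℚ[x].const i , λ { zero → ≡.trans (ℚP.mul-const i (ℚ[x].const (ℤ⇒ℚ (+ N))) 0) e
                               ; (suc j) → ≡.trans (ℚP.mul-const i (ℚ[x].const (ℤ⇒ℚ (+ N))) (suc j)) (ℚₚ.*-zeroʳ i) }

-- Divisibility by a monic polynomial over ℚ and over ℤ

module _ {P Q : ℤ-Algebra} (hom : Homomorphism P Q) where
  open Homomorphism hom

  module Descent {f : ℤ-Algebra.Carrier P} (reduction : Reduction P f)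
    (reduced-zeroᴼ : ∀ z → Reduction.Reduced reduction z → ℤ-Algebra._∣ᴿ_ Q (ι f) (ι z) → ℤ-Algebra._≈_ P z (ℤ-Algebra.0# P)) where

    open Reduction reduction

    private
      module P = ℤ-Algebra P
      module Q = ℤ-Algebra Q
      module S = Solver Q

    -- The remainder z₀ of the division over ℤ is again a multiple of f over ℚ, and a reduced
    -- multiple is zero. So the integral quotient q is the one over ℚ.
    descent : ∀ z → ι f Q.∣ᴿ ι z → f P.∣ᴿ z
    descent z (w , wf≈) with divide z
    ... | q , z₀ , z≈ , red = q , P.sym (P.trans z≈ (P.trans (P.+-congˡ z₀≈0) (P.+-identityʳ _)))
      where
      open import Relation.Binary.Reasoning.Setoid Q.setoid
      z₀≈0 : z₀ P.≈ P.0#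
      z₀≈0 = reduced-zeroᴼ z₀ red (w Q.- ι q , (begin
        (w Q.- ι q) Q.* ι f
          ≈⟨ S.solve 3 (λ w q f → (w S.:- q) S.:* f S.:= w S.:* f S.:- q S.:* f) Q.refl w (ι q) (ι f) ⟩
        w Q.* ι f Q.- ι q Q.* ι f
          ≈⟨ Q.+-congʳ (Q.trans wf≈ (Q.trans (ι-cong z≈) (Q.trans (ι-+ _ z₀) (Q.+-congʳ (ι-* q f))))) ⟩
        ι q Q.* ι f Q.+ ι z₀ Q.- ι q Q.* ι f
          ≈⟨ S.solve 2 (λ u v → u S.:+ v S.:- u S.:= v) Q.refl (ι q Q.* ι f) (ι z₀) ⟩
        ι z₀ ∎))

module MonicDescent {N} (f : List ℤ) (monic : MonicOfDegree N f) where
  reduced-zeroᴼ : ∀ z → ℤP.Below N z → ℤ-Algebra._∣ᴿ_ ℚX (ℤ[x]⇒ℚ[x] f) (ℤ[x]⇒ℚ[x] z) → z ℤP.≋ []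
  reduced-zeroᴼ z b (w , e) = ι-injective z [] λ i → ≡.trans (≡.sym (e i)) (ℚP.mul-zeroˡ w (ℤ[x]⇒ℚ[x] f)
    (ℚP.below-multiple (ι-monic f monic) w λ j N≤j → ≡.trans (e j) (≡.trans (coeff-ι z j) (≡.cong ℤ⇒ℚ (b j N≤j)))) i)

  open Descent scalars (monic-reduction f monic) reduced-zeroᴼ public

-- Eisenstein's criterion

-- In the coefficient of index m + n every other product has a factor below index m in G or below
-- index n in H.
lowest-mul : ∀ p m n G H → (∀ i → i < m → p ∣ˢ coeff G i) → (∀ i → i < n → p ∣ˢ coeff H i) →
  p ∣ˢ coeff (mul G H) (m ℕ.+ n) ℤ.- coeff G m ℤ.* coeff H n
lowest-mul p m       n       []      H _  _  = divides (+ 0) ≡.refl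
lowest-mul p zero    zero    (a ∷ G) H _  _  = divides (+ 0) (≡.trans (≡.cong (ℤ._- a ℤ.* coeff H 0) (ℤP.mul-zero a G H)) (ℤₚ.+-inverseʳ (a ℤ.* coeff H 0)))
lowest-mul p zero    (suc n) (a ∷ G) H _  lH = subst (p ∣ˢ_) (≡.sym eq) (low G n ℕₚ.≤-refl)
  where
  low : ∀ G i → i < suc n → p ∣ˢ coeff (mul G H) i
  low []      i       _  = divides (+ 0) ≡.refl
  low (a ∷ G) zero    lt = subst (p ∣ˢ_) (≡.sym (ℤP.mul-zero a G H)) (Signed.∣n⇒∣m*n a (lH 0 lt))
  low (a ∷ G) (suc i) lt = subst (p ∣ˢ_) (≡.sym (ℤP.mul-suc a G H i))
    (Signed.∣m∣n⇒∣m+n (Signed.∣n⇒∣m*n a (lH (suc i) lt)) (low G i (ℕₚ.<-trans (ℕₚ.n<1+n i) lt)))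
  eq : coeff (mul (a ∷ G) H) (suc n) ℤ.- a ℤ.* coeff H (suc n) ≡ coeff (mul G H) n
  eq = ≡.trans (≡.cong (ℤ._- a ℤ.* coeff H (suc n)) (ℤP.mul-suc a G H n)) (cancel (a ℤ.* coeff H (suc n)) (coeff (mul G H) n))
    where
    cancel : ∀ u v → u ℤ.+ v ℤ.- u ≡ v
    cancel = solve 2 (λ u v → u :+ v :- u := v) ≡.refl
      where open +-*-Solver
lowest-mul p (suc m) n       (a ∷ G) H lG lH = subst (p ∣ˢ_) (≡.sym eq)
  (Signed.∣m∣n⇒∣m+n (Signed.∣m⇒∣m*n (coeff H (suc (m ℕ.+ n))) (lG 0 (s≤s z≤n))) (lowest-mul p m n G H (λ i lt → lG (suc i) (s≤s lt)) lH))
  where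
  eq : coeff (mul (a ∷ G) H) (suc (m ℕ.+ n)) ℤ.- coeff G m ℤ.* coeff H n
     ≡ a ℤ.* coeff H (suc (m ℕ.+ n)) ℤ.+ (coeff (mul G H) (m ℕ.+ n) ℤ.- coeff G m ℤ.* coeff H n)
  eq = ≡.trans (≡.cong (ℤ._- coeff G m ℤ.* coeff H n) (ℤP.mul-suc a G H (m ℕ.+ n))) (ℤₚ.+-assoc (a ℤ.* coeff H (suc (m ℕ.+ n))) (coeff (mul G H) (m ℕ.+ n)) (ℤ.- (coeff G m ℤ.* coeff H n)))

first-nondivisible : ∀ p (g : ℕ → ℤ) D → ¬ (p ∣ˢ g D) → ∃ λ i → i ≤ D × ¬ (p ∣ˢ g i) × (∀ j → j < i → p ∣ˢ g j)
first-nondivisible p g D p∤ with p ∣ˢ? g 0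
first-nondivisible p g D       p∤ | no p∤g₀ = 0 , z≤n , p∤g₀ , λ j ()
first-nondivisible p g zero    p∤ | yes p∣g₀ = contradiction p∣g₀ p∤
first-nondivisible p g (suc D) p∤ | yes p∣g₀ with first-nondivisible p (λ i → g (suc i)) D p∤
... | i , i≤D , p∤i , below = suc i , s≤s i≤D , p∤i , λ { zero _ → p∣g₀ ; (suc j) (s≤s lt) → below j lt }

divisible? : ∀ p G → (∃ λ G′ → ∀ i → coeff G i ≡ p ℤ.* coeff G′ i) ⊎ (∃ λ D → ¬ (p ∣ˢ coeff G D))
divisible? p []      = inj₁ ([] , λ i → ≡.sym (ℤₚ.*-zeroʳ p))
divisible? p (a ∷ G) with p ∣ˢ? a | divisible? p G
... | no p∤a            | _                = inj₂ (0 , p∤a)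
... | yes _             | inj₂ (D , p∤)    = inj₂ (suc D , p∤)
... | yes (divides q e) | inj₁ (G′ , eq)   = inj₁ (q ∷ G′ , λ { zero → ≡.trans e (ℤₚ.*-comm q p) ; (suc i) → eq i })

degree? : ∀ G → (∀ i → coeff G i ≡ + 0) ⊎ (∃ λ D → coeff G D ≢ + 0 × ℤP.Below (suc D) G)
degree? []      = inj₁ λ i → ≡.refl
degree? (a ∷ G) with degree? G | a ℤₚ.≟ + 0
... | inj₂ (D , ne , b) | _        = inj₂ (suc D , ne , λ { (suc i) (s≤s le) → b i le })
... | inj₁ G≡0          | yes a≡0  = inj₁ λ { zero → a≡0 ; (suc i) → G≡0 i }
... | inj₁ G≡0          | no a≢0   = inj₂ (0 , a≢0 , λ { (suc i) _ → G≡0 i })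

module Eisenstein {p : ℕ} (pr : Prime p) {f : List ℤ} {N : ℕ} (monic : MonicOfDegree N f)
  (p∣lower : ∀ i → i < N → + p ∣ˢ coeff f i) (p²∤f₀ : ¬ (+ p ℤ.* + p ∣ˢ coeff f 0)) where

  private
    instance _ = prime⇒nonZero pr

    quotient>0 : ∀ {n q} → 0 < n → n ≡ q ℕ.* p → 0 < q
    quotient>0 {q = zero}  0<n ≡.refl = 0<n
    quotient>0 {q = suc _} _   _      = s≤s z≤n

    quotient<n : ∀ {n q} → 0 < n → n ≡ q ℕ.* p → q < n
    quotient<n {n} {q} 0<n n≡ = subst (q <_) (≡.sym n≡) (ℕₚ.m<m*n q p {{ℕ.>-nonZero (quotient>0 0<n n≡)}} (prime≥2 pr))

    -- A factorisation over ℚ after clearing denominators: G H = n f.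
    Multiple : ℕ → List ℤ → List ℤ → Set
    Multiple n G H = ∀ i → coeff (mul G H) i ≡ + n ℤ.* coeff f i

    scaled : ∀ {G G′} → (∀ i → coeff G i ≡ + p ℤ.* coeff G′ i) → ∀ H i → coeff (mul G H) i ≡ + p ℤ.* coeff (mul G′ H) i
    scaled {G} {G′} e H i = ≡.trans (ℤP.mul-congˡ G (List.map (+ p ℤ.*_) G′) H (λ j → ≡.trans (e j) (≡.sym (ℤP.coeff-scale (+ p) G′ j))) i)
      (ℤP.coeff-mul-scale (+ p) G′ H i)

    constant-scale : ∀ {G G′} → (∀ i → coeff G i ≡ + p ℤ.* coeff G′ i) → ℤP.Below 1 G′ → ℤP.Below 1 G
    constant-scale e b i le = ≡.trans (e i) (≡.trans (≡.cong (+ p ℤ.*_) (b i le)) (ℤₚ.*-zeroʳ (+ p)))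

    cancelled : ∀ n {x y z} → x ≡ + p ℤ.* y → x ≡ + (n ℕ.* p) ℤ.* z → y ≡ + n ℤ.* z
    cancelled n {x} {y} {z} e e′ = ℤₚ.*-cancelˡ-≡ (+ p) y (+ n ℤ.* z) (≡.trans (≡.sym e) (≡.trans e′
      (≡.trans (≡.cong (λ k → + k ℤ.* z) (ℕₚ.*-comm n p)) (≡.trans (≡.cong (ℤ._* z) (ℤₚ.pos-* p n)) (ℤₚ.*-assoc (+ p) (+ n) z)))))

    difference : ∀ u v → u ℤ.- (u ℤ.- v) ≡ v
    difference = solve 2 (λ u v → u :- (u :- v) := v) ≡.refl
      where open +-*-Solver

    -- Gauss's lemma at the one prime p: the first coefficients of G and of H prime to p would
    -- produce a coefficient of n f prime to p.
    not-both : ∀ {n G H D E} → + p ∣ˢ + n → Multiple n G H → ¬ (+ p ∣ˢ coeff G D) → ¬ (+ p ∣ˢ coeff H E) → ∀ {A : Set} → A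
    not-both {n} {G} {H} {D} {E} p∣n eq p∤G p∤H with first-nondivisible (+ p) (coeff G) D p∤G | first-nondivisible (+ p) (coeff H) E p∤H
    ... | i , _ , p∤i , belowᵢ | j , _ , p∤j , belowⱼ = contradiction
      (euclidℤ pr (coeff G i) (coeff H j) (subst (+ p ∣ˢ_) (difference (coeff (mul G H) (i ℕ.+ j)) _)
        (Signed.∣m∣n⇒∣m-n (subst (+ p ∣ˢ_) (≡.sym (eq (i ℕ.+ j))) (Signed.∣m⇒∣m*n (coeff f (i ℕ.+ j)) p∣n)) (lowest-mul (+ p) i j G H belowᵢ belowⱼ))))
      [ p∤i , p∤j ]′

    module PrimeToLeading {n G H D E} (p∤n : ¬ (+ p ∣ˢ + n)) (eq : Multiple n G H)
      (G≢0 : coeff G D ≢ + 0) (belowG : ℤP.Below (suc D) G) (H≢0 : coeff H E ≢ + 0) (belowH : ℤP.Below (suc E) H) where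

      top : coeff (mul G H) (D ℕ.+ E) ≡ coeff G D ℤ.* coeff H E
      top = proj₁ (ℤP.below-mul-top {D} {E} G H belowG belowH)

      D+E≡N : D ℕ.+ E ≡ N
      D+E≡N with ℕₚ.<-cmp (D ℕ.+ E) N
      ... | tri≈ _ e _ = e
      ... | tri< lt _ _ = contradiction (subst (+ p ∣ˢ_) (≡.sym n≡0) (divides (+ 0) ≡.refl)) p∤n
        where
        n≡0 : + n ≡ + 0
        n≡0 = ≡.trans (≡.sym (ℤₚ.*-identityʳ (+ n))) (≡.trans (≡.cong (+ n ℤ.*_) (≡.sym (proj₁ monic)))
          (≡.trans (≡.sym (eq N)) (proj₂ (ℤP.below-mul-top {D} {E} G H belowG belowH) N lt)))
      ... | tri> _ _ gt = contradiction (ℤₚ.i*j≡0⇒i≡0∨j≡0 (coeff G D) (≡.trans (≡.sym top)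
              (≡.trans (eq (D ℕ.+ E)) (≡.trans (≡.cong (+ n ℤ.*_) (proj₂ monic (D ℕ.+ E) gt)) (ℤₚ.*-zeroʳ (+ n)))))) [ G≢0 , H≢0 ]′

      leading : coeff G D ℤ.* coeff H E ≡ + n
      leading = ≡.trans (≡.sym top) (≡.trans (eq (D ℕ.+ E)) (≡.trans (≡.cong (λ k → + n ℤ.* coeff f k) D+E≡N)
        (≡.trans (≡.cong (+ n ℤ.*_) (proj₁ monic)) (ℤₚ.*-identityʳ (+ n)))))

      p∤G : ¬ (+ p ∣ˢ coeff G D)
      p∤G d = p∤n (subst (+ p ∣ˢ_) leading (Signed.∣m⇒∣m*n (coeff H E) d))

      p∤H : ¬ (+ p ∣ˢ coeff H E)
      p∤H d = p∤n (subst (+ p ∣ˢ_) leading (Signed.∣n⇒∣m*n (coeff G D) d))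

      lowG = first-nondivisible (+ p) (coeff G) D p∤G
      lowH = first-nondivisible (+ p) (coeff H) E p∤H
      i = proj₁ lowG
      j = proj₁ lowH

      -- The coefficient of G H at index i + j is prime to p, whereas those of n f below N are
      -- divisible by p.
      N≤i+j : N ≤ i ℕ.+ j
      N≤i+j with (i ℕ.+ j) ℕ.<? N
      ... | no ≮ = ℕₚ.≮⇒≥ ≮
      ... | yes lt = contradiction (euclidℤ pr (coeff G i) (coeff H j) (subst (+ p ∣ˢ_) (difference (coeff (mul G H) (i ℕ.+ j)) _)
              (Signed.∣m∣n⇒∣m-n (subst (+ p ∣ˢ_) (≡.sym (eq (i ℕ.+ j))) (Signed.∣n⇒∣m*n (+ n) (p∣lower (i ℕ.+ j) lt)))
                (lowest-mul (+ p) i j G H (proj₂ (proj₂ (proj₂ lowG))) (proj₂ (proj₂ (proj₂ lowH)))))))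
              [ proj₁ (proj₂ (proj₂ lowG)) , proj₁ (proj₂ (proj₂ lowH)) ]′

      not-both-constant-terms : + p ∣ˢ coeff G 0 → + p ∣ˢ coeff H 0 → ∀ {A : Set} → A
      not-both-constant-terms (divides u u≡) (divides v v≡) = contradiction (prime-square-divides pr (+ n) (coeff f 0) p∤n
        (divides (u ℤ.* v) (≡.trans (≡.sym (eq 0)) (≡.trans (constant-term G H) (≡.trans (≡.cong₂ ℤ._*_ u≡ v≡) (swap u v (+ p))))))) p²∤f₀
        where
        constant-term : ∀ G H → coeff (mul G H) 0 ≡ coeff G 0 ℤ.* coeff H 0
        constant-term []      H = ≡.refl
        constant-term (a ∷ G) H = ℤP.mul-zero a G H
        swap : ∀ u v p → (u ℤ.* p) ℤ.* (v ℤ.* p) ≡ (u ℤ.* v) ℤ.* (p ℤ.* p)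
        swap = solve 3 (λ u v p → (u :* p) :* (v :* p) := (u :* v) :* (p :* p)) ≡.refl
          where open +-*-Solver

      -- i ≤ D, j ≤ E and D + E = N ≤ i + j force i = D and j = E. With both degrees positive, p
      -- divides both constant terms, against `p²∤f₀`.
      constant-factor : ℤP.Below 1 G ⊎ ℤP.Below 1 H
      constant-factor = by-degrees D E ≡.refl ≡.refl
        where
        D≤i : D ≤ i
        D≤i = ℕₚ.+-cancelʳ-≤ E D i (ℕₚ.≤-trans (ℕₚ.≤-reflexive D+E≡N) (ℕₚ.≤-trans N≤i+j (ℕₚ.+-monoʳ-≤ i (proj₁ (proj₂ lowH)))))
        E≤j : E ≤ j
        E≤j = ℕₚ.+-cancelˡ-≤ D E j (ℕₚ.≤-trans (ℕₚ.≤-reflexive D+E≡N) (ℕₚ.≤-trans N≤i+j (ℕₚ.+-monoˡ-≤ j (proj₁ (proj₂ lowG)))))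
        by-degrees : ∀ D′ E′ → D ≡ D′ → E ≡ E′ → ℤP.Below 1 G ⊎ ℤP.Below 1 H
        by-degrees zero     _        D≡ _  = inj₁ (subst (λ d → ℤP.Below (suc d) G) D≡ belowG)
        by-degrees (suc _)  zero     _  E≡ = inj₂ (subst (λ d → ℤP.Below (suc d) H) E≡ belowH)
        by-degrees (suc D′) (suc E′) D≡ E≡ = not-both-constant-terms
          (proj₂ (proj₂ (proj₂ lowG)) 0 (ℕₚ.≤-trans (subst (0 <_) (≡.sym D≡) (s≤s z≤n)) D≤i))
          (proj₂ (proj₂ (proj₂ lowH)) 0 (ℕₚ.≤-trans (subst (0 <_) (≡.sym E≡) (s≤s z≤n)) E≤j))

  -- Only the factors p are removed from n, by induction with `not-both`. Other primes may remain in
  -- the denominators, since Eisenstein's argument runs as soon as p does not divide n.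
  constant-factor : ∀ n G H → 0 < n → Multiple n G H → Acc _<_ n → ℤP.Below 1 G ⊎ ℤP.Below 1 H
  constant-factor n G H 0<n eq (acc rec) with p ∣? n
  constant-factor n G H 0<n eq (acc rec) | no p∤n with degree? G | degree? H
  ... | inj₁ G≡0 | _        = inj₁ λ i _ → G≡0 i
  ... | inj₂ _   | inj₁ H≡0 = inj₂ λ i _ → H≡0 i
  ... | inj₂ (D , G≢0 , belowG) | inj₂ (E , H≢0 , belowH) =
    PrimeToLeading.constant-factor {n} {G} {H} {D} {E} (λ p∣n → p∤n (∣⇒∣ᵤ p∣n)) eq G≢0 belowG H≢0 belowH
  constant-factor n G H 0<n eq (acc rec) | yes (ℕ∣.divides q n≡) with divisible? (+ p) G | divisible? (+ p) H
  ... | inj₁ (G′ , G≡) | _ = Sum.map₁ (constant-scale {G} {G′} G≡) (constant-factor q G′ H (quotient>0 0<n n≡)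
          (λ i → cancelled q (scaled {G} {G′} G≡ H i) (≡.trans (eq i) (≡.cong (λ k → + k ℤ.* coeff f i) n≡))) (rec (quotient<n 0<n n≡)))
  ... | inj₂ _ | inj₁ (H′ , H≡) = Sum.map₂ (constant-scale {H} {H′} H≡) (constant-factor q G H′ (quotient>0 0<n n≡)
          (λ i → cancelled q (≡.trans (ℤP.mul-comm G H i) (≡.trans (scaled {H} {H′} H≡ G i) (≡.cong (+ p ℤ.*_) (ℤP.mul-comm H′ G i))))
            (≡.trans (eq i) (≡.cong (λ k → + k ℤ.* coeff f i) n≡))) (rec (quotient<n 0<n n≡)))
  ... | inj₂ (D , p∤G) | inj₂ (E , p∤H) = not-both {n} {G} {H} {D} {E} (∣ᵤ⇒∣ (ℕ∣.divides q n≡)) eq p∤G p∤H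

  private
    constant∣1 : ∀ x y → (∀ i → ℚ[x].coeff (ℚ[x].mul x y) i ≡ ℚ[x].coeff (ℤ[x]⇒ℚ[x] f) i) →
      (∀ i → 1 ≤ i → ℚ[x].coeff x i ≡ ℚ.0ℚ) → x ℚ[x].divides ℚ[x].1#
    constant∣1 x y eq b = ℚ[x].const (proj₁ inv) , λ
      { zero    → ≡.trans (ℚP.mul-const (proj₁ inv) x 0) (proj₂ inv)
      ; (suc i) → ≡.trans (ℚP.mul-const (proj₁ inv) x (suc i)) (≡.trans (≡.cong (proj₁ inv ℚ.*_) (b (suc i) (s≤s z≤n))) (ℚₚ.*-zeroʳ (proj₁ inv))) }
      where
      x₀≢0 : ℚ[x].coeff x 0 ≢ ℚ.0ℚ
      x₀≢0 x₀≡0 = contradiction (ℤ⇒ℚ-injective {+ 1} {+ 0} (≡.trans (≡.cong ℤ⇒ℚ (≡.sym (proj₁ monic))) (≡.trans (≡.sym (coeff-ι f N))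
        (≡.trans (≡.sym (eq N)) (ℚP.mul-zeroˡ x y (λ { zero → x₀≡0 ; (suc i) → b (suc i) (s≤s z≤n) }) N))))) λ ()
      inv : ∃ λ i → i ℚ.* ℚ[x].coeff x 0 ≡ ℚ.1ℚ
      inv = ℚ-inverse (ℚ[x].coeff x 0) x₀≢0

    constant-numerator : ∀ x {n h} → 0 < n → (∀ i → ℤ⇒ℚ (+ n) ℚ.* ℚ[x].coeff x i ≡ ℤ⇒ℚ (coeff h i)) → ℤP.Below 1 h →
      ∀ i → 1 ≤ i → ℚ[x].coeff x i ≡ ℚ.0ℚ
    constant-numerator x {n} {h} 0<n e b i le with ℚ-inverse (ℤ⇒ℚ (+ n)) (ℤ⇒ℚ-≢0 (positive≢0 0<n))
    ... | v , vn≡1 = begin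
      ℚ[x].coeff x i                              ≡⟨ ℚₚ.*-identityˡ _ ⟨
      ℚ.1ℚ ℚ.* ℚ[x].coeff x i                     ≡⟨ ≡.cong (ℚ._* ℚ[x].coeff x i) vn≡1 ⟨
      v ℚ.* ℤ⇒ℚ (+ n) ℚ.* ℚ[x].coeff x i          ≡⟨ ℚₚ.*-assoc v _ _ ⟩
      v ℚ.* (ℤ⇒ℚ (+ n) ℚ.* ℚ[x].coeff x i)        ≡⟨ ≡.cong (v ℚ.*_) (≡.trans (e i) (≡.cong ℤ⇒ℚ (b i le))) ⟩
      v ℚ.* ℚ.0ℚ                                  ≡⟨ ℚₚ.*-zeroʳ v ⟩
      ℚ.0ℚ ∎
      where open ≡.≡-Reasoning

  irreducible : 0 < N → IrreducibleOverℚ f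
  irreducible 0<N = record { p∤1 = f∤1 ; split-∣1 = λ {x} {y} → split x y }
    where
    f∤1 : ¬ (ℤ[x]⇒ℚ[x] f ℚ[x].divides ℚ[x].1#)
    f∤1 (q , e) = contradiction (≡.trans (≡.sym (e 0)) (ℚP.mul-zeroˡ q (ℤ[x]⇒ℚ[x] f) q≋0 0)) λ ()
      where
      q≋0 : q ℚP.≋ []
      q≋0 = ℚP.below-multiple (ι-monic f monic) q λ i N≤i → ≡.trans (e i) (one-below i (ℕₚ.≤-trans 0<N N≤i))
        where
        one-below : ∀ i → 1 ≤ i → ℚ[x].coeff ℚ[x].1# i ≡ ℚ.0ℚ
        one-below (suc i) _ = ≡.refl
    split : ∀ x y → (∀ i → ℚ[x].coeff (ℤ[x]⇒ℚ[x] f) i ≡ ℚ[x].coeff (ℚ[x].mul x y) i) → x ℚ[x].divides ℚ[x].1# ⊎ y ℚ[x].divides ℚ[x].1#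
    split x y eq with polynomial-denominator x | polynomial-denominator y
    ... | n , g , 0<n , ex | m , h , 0<m , ey = Sum.map
        (λ b → constant∣1 x y (λ i → ≡.sym (eq i)) (constant-numerator x {n} {g} 0<n ex b))
        (λ b → constant∣1 y x (λ i → ≡.trans (ℚP.mul-comm y x i) (≡.sym (eq i))) (constant-numerator y {m} {h} 0<m ey b))
        (constant-factor (n ℕ.* m) g h (ℕₚ.*-mono-< 0<n 0<m) multiple (<-wellFounded (n ℕ.* m)))
      where
      open ≡.≡-Reasoning
      nx≋ : List.map (ℤ⇒ℚ (+ n) ℚ.*_) x ℚP.≋ ℤ[x]⇒ℚ[x] g
      nx≋ i = ≡.trans (ℚP.coeff-scale (ℤ⇒ℚ (+ n)) x i) (≡.trans (ex i) (≡.sym (coeff-ι g i)))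
      my≋ : List.map (ℤ⇒ℚ (+ m) ℚ.*_) y ℚP.≋ ℤ[x]⇒ℚ[x] h
      my≋ i = ≡.trans (ℚP.coeff-scale (ℤ⇒ℚ (+ m)) y i) (≡.trans (ey i) (≡.sym (coeff-ι h i)))
      multiple : ∀ i → coeff (mul g h) i ≡ + (n ℕ.* m) ℤ.* coeff f i
      multiple i = ℤ⇒ℚ-injective (begin
        ℤ⇒ℚ (coeff (mul g h) i)                                        ≡⟨ coeff-ι (mul g h) i ⟨
        ℚ[x].coeff (ℤ[x]⇒ℚ[x] (mul g h)) i                             ≡⟨ ι-mul g h i ⟩
        ℚ[x].coeff (ℚ[x].mul (ℤ[x]⇒ℚ[x] g) (ℤ[x]⇒ℚ[x] h)) i
          ≡⟨ ℚP.mul-cong {List.map (ℤ⇒ℚ (+ n) ℚ.*_) x} {ℤ[x]⇒ℚ[x] g} {List.map (ℤ⇒ℚ (+ m) ℚ.*_) y} {ℤ[x]⇒ℚ[x] h} nx≋ my≋ i ⟨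
        ℚ[x].coeff (ℚ[x].mul (List.map (ℤ⇒ℚ (+ n) ℚ.*_) x) (List.map (ℤ⇒ℚ (+ m) ℚ.*_) y)) i
          ≡⟨ ℚP.coeff-mul-scale (ℤ⇒ℚ (+ n)) x (List.map (ℤ⇒ℚ (+ m) ℚ.*_) y) i ⟩
        ℤ⇒ℚ (+ n) ℚ.* ℚ[x].coeff (ℚ[x].mul x (List.map (ℤ⇒ℚ (+ m) ℚ.*_) y)) i
          ≡⟨ ≡.cong (ℤ⇒ℚ (+ n) ℚ.*_) (≡.trans (ℚP.mul-comm x (List.map (ℤ⇒ℚ (+ m) ℚ.*_) y) i) (≡.trans (ℚP.coeff-mul-scale (ℤ⇒ℚ (+ m)) y x i) (≡.cong (ℤ⇒ℚ (+ m) ℚ.*_) (ℚP.mul-comm y x i)))) ⟩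
        ℤ⇒ℚ (+ n) ℚ.* (ℤ⇒ℚ (+ m) ℚ.* ℚ[x].coeff (ℚ[x].mul x y) i)      ≡⟨ ℚₚ.*-assoc (ℤ⇒ℚ (+ n)) (ℤ⇒ℚ (+ m)) _ ⟨
        ℤ⇒ℚ (+ n) ℚ.* ℤ⇒ℚ (+ m) ℚ.* ℚ[x].coeff (ℚ[x].mul x y) i
          ≡⟨ ≡.cong₂ ℚ._*_ (≡.trans (≡.sym (ℤ⇒ℚ-* (+ n) (+ m))) (≡.cong ℤ⇒ℚ (≡.sym (ℤₚ.pos-* n m)))) (≡.trans (≡.sym (eq i)) (coeff-ι f i)) ⟩
        ℤ⇒ℚ (+ (n ℕ.* m)) ℚ.* ℤ⇒ℚ (coeff f i)                          ≡⟨ ℤ⇒ℚ-* (+ (n ℕ.* m)) (coeff f i) ⟨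
        ℤ⇒ℚ (+ (n ℕ.* m) ℤ.* coeff f i) ∎)

-- The power basis

module PowerSums (K : ℤ-Algebra) where
  open ℤ-Algebra K
  open Evaluation K
  open import Algebra.Properties.Semiring.Sum semiring using (sum; sum-cong-≋; *-distribˡ-sum; sum-replicate-zero)
  open import Relation.Binary.Reasoning.Setoid setoid
  open Solver K

  evaluate≈sum : ∀ N z θ → ℤP.Below N z → evaluate z θ ≈ sum (λ (i : Fin N) → int (coeff z (toℕ i)) * θ ^ toℕ i)
  evaluate≈sum zero    z       θ b = evaluate-zero z θ (λ i → b i z≤n)
  evaluate≈sum (suc N) []      θ b = sym (trans (sum-cong-≋ {suc N} {λ i → int (+ 0) * θ ^ toℕ i} {λ _ → 0#} (λ i → trans (*-congʳ 0#-homo) (zeroˡ _))) (sum-replicate-zero (suc N)))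
  evaluate≈sum (suc N) (a ∷ z) θ b = +-cong (sym (*-identityʳ _)) (begin
    θ * evaluate z θ
      ≈⟨ *-congˡ (evaluate≈sum N z θ (λ i le → b (suc i) (s≤s le))) ⟩
    θ * sum (λ (i : Fin N) → int (coeff z (toℕ i)) * θ ^ toℕ i)
      ≈⟨ *-distribˡ-sum θ (λ (i : Fin N) → int (coeff z (toℕ i)) * θ ^ toℕ i) ⟩
    sum (λ (i : Fin N) → θ * (int (coeff z (toℕ i)) * θ ^ toℕ i))
      ≈⟨ sum-cong-≋ {N} (λ i → solve 3 (λ θ c x → θ :* (c :* x) := c :* (θ :* x))
          refl θ (int (coeff z (toℕ i))) (θ ^ toℕ i)) ⟩
    sum (λ (i : Fin N) → int (coeff z (toℕ i)) * (θ * θ ^ toℕ i)) ∎)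

  evaluate-tabulate : ∀ {N} (a : Vector ℤ N) θ → evaluate (List.tabulate a) θ ≈ sum (λ i → int (a i) * θ ^ toℕ i)
  evaluate-tabulate {zero}  a θ = refl
  evaluate-tabulate {suc N} a θ = +-cong (sym (*-identityʳ _)) (begin
    θ * evaluate (List.tabulate (a ∘ suc)) θ                       ≈⟨ *-congˡ (evaluate-tabulate (a ∘ suc) θ) ⟩
    θ * sum (λ i → int (a (suc i)) * θ ^ toℕ i)
      ≈⟨ *-distribˡ-sum θ (λ i → int (a (suc i)) * θ ^ toℕ i) ⟩
    sum (λ i → θ * (int (a (suc i)) * θ ^ toℕ i))
      ≈⟨ sum-cong-≋ {N} (λ i → solve 3 (λ θ c x → θ :* (c :* x) := c :* (θ :* x))
          refl θ (int (a (suc i))) (θ ^ toℕ i)) ⟩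
    sum (λ i → int (a (suc i)) * (θ * θ ^ toℕ i)) ∎)

coeff-tabulate : ∀ {N} (a : Vector ℤ N) i → coeff (List.tabulate a) (toℕ i) ≡ a i
coeff-tabulate a zero    = ≡.refl
coeff-tabulate a (suc i) = coeff-tabulate (a ∘ suc) i

below-tabulate : ∀ {N} (a : Vector ℤ N) → ℤP.Below N (List.tabulate a)
below-tabulate {zero}  a i       _        = ≡.refl
below-tabulate {suc N} a (suc i) (s≤s le) = below-tabulate (a ∘ suc) i le

-- The operations of Adjoin, known only through their recursion equations:
-- comparing them by unfolding over the concrete quotient ring is infeasible.
record AdjoinOperations (K : ℤ-Algebra) : Set where
  open ℤ-Algebra K
  field
    eval        : List ℤ → Carrier → Carrier
    eval-[]     : ∀ α → eval [] α ≈ 0#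
    eval-∷      : ∀ a g α → eval (a ∷ g) α ≈ int a + α * eval g α
    pow         : Carrier → ℕ → Carrier
    pow-zero    : ∀ α → pow α 0 ≈ 1#
    pow-suc     : ∀ α n → pow α (suc n) ≈ α * pow α n
    combine     : ∀ {n} → Vector ℤ n → Vector Carrier n → Carrier
    combine-nil : ∀ a v → combine {0} a v ≈ 0#
    combine-suc : ∀ {n} a v → combine {suc n} a v ≈ int (a zero) * v zero + combine (a ∘ suc) (v ∘ suc)

  open Evaluation K
  open PowerSums K
  open import Algebra.Properties.Semiring.Sum semiring using (sum; sum-cong-≋)

  eval≈evaluate : ∀ g α → eval g α ≈ evaluate g α
  eval≈evaluate []      α = eval-[] α
  eval≈evaluate (a ∷ g) α = trans (eval-∷ a g α) (+-congˡ (*-congˡ (eval≈evaluate g α)))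

  pow≈^ : ∀ α n → pow α n ≈ α ^ n
  pow≈^ α zero    = pow-zero α
  pow≈^ α (suc n) = trans (pow-suc α n) (*-congˡ (pow≈^ α n))

  combine≈sum : ∀ {n} a v → combine {n} a v ≈ sum (λ i → int (a i) * v i)
  combine≈sum {zero}  a v = combine-nil a v
  combine≈sum {suc n} a v = trans (combine-suc a v) (+-congˡ (combine≈sum (a ∘ suc) (v ∘ suc)))

  powers : Carrier → ∀ n → Vector Carrier n
  powers θ n i = pow θ (toℕ i)

  combine-powers≈sum : ∀ {n} a θ → combine a (powers θ n) ≈ sum (λ i → int (a i) * θ ^ toℕ i)
  combine-powers≈sum {n} a θ = trans (combine≈sum a (powers θ n)) (sum-cong-≋ {n} (λ i → *-congˡ (pow≈^ θ (toℕ i))))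

  combine-powers≈evaluate : ∀ {n} a θ → combine a (powers θ n) ≈ evaluate (List.tabulate a) θ
  combine-powers≈evaluate a θ = trans (combine-powers≈sum a θ) (sym (evaluate-tabulate a θ))

-- ℤ[x] / (f) seen through coefficient lists: every class has a representative of degree below N,
-- unique up to trailing zeros.
record Presentation (P : ℤ-Algebra) (x f : ℤ-Algebra.Carrier P) (N : ℕ) : Set where
  open ℤ-Algebra P
  module A = ℤ-Algebra (Quotient.A/⟨_⟩ P f)
  field
    poly        : List ℤ → Carrier
    poly-[]     : poly [] ≈ 0#
    poly-∷      : ∀ a z → poly (a ∷ z) ≈ int a + x * poly z
    digits      : ∀ h → ∃ λ z → ℤP.Below N z × h A.≈ poly z
    independent : ∀ z → ℤP.Below N z → poly z A.≈ 0# → ∀ i → coeff z i ≡ + 0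

module _ {P Q : ℤ-Algebra} (hom : Homomorphism P Q) where
  open Homomorphism hom

  module PowerBasis (f : ℤ-Algebra.Carrier P)
    (descent : ∀ z → ℤ-Algebra._∣ᴿ_ Q (ι f) (ι z) → ℤ-Algebra._∣ᴿ_ P f z)
    (denominator : ∀ α → ∃₂ λ N h → 0 < N × ℤ-Algebra._≈_ Q (ℤ-Algebra._*_ Q (ℤ-Algebra.int Q (+ N)) α) (ι h))
    (inverse : ∀ N → 0 < N → ∃ λ i → ℤ-Algebra._≈_ Q (ℤ-Algebra._*_ Q i (ℤ-Algebra.int Q (+ N))) (ℤ-Algebra.1# Q))
    (x : ℤ-Algebra.Carrier P) (N : ℕ) (presentation : Presentation P x f N)
    (operations : AdjoinOperations (Quotient.A/⟨_⟩ Q (ι f))) where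

    open Localisation hom f descent denominator inverse
    open Presentation presentation using (poly; poly-[]; poly-∷; digits; independent)
    open AdjoinOperations operations

    private
      module P = ℤ-Algebra P
      module Q = ℤ-Algebra Q
      module A = ℤ-Algebra ℤ[θ]
      module K = ℤ-Algebra ℚ[θ]
      lift≈ : ∀ {x y} → x Q.≈ y → x K.≈ y
      lift≈ = Quotient.≈⇒≈/ Q (Quotient.principal-isIdeal Q (ι f))
      θ : K.Carrier
      θ = ι x
      open Evaluation ℚ[θ] using (evaluate)
      open import Algebra.Properties.Semiring.Sum K.semiring using (sum; sum-cong-≋)
      open import Relation.Binary.Reasoning.Setoid K.setoid

      ι-poly : ∀ z → ι (poly z) K.≈ evaluate z θ
      ι-poly []      = K.trans (lift≈ (ι-cong poly-[])) (lift≈ ι-0)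
      ι-poly (a ∷ z) = K.trans (lift≈ (Q.trans (ι-cong (poly-∷ a z)) (Q.trans (ι-+ _ _) (Q.+-cong (ι-int a) (ι-* x _)))))
        (K.+-congˡ (K.*-congˡ (ι-poly z)))

      ι-power : ∀ n → ι (x P.^ n) K.≈ θ K.^ n
      ι-power n = subst (ι (x P.^ n) K.≈_) (≡.sym (Quotient.^-quotient Q (Quotient.principal-isIdeal Q (ι f)) θ n)) (lift≈ (ι-^ x n))

      spans : ∀ h → ∃ λ (a : Vector ℤ N) → ι h K.≈ sum (λ i → K.int (a i) K.* θ K.^ toℕ i)
      spans h with digits h
      ... | z , b , h∼ = (λ i → coeff z (toℕ i)) , (begin
        ι h              ≈⟨ ι-residue h∼ ⟩
        ι (poly z)       ≈⟨ ι-poly z ⟩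
        evaluate z θ     ≈⟨ PowerSums.evaluate≈sum ℚ[θ] N z θ b ⟩
        sum (λ (i : Fin N) → K.int (coeff z (toℕ i)) K.* θ K.^ toℕ i) ∎)

    u : Vector P.Carrier N
    u i = x P.^ toℕ i

    spans-ιu : ∀ γ h → Elimination.Spanned ℚ[θ] γ (λ j → ι (u j)) (ι h)
    spans-ιu γ h = proj₁ (spans h) , K.trans (proj₂ (spans h)) (sum-cong-≋ {N} (λ i → K.*-congˡ (K.sym (ι-power (toℕ i)))))

    polynomial-combination : ∀ {n} (a : Vector ℤ n) → combine a (powers θ n) K.≈ ι (poly (List.tabulate a))
    polynomial-combination a = K.trans (combine-powers≈evaluate a θ) (K.sym (ι-poly (List.tabulate a)))

    -- ℤ[θ] is spanned by finitely many powers, contains 1 and is stable under multiplication by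
    -- θ^i.
    powers-integral : ∀ i → ∃ λ g → (∃ λ n → MonicOfDegree n g) × eval g (pow θ i) K.≈ K.0#
    powers-integral i = conclude (integral-of-stable ιu (spanned-resp ιu (lift≈ ι-1) (spans-ιu γ P.1#))
        (λ j → spanned-resp ιu (K.trans (lift≈ (ι-* _ (u j))) (K.*-congʳ γ≈)) (spans-ιu γ (x P.^ i P.* u j))))
      where
      γ : K.Carrier
      γ = pow θ i
      γ≈ : ι (x P.^ i) K.≈ γ
      γ≈ = K.trans (ι-power i) (K.sym (pow≈^ θ i))
      open Elimination ℚ[θ] γ
      ιu : Vector K.Carrier N
      ιu j = ι (u j)
      conclude : (∃₂ λ e g → MonicOfDegree e g × evaluate g γ K.≈ K.0#) → ∃ λ g → (∃ λ n → MonicOfDegree n g) × eval g γ K.≈ K.0#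
      conclude (e , g , monic , root) = g , (e , monic) , K.trans (eval≈evaluate g γ) root

    powers-spanning : (∀ {p} → Prime p → MaximalAt P f p) → ∀ α → (∃ λ g → (∃ λ n → MonicOfDegree n g) × eval g α K.≈ K.0#) →
      ∃ λ a → α K.≈ combine a (powers θ N)
    powers-spanning maximal α (g , (n , monic) , root) = conclude (integral-is-polynomial maximal α n g monic (K.trans (K.sym (eval≈evaluate g α)) root))
      where
      conclude : (∃ λ h → α K.≈ ι h) → ∃ λ a → α K.≈ combine a (powers θ N)
      conclude (h , α≈) = proj₁ (spans h) , K.trans α≈ (K.trans (proj₂ (spans h)) (K.sym (combine-powers≈sum (proj₁ (spans h)) θ)))

    powers-independent : ∀ a → combine a (powers θ N) K.≈ K.0# → ∀ i → a i ≡ + 0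
    powers-independent a a≈0 i = ≡.trans (≡.sym (coeff-tabulate a i)) (independent (List.tabulate a) (below-tabulate a)
      (ι-residue⁻¹ (K.trans (K.sym (polynomial-combination a)) (K.trans a≈0 (K.sym (lift≈ ι-0))))) (toℕ i))

    -- If the integral element γ = r^(e+1) / p is a combination of powers of θ, then p divides
    -- r^(e+1) in ℤ[θ]. The number n of powers is left free, because `Monogenic` carries its own
    -- degree.
    spanning⇒divisible : ∀ {n p} (pr : Prime p) {r e c} → + p ∣ˢ c → Reduction P r → Expansion P p f r (suc e) c →
      (∀ α → (∃ λ g → (∃ λ n → MonicOfDegree n g) × eval g α K.≈ K.0#) → ∃ λ a → α K.≈ combine a (powers θ n)) →
      ∃ λ h → r P.^ suc e A.≈ P.int (+ p) P.* h
    spanning⇒divisible {n} {p} pr {r} {e} {c} (divides c′ c≡) reduction-r ex spanning = conclude (spanning γ (integral (γ-integral u (spans-ιu γ))))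
      where
      open NonMaximal hom f descent denominator inverse pr (≡.trans c≡ (ℤₚ.*-comm c′ (+ p))) reduction-r ex
      integral : (∃₂ λ d g → MonicOfDegree d g × evaluate g γ K.≈ K.0#) → ∃ λ g → (∃ λ n → MonicOfDegree n g) × eval g γ K.≈ K.0#
      integral (d , g , monic , root) = g , (d , monic) , K.trans (eval≈evaluate g γ) root
      conclude : (∃ λ a → γ K.≈ combine a (powers θ n)) → ∃ λ h → r P.^ suc e A.≈ P.int (+ p) P.* h
      conclude (a , γ≈) = poly (List.tabulate a) , γ-polynomial⇒ (poly (List.tabulate a)) (K.trans γ≈ (polynomial-combination a))

-- Monic polynomials in ℤ[x] and the presentation of ℤ[θ]

coeff-X*-suc : ∀ q i → coeff (mul X q) (suc i) ≡ coeff q i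
coeff-X*-suc q i = ≡.trans (ℤP.mul-shift (const (+ 1)) q (suc i)) (ℤP.mul-identityˡ q i)

monic-X^ : ∀ n → MonicOfDegree n (ℤ-Algebra._^_ ℤX X n)
monic-X^ zero    = ≡.refl , λ { (suc i) _ → ≡.refl }
monic-X^ (suc n) = ≡.trans (coeff-X*-suc X^n n) (proj₁ (monic-X^ n)) , λ { (suc i) (s≤s lt) → ≡.trans (coeff-X*-suc X^n i) (proj₂ (monic-X^ n) i lt) }
  where X^n = ℤ-Algebra._^_ ℤX X n

monic-X : MonicOfDegree 1 X
monic-X = ≡.refl , λ { (suc (suc i)) _ → ≡.refl ; (suc zero) (s≤s ()) }

monic-^ : ∀ {d} r → MonicOfDegree d r → ∀ n → MonicOfDegree (n ℕ.* d) (ℤ-Algebra._^_ ℤX r n)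
monic-^ r monic zero    = ≡.refl , λ { (suc i) _ → ≡.refl }
monic-^ r monic (suc n) = monic-mul r (ℤ-Algebra._^_ ℤX r n) monic (monic-^ r monic n)

const-below : ∀ {n} → 0 < n → ∀ c → ℤP.Below n (const c)
const-below {suc n} _ c (suc i) _ = ≡.refl

monic-binomial : ∀ n → 0 < n → ∀ c → MonicOfDegree n (binomial ℤX X n c)
monic-binomial n 0<n c = monic-add (ℤ-Algebra._^_ ℤX X n) (const c) (monic-X^ n) (const-below 0<n c)

0<2k : ∀ {k} → 0 < k → 0 < 2 ℕ.* k
0<2k {k} 0<k = ℕₚ.*-mono-< {0} {2} {0} {k} (s≤s z≤n) 0<k

monic-trinomial : ∀ k → 0 < k → ∀ A b → MonicOfDegree (2 ℕ.* k) (trinomial ℤX X k A b)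
monic-trinomial k 0<k A b = monic-add (add (ℤ-Algebra._^_ ℤX X (2 ℕ.* k)) AX^k) (const b)
  (monic-add (ℤ-Algebra._^_ ℤX X (2 ℕ.* k)) AX^k (monic-X^ (2 ℕ.* k)) below-AX^k) (const-below (0<2k 0<k) b)
  where
  AX^k : List ℤ
  AX^k = mul (const A) (ℤ-Algebra._^_ ℤX X k)
  below-AX^k : ℤP.Below (2 ℕ.* k) AX^k
  below-AX^k i 2k≤i = ≡.trans (ℤP.mul-const A (ℤ-Algebra._^_ ℤX X k) i) (≡.trans (≡.cong (A ℤ.*_)
    (proj₂ (monic-X^ k) i (ℕₚ.<-≤-trans (ℕₚ.m<m+n k (ℕₚ.≤-trans 0<k (ℕₚ.≤-reflexive (≡.sym (ℕₚ.+-identityʳ k))))) 2k≤i))) (ℤₚ.*-zeroʳ A))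

monic-shifted : ∀ k → 0 < k → ∀ A b p → MonicOfDegree (2 ℕ.* k) (ℤ-Algebra._-_ ℤX (trinomial ℤX X k A b) (const p))
monic-shifted k 0<k A b p = monic-add (trinomial ℤX X k A b) (List.map ℤ.-_ (const p)) (monic-trinomial k 0<k A b) (const-below (0<2k 0<k) (ℤ.- p))

presentation : ∀ f {N} → MonicOfDegree N f → Presentation ℤX X f N
presentation f {N} monic = record
  { poly        = λ z → z
  ; poly-[]     = λ i → ≡.refl
  ; poly-∷      = ℤP.∷≋const+X*
  ; digits      = λ h → let (z , h∼z , b) = ReductionProperties.reduce (monic-reduction f monic) h in z , b , h∼z
  ; independent = λ z b z∼0 → Reduction.reduced-zero (monic-reduction f monic) z b (Quotient.≈0⇒∈ ℤX (Quotient.principal-isIdeal ℤX f) {z} z∼0)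
  }

adjoin-operations : ∀ f → AdjoinOperations (Quotient.A/⟨_⟩ ℚX (ℤ[x]⇒ℚ[x] f))
adjoin-operations f = record
  { eval        = A.eval
  ; eval-[]     = λ α → K.refl {[]}
  ; eval-∷      = λ a g α → K.refl {A.eval (a ∷ g) α}
  ; pow         = A._^′_
  ; pow-zero    = λ α → K.refl {ℚ[x].1#}
  ; pow-suc     = λ α n → K.refl {α A.^′ suc n}
  ; combine     = A.combination
  ; combine-nil = λ a v → K.refl {[]}
  ; combine-suc = λ a v → K.refl {A.combination a v}
  }
  where
  module K = ℤ-Algebra (Quotient.A/⟨_⟩ ℚX (ℤ[x]⇒ℚ[x] f))
  module A where
    open Adjoin f public
    open import Algebra.Definitions.RawSemiring (Algebra.Bundles.RawRing.rawSemiring ℚ⟨θ⟩) public using () renaming (_^_ to _^′_)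

-- After reduction of h both sides have degree below N and agree as polynomials; at index d this
-- reads 1 = p h₀(d).
monic-not-divisible : ∀ f {N} → MonicOfDegree N f → ∀ {p} → Prime p → ∀ s {d} → MonicOfDegree d s → d < N →
  ¬ ∃ λ h → ℤ-Algebra._≈_ (Quotient.A/⟨_⟩ ℤX f) s (ℤ-Algebra._*_ ℤX (ℤ-Algebra.int ℤX (+ p)) h)
monic-not-divisible f {N} monic-f {p} pr s {d} monic-s d<N (h , s∼ph) = prime∤1ℤ pr (divides (coeff h₀ d) (begin
    + 1                   ≡⟨ proj₁ monic-s ⟨
    coeff s d             ≡⟨ s≈ph₀ d ⟩
    coeff (P.int (+ p) P.* h₀) d ≡⟨ ℤP.mul-const (+ p) h₀ d ⟩
    + p ℤ.* coeff h₀ d    ≡⟨ ℤₚ.*-comm (+ p) (coeff h₀ d) ⟩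
    coeff h₀ d ℤ.* + p ∎))
  where
  open ≡.≡-Reasoning
  module P = ℤ-Algebra ℤX
  module A = ℤ-Algebra (Quotient.A/⟨_⟩ ℤX f)
  reduction = monic-reduction f monic-f
  reduced = ReductionProperties.reduce reduction h
  h₀ : List ℤ
  h₀ = proj₁ reduced
  s≈ph₀ : s P.≈ P.int (+ p) P.* h₀
  s≈ph₀ = ReductionProperties.reduced-unique reduction s (P.int (+ p) P.* h₀) (λ i N≤i → proj₂ monic-s i (ℕₚ.<-≤-trans d<N N≤i))
    (Reduction.reduced-scale reduction (+ p) h₀ (proj₂ (proj₂ reduced)))
    (A.trans {s} {P.int (+ p) P.* h} {P.int (+ p) P.* h₀} s∼ph (A.*-congˡ {P.int (+ p)} {h} {h₀} (proj₁ (proj₂ reduced))))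

module Basis (f : List ℤ) {N : ℕ} (monic : MonicOfDegree N f) =
  PowerBasis scalars f (MonicDescent.descent f monic) denominatorℚX inverseℚX X N (presentation f monic) (adjoin-operations f)

-- The two directions of the equivalence for the trinomial

module _ {m : ℤ} {b k : ℕ} (2≤b : 2 ≤ b) (H : Hypotheses m b k) where
  open Hypotheses H

  private
    f : List ℤ
    f = trinomial ℤX X k A (+ b)

    monic-f : MonicOfDegree (2 ℕ.* k) f
    monic-f = monic-trinomial k 0<k A (+ b)

    module B = Basis f monic-f

    lower-divisible : ∀ {p} → + p ∣ˢ + b → ∀ i → i < 2 ℕ.* k → + p ∣ˢ coeff f i
    lower-divisible {p} p∣b i i<2k = subst (+ p ∣ˢ_) (≡.sym coefficient)
      (Signed.∣m∣n⇒∣m+n (Signed.∣m⇒∣m*n (coeff X^k i) (Signed.∣m⇒∣m*n (m ℤ.^ 2) p∣b)) (constant i))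
      where
      module P = ℤ-Algebra ℤX
      X^2k X^k : List ℤ
      X^2k = X P.^ (2 ℕ.* k)
      X^k = X P.^ k
      lower-X^ : ∀ n i → i < n → coeff (X P.^ n) i ≡ + 0
      lower-X^ (suc n) zero    _        = ℤP.mul-shift (const (+ 1)) (X P.^ n) 0
      lower-X^ (suc n) (suc i) (s≤s lt) = ≡.trans (coeff-X*-suc (X P.^ n) i) (lower-X^ n i lt)
      constant : ∀ i → + p ∣ˢ coeff (const (+ b)) i
      constant zero    = p∣b
      constant (suc i) = divides (+ 0) ≡.refl
      coefficient : coeff f i ≡ A ℤ.* coeff X^k i ℤ.+ coeff (const (+ b)) i
      coefficient = ≡.trans (ℤP.coeff-add (X^2k P.+ P.int A P.* X^k) (const (+ b)) i) (≡.cong (ℤ._+ coeff (const (+ b)) i)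
        (≡.trans (ℤP.coeff-add X^2k (P.int A P.* X^k) i) (≡.trans (≡.cong₂ ℤ._+_ (lower-X^ (2 ℕ.* k) i i<2k) (ℤP.mul-const A X^k i)) (ℤₚ.+-identityˡ (A ℤ.* coeff X^k i)))))

    constant-coefficient : coeff f 0 ≡ + b
    constant-coefficient = ≡.trans (ℤP.coeff-add (X^2k P.+ P.int A P.* X^k) (const (+ b)) 0) (≡.trans (≡.cong (ℤ._+ + b)
        (≡.trans (ℤP.coeff-add X^2k (P.int A P.* X^k) 0) (≡.cong₂ ℤ._+_ (constant-X^ (2 ℕ.* k) (0<2k 0<k)) (≡.trans (ℤP.mul-const A X^k 0)
          (≡.trans (≡.cong (A ℤ.*_) (constant-X^ k 0<k)) (ℤₚ.*-zeroʳ A)))))) (ℤₚ.+-identityˡ (+ b)))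
      where
      module P = ℤ-Algebra ℤX
      X^2k X^k : List ℤ
      X^2k = X P.^ (2 ℕ.* k)
      X^k = X P.^ k
      constant-X^ : ∀ n → 0 < n → coeff (X P.^ n) 0 ≡ + 0
      constant-X^ (suc n) _ = ℤP.mul-shift (const (+ 1)) (X P.^ n) 0

    -- b ≥ 2 has a prime factor, and by squarefreeness of b any such factor is an Eisenstein prime
    -- of f.
    irreducible-f : IrreducibleOverℚ f
    irreducible-f with prime-factor-of b 2≤b
    ... | p , b′ , pr , b≡ = Eisenstein.irreducible pr monic-f (lower-divisible p∣b)
        (λ p²∣ → b-squarefree pr (subst (+ p ℤ.* + p ∣ˢ_) constant-coefficient p²∣)) (0<2k 0<k)
      where
      p∣b : + p ∣ˢ + b
      p∣b = divides (+ b′) (≡.trans (≡.cong +_ (≡.trans b≡ (ℕₚ.*-comm p b′))) (ℤₚ.pos-* b′ p))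

  monogenic : (∀ p → Prime p → 2 ∤ p → p ∣ k → ¬ Wieferich b p) → (+ 2 ∣ˢ m → + 4 ∣ˢ + b ℤ.- + 1) → Monogenic f
  monogenic no-Wieferich b≡1-mod-4 = record
    { degree      = 2 ℕ.* k
    ; monic       = monic-f
    ; irreducible = irreducible-f
    ; basis       = record
      { integral    = λ i → B.powers-integral (toℕ i)
      ; spanning    = B.powers-spanning λ {p} → AllPrimes.maximal-at ℤX X generated-by-X H
          (λ n 0<n c → monic-reduction (binomial ℤX X n c) (monic-binomial n 0<n c))
          (monic-reduction X monic-X)
          (monic-reduction f monic-f)
          (λ p → monic-reduction (ℤ-Algebra._-_ ℤX f (const (+ p))) (monic-shifted k 0<k A (+ b) (+ p)))
          no-Wieferich b≡1-mod-4 {p}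
      ; independent = B.powers-independent
      } }

  module _ (M : Monogenic f) where
    private
      open Monogenic M using (basis)
      open Adjoin.IsIntegralBasis basis using (spanning)

      -- r^(e+1) is monic of degree (e + 1) K, below 2k = (e + 2) K, so p cannot divide it in ℤ[θ].
      -- `k′` is k in the factored form that the expansions produce.
      no-divisor : ∀ {p} → Prime p → ∀ {K k′ e a c} → 0 < K → K ℕ.* suc (suc e) ≡ 2 ℕ.* k → k′ ≡ k → + p ∣ˢ c →
        ¬ Expansion ℤX p (trinomial ℤX X k′ A (+ b)) (binomial ℤX X K a) (suc e) c
      no-divisor {p} pr {K} {e = e} {a} {c} 0<K K≡ ≡.refl p∣c ex = monic-not-divisible f monic-f pr (ℤ-Algebra._^_ ℤX r (suc e))
          (monic-^ r monic-r (suc e)) degree< (B.spanning⇒divisible pr p∣c (monic-reduction r monic-r) ex spanning)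
        where
        r : List ℤ
        r = binomial ℤX X K a
        monic-r : MonicOfDegree K r
        monic-r = monic-binomial K 0<K a
        degree< : suc e ℕ.* K < 2 ℕ.* k
        degree< = subst (suc e ℕ.* K <_) (≡.trans (ℕₚ.*-comm (suc (suc e)) K) K≡) (ℕₚ.m<n+m (suc e ℕ.* K) 0<K)

    -- A single factor p of k is enough: f is the p-th power of r = x^(2k/p) + b modulo p, and
    -- r^(p-1) / p at θ is integral even if r has repeated factors modulo p. The index e is p - 2,
    -- as r occurs with exponent e + 2.
    monogenic⇒no-Wieferich : ∀ p → Prime p → 2 ∤ p → p ∣ k → ¬ Wieferich b p
    monogenic⇒no-Wieferich p pr 2∤p p∣k@(ℕ∣.divides k′ k≡) wieferich
      with Arithmetic.square∣A H p (k-radical pr p∣k) | Wieferich⇒ wieferich | p ℕ.∸ 2 | ℕₚ.m+[n∸m]≡n (prime≥2 pr)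
    ... | A′ , A≡ | divides w′ w≡ | e | ≡.refl = no-divisor pr
        {2 ℕ.* k′} {k′ ℕ.* p ℕ.^ 1} {e} {+ b} {ℤ.- (w′ ℤ.* + p)} 0<2k′ K≡
        (≡.trans (≡.cong (k′ ℕ.*_) (ℕₚ.*-identityʳ p)) (≡.sym k≡))
        (Signed.∣m⇒∣-m (Signed.∣n⇒∣m*n w′ Signed.∣-refl))
        (subst (λ e → Expansion ℤX p (trinomial ℤX X (k′ ℕ.* p ℕ.^ 1) A (+ b)) (binomial ℤX X (2 ℕ.* k′) (+ b)) e (ℤ.- (w′ ℤ.* + p))) (≡.cong (ℕ._∸ 1) (ℕₚ.*-identityʳ p))
          (BinomialExpansions.odd-expansion ℤX X pr 2∤p k′ 1 A≡
            (≡.trans (≡.cong (λ q → (+ b) ℤ.^ q ℤ.- + b) (ℕₚ.*-identityʳ p)) (≡.trans w≡ (≡.sym (ℤₚ.*-assoc w′ (+ p) (+ p)))))))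
      where
      0<k′ : ∀ k′ → k ≡ k′ ℕ.* p → 0 < k′
      0<k′ zero    eq = contradiction (subst (0 <_) eq 0<k) λ ()
      0<k′ (suc _) eq = s≤s z≤n
      0<2k′ : 0 < 2 ℕ.* k′
      0<2k′ = 0<2k (0<k′ k′ k≡)
      K≡ : 2 ℕ.* k′ ℕ.* p ≡ 2 ℕ.* k
      K≡ = ≡.trans (ℕₚ.*-assoc 2 k′ p) (≡.cong (2 ℕ.*_) (≡.sym k≡))

    -- b is odd, being coprime to m. If b ≡ 3 modulo 4, then (1 + b) / 2 is even and (θ^k + 1) / 2
    -- is an integral element outside ℤ[θ].
    monogenic⇒b≡1-mod-4 : + 2 ∣ˢ m → + 4 ∣ˢ + b ℤ.- + 1
    monogenic⇒b≡1-mod-4 2∣m with + 4 ∣ˢ? + b ℤ.- + 1 | + 4 ∣ˢ? + b ℤ.+ + 1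
    ... | yes 4∣b-1 | _ = 4∣b-1
    ... | no 4∤b-1 | no 4∤b+1 = contradiction (odd-mod-4 b) [ b-coprime-m′ , [ 4∤b-1 , 4∤b+1 ]′ ]′
      where
      b-coprime-m′ : ¬ (+ 2 ∣ˢ + b)
      b-coprime-m′ 2∣b = b-coprime-m prime[2] 2∣b 2∣m
      odd-mod-4 : ∀ b → + 2 ∣ˢ + b ⊎ + 4 ∣ˢ + b ℤ.- + 1 ⊎ + 4 ∣ˢ + b ℤ.+ + 1
      odd-mod-4 0 = inj₁ (divides (+ 0) ≡.refl)
      odd-mod-4 1 = inj₂ (inj₁ (divides (+ 0) ≡.refl))
      odd-mod-4 2 = inj₁ (divides (+ 1) ≡.refl)
      odd-mod-4 3 = inj₂ (inj₂ (divides (+ 1) ≡.refl))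
      odd-mod-4 (suc (suc (suc (suc b)))) with odd-mod-4 b
      ... | inj₁ 2∣b = inj₁ (Signed.∣m∣n⇒∣m+n {+ 2} {+ 4} (divides (+ 2) ≡.refl) 2∣b)
      ... | inj₂ (inj₁ d) = inj₂ (inj₁ (subst (+ 4 ∣ˢ_) (≡.sym (ℤₚ.+-assoc (+ 4) (+ b) (ℤ.- + 1))) (Signed.∣m∣n⇒∣m+n (Signed.∣-refl {+ 4}) d)))
      ... | inj₂ (inj₂ d) = inj₂ (inj₂ (subst (+ 4 ∣ˢ_) (≡.sym (ℤₚ.+-assoc (+ 4) (+ b) (+ 1))) (Signed.∣m∣n⇒∣m+n (Signed.∣-refl {+ 4}) d)))
    ... | no _ | yes (divides q b+1≡) with Arithmetic.square∣A H 2 2∣m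
    ...   | A′ , A≡ = contradiction (BinomialExpansions.even-expansion ℤX X k 0 {A} {+ b} {A′} {q ℤ.* + 2} A≡ 1+b≡)
        (no-divisor prime[2] {k} {k ℕ.* 1} {0} {+ 1} {q ℤ.* + 2} 0<k (ℕₚ.*-comm k 2) (ℕₚ.*-identityʳ k) (Signed.∣n⇒∣m*n q Signed.∣-refl))
      where
      1+b≡ : + 1 ℤ.+ + b ≡ q ℤ.* + 2 ℤ.* + 2
      1+b≡ = ≡.trans (ℤₚ.+-comm (+ 1) (+ b)) (≡.trans b+1≡ (≡.sym (ℤₚ.*-assoc q (+ 2) (+ 2))))

-- The assumptions of the theorem, one prime at a time

prime∣⇒∣rad : ∀ {p k} → Prime p → 1 ≤ k → p ∣ k → p ∣ rad k
prime∣⇒∣rad {p} {k} pr 1≤k p∣k = ∈⇒∣product (∈-filter⁺ (λ p → prime? p ×-dec (p ∣? k))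
  (∈-upTo⁺ (s≤s (ℕ∣.∣⇒≤ {{ℕ.>-nonZero 1≤k}} p∣k))) (pr , p∣k))

prime∣product-of-powers : ∀ {p} → Prime p → ∀ {n} (e : ℕ → ℕ) qs → All (λ q → Prime q × q ∣ n) qs →
  p ∣ product (List.map (λ q → q ℕ.^ e q) qs) → p ∣ n
prime∣product-of-powers pr e []       []                  p∣ = contradiction p∣ (prime∤1 pr)
prime∣product-of-powers {p} pr {n} e (q ∷ qs) ((qp , q∣n) ∷ all) p∣ with euclidsLemma (q ℕ.^ e q) _ pr p∣
... | inj₂ p∣rest = prime∣product-of-powers pr e qs all p∣rest
... | inj₁ p∣q^e with prime⇒irreducible qp (prime∣power⇒∣ pr q (e q) p∣q^e)
...   | inj₁ p≡1 = contradiction (subst (_∣ 1) (≡.sym p≡1) ℕ∣.∣-refl) (prime∤1 pr)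
...   | inj₂ ≡.refl = q∣n

prime∤bmPart : ∀ {p} → Prime p → ∀ b m D → ¬ (+ p ∣ˢ + b) → ¬ (+ p ∣ˢ m) → p ∤ bmPart b m D
prime∤bmPart {p} pr b m D p∤b p∤m p∣ = [ (λ d → p∤b (∣ᵤ⇒∣ d)) , (λ d → p∤m (∣ᵤ⇒∣ d)) ]′ (euclidsLemma b ∣ m ∣ pr
  (prime∣product-of-powers pr (λ q → ν q D) (primeDivisors (b ℕ.* ∣ m ∣)) (all-filter (λ p → prime? p ×-dec (p ∣? (b ℕ.* ∣ m ∣))) (List.upTo (suc (b ℕ.* ∣ m ∣)))) p∣))

opaque
  -- The denominator is the square of the odd number 1 + 2 b m⁴, hence nonzero, and can be cancelled
  -- against `𝒟-integral`.
  𝒟-unique : ∀ b m D → Is𝒟 2 b m D → D ≡ + 4 ℤ.- + b ℤ.* m ℤ.^ 4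
  𝒟-unique b m D is𝒟 = ℤₚ.*-cancelʳ-≡ D (+ 4 ℤ.- + b ℤ.* m ℤ.^ 4) (𝒟-denominator 2 b m) {{ℤ.≢-nonZero denominator≢0}}
    (≡.trans is𝒟 (≡.sym (𝒟-integral b m)))
    where
    odd≢0 : ∀ t → + 1 ℤ.+ t ℤ.* + 2 ≢ + 0
    odd≢0 t e = prime∤1ℤ prime[2] (Signed.∣m+n∣n⇒∣m (divides (+ 0) e) (divides t ≡.refl))
    denominator≢0 : 𝒟-denominator 2 b m ≢ + 0
    denominator≢0 e with ℤₚ.i*j≡0⇒i≡0∨j≡0 (+ 1 ℤ.+ + b ℤ.* m ℤ.^ 4 ℤ.* + 2) e
    ... | inj₁ u≡0 = odd≢0 (+ b ℤ.* m ℤ.^ 4) u≡0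
    ... | inj₂ u≡0 = odd≢0 (+ b ℤ.* m ℤ.^ 4) (≡.trans (≡.sym (ℤₚ.*-identityʳ _)) u≡0)

hypotheses : ∀ m b k → 1 ≤ k → gcd (+ b) m ≡ + 1 → Squarefree b → (+ rad k) ∣ℤ m →
  ∀ D → Is𝒟 2 b m D → ∀ d → IsReduced𝒟 b m D d → Squarefree d → Hypotheses m b k
hypotheses m b k 1≤k coprime squarefree-b rad∣m D is𝒟 d reduced squarefree-d = record
  { 0<k          = 1≤k
  ; b-squarefree = λ {p} pr p²∣b → not-1 pr (squarefree-b p (subst (_∣ b) (ℤₚ.abs-* (+ p) (+ p)) (∣⇒∣ᵤ p²∣b)))
  ; b-coprime-m  = λ {p} pr p∣b p∣m → prime∤1 pr (subst (p ∣_) (ℤₚ.+-injective coprime) (ℕGCD.gcd-greatest (∣⇒∣ᵤ p∣b) (∣⇒∣ᵤ p∣m)))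
  ; k-radical    = λ pr p∣k → ∣ᵤ⇒∣ (ℕ∣.∣-trans (prime∣⇒∣rad pr 1≤k p∣k) rad∣m)
  -- ∣ D ∣ is d times `bmPart`, which is prime to p, so p² divides d.
  ; D-squarefree = λ {p} pr p∤b p∤m p²∣D → not-1 pr (squarefree-d p (subst (_∣ d) (ℤₚ.abs-* (+ p) (+ p))
      (∣⇒∣ᵤ (prime-square-divides pr (+ bmPart b m D) (+ d) (λ p∣ → prime∤bmPart pr b m D p∤b p∤m (∣⇒∣ᵤ p∣)) (p²∣product p p²∣D)))))
  }
  where
  not-1 : ∀ {p} → Prime p → ¬ p ≡ 1
  not-1 pr ≡.refl = prime∤1 pr ℕ∣.∣-refl
  p²∣product : ∀ p → + p ℤ.* + p ∣ˢ + 4 ℤ.- + b ℤ.* m ℤ.^ 4 → + p ℤ.* + p ∣ˢ + bmPart b m D ℤ.* + d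
  p²∣product p p²∣D = subst (+ p ℤ.* + p ∣ˢ_) (≡.trans (≡.cong +_ (≡.trans (≡.sym reduced) (ℕₚ.*-comm d (bmPart b m D)))) (ℤₚ.pos-* (bmPart b m D) d))
    (∣ᵤ⇒∣ (∣⇒∣ᵤ (subst (+ p ℤ.* + p ∣ˢ_) (≡.sym (𝒟-unique b m D is𝒟)) p²∣D)))

open import Data.Integer using (_-_)

theorem1p2 : (m : ℤ) (b k : ℕ) →
    2 ≤ ∣ m ∣ → 2 ≤ b → 1 ≤ k →
    gcd (+ b) m ≡ + 1 →
    Squarefree b →
    (+ rad k) ∣ℤ m →
    (D : ℤ) → Is𝒟 2 b m D →
    (d : ℕ) → IsReduced𝒟 b m D d →
    Squarefree d →
    Monogenic (ℱ₂ b m k) ⇔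
    ((∀ p → Prime p → 2 ∤ p → p ∣ k → ¬ Wieferich b p)
    × ((+ 2) ∣ℤ m → (+ 4) ∣ℤ (+ b - + 1)))
theorem1p2 m b k _ 2≤b 1≤k coprime squarefree-b rad∣m D is𝒟 d reduced squarefree-d = mk⇔
  (λ M → monogenic⇒no-Wieferich 2≤b H M , λ 2∣m → ∣⇒∣ᵤ (monogenic⇒b≡1-mod-4 2≤b H M (∣ᵤ⇒∣ 2∣m)))
  (λ (no-Wieferich , b≡1-mod-4) → monogenic 2≤b H no-Wieferich (λ 2∣m → ∣ᵤ⇒∣ (b≡1-mod-4 (∣⇒∣ᵤ 2∣m))))
  where
  H : Hypotheses m b k
  H = hypotheses m b k 1≤k coprime squarefree-b rad∣m D is𝒟 d reduced squarefree-d
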